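{- Let $m$ and $n$ be positive integers, let $k$ be an integer with $0\le k\le m$, and let $\kappa=m+n$. For $r\ge 0$ let $(m^r,k)$ denote the partition with $r$ parts equal to $m$ followed by one part equal to $k$ (omitted if $k=0$). Then, as formal power series in $q$, \[ \lim_{r\to\infty} q^{ -m\binom{r}{2}-kr} Q_{(m^r,k)}(1,q,q^2,\dots;q^n) =\frac{(q^n;q^n)_{\infty} (q^{\kappa};q^{\kappa})_{\infty}^{n-1}}{(q;q)_{\infty}^n} \prod_{i=1}^{n-1} \theta(q^{i+k};q^{\kappa}) \prod_{1\leq i<j\leq n-1} \theta(q^{j-i};q^{\kappa}). \]
   Context: For a partition $\lambda$, $l(\lambda)$ is the number of positive parts and $m_i=m_i(\lambda)$ is the multiplicity of parts equal to $i$. Notation: $(a;q)_k=(1-a)(1-aq)\cdots(1-aq^{k-1})$ for $k\in\{0,1,2,\dots\}\cup\{\infty\}$; $\theta(a;q)=(a;q)_\infty(q/a;q)_\infty$. The Hall–Littlewood polynomial in $N$ variables $x=(x_1,\dots,x_N)$ with parameter $t$ is $P_\lambda(x;t)=\frac{1}{v_\lambda(t)}\sum_{w\in S_N} w\Big(x_1^{\lambda_1}\cdots x_N^{\lambda_N}\prod_{i<j}\frac{x_i-tx_j}{x_i-x_j}\Big)$ for $l(\lambda)\le N$, where $S_N$ permutes the variables and $v_\lambda(t)=\prod_{i=0}^N (t;t)_{m_i}/(1-t)^{m_i}$ with $m_0=N-l(\lambda)$; $P_\lambda(x;t)=0$ if $l(\lambda)>N$. These are stable under setting $x_N=0$ and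 so define symmetric functions in infinitely many variables. Further $Q_\lambda(x;t)=b_\lambda(t)P_\lambda(x;t)$ with $b_\lambda(t)=\prod_{i\ge1}(t;t)_{m_i(\lambda)}$. $Q_\lambda(1,q,q^2,\dots;t)$ denotes the specialisation $x_i=q^{i-1}$ ($i\ge1$), a formal power series in $q$; the limit is coefficientwise. -}

module Defs where

open import Data.Bool using (Bool; true; false; if_then_else_; not; _∧_)
open import Data.Nat as ℕ using (ℕ; zero; suc; _∸_; _<ᵇ_; _≡ᵇ_)
open import Data.Nat.Divisibility using (_∣?_)
open import Data.Nat.Combinatorics using (_C_)
open import Data.Integer as ℤ using (ℤ; +_; -[1+_])
open import Data.Fin using (Fin; toℕ)
open import Data.Fin.Properties using () renaming (_≟_ to _≟F_)
open import Data.List as L using (List; []; _∷_; _++_; map; concatMap; foldr; allFin; filterᵇ; upTo)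
open import Data.Vec as V using (Vec; lookup; tabulate; zipWith)
open import Data.Vec.Properties using (≡-dec)
open import Data.Product using (_×_; _,_)
open import Relation.Binary.PropositionalEquality using (_≡_)
open import Relation.Nullary.Decidable using (⌊_⌋)

sumℤ : List ℤ → ℤ
sumℤ = foldr ℤ._+_ (+ 0)

Series : Set
Series = ℕ → ℤ

_⊛_ : Series → Series → Series
(f ⊛ g) d = sumℤ (map (λ i → f i ℤ.* g (d ∸ i)) (upTo (suc d)))
infixl 7 _⊛_

oneS : Series
oneS zero    = + 1
oneS (suc _) = + 0

powS : Series → ℕ → Series
powS f zero    = oneS
powS f (suc k) = f ⊛ powS f k

prodS : List Series → Series
prodS = foldr _⊛_ oneS

oneMinusQ : ℕ → Series
oneMinusQ e d = (if d ≡ᵇ 0 then + 1 else + 0) ℤ.- (if d ≡ᵇ e then + 1 else + 0)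

-- (q^a ; q^c)_∞ = ∏_{j≥0} (1 - q^{a+cj}), for a ≥ 1, c ≥ 1.
-- Its coefficient of q^d equals that of the finite product over j ≤ d,
-- since the factors with j > d are ≡ 1 mod q^{d+1} (as a + c j > d).
pochInf : ℕ → ℕ → Series
pochInf a c d = prodS (map (λ j → oneMinusQ (a ℕ.+ c ℕ.* j)) (upTo (suc d))) d

-- θ(q^a ; q^c) = (q^a;q^c)_∞ (q^{c-a};q^c)_∞   (for 1 ≤ a < c)
thetaS : ℕ → ℕ → Series
thetaS a c = pochInf a c ⊛ pochInf (c ∸ a) c

-- 1/(1-q^j) = Σ_{l≥0} q^{jl}  (j ≥ 1)
geomS : ℕ → Series
geomS j d = if ⌊ j ∣? d ⌋ then + 1 else + 0

-- 1/(q;q)_∞ = ∏_{j≥1} 1/(1-q^j); coefficient of q^d only needs j ≤ d.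
invQQ : Series
invQQ d = prodS (map (λ j → geomS (suc j)) (upTo d)) d

range1 : ℕ → List ℕ
range1 n = map suc (upTo (n ∸ 1))

pairs1 : ℕ → List (ℕ × ℕ)
pairs1 n = concatMap (λ i → map (λ j → (i , j)) (filterᵇ (λ j → i <ᵇ j) (range1 n))) (range1 n)

rhsS : ℕ → ℕ → ℕ → Series
rhsS m n k =
  pochInf n n ⊛ powS (pochInf κ κ) (n ∸ 1) ⊛ powS invQQ n
  ⊛ prodS (map (λ i → thetaS (i ℕ.+ k) κ) (range1 n))
  ⊛ prodS (map (λ { (i , j) → thetaS (j ∸ i) κ }) (pairs1 n))
  where κ = m ℕ.+ n

coeffℤ : Series → ℤ → ℤ
coeffℤ f (+ d)      = f d
coeffℤ f -[1+ _ ]   = + 0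

-- Polynomials in ℤ[t][x_0,…,x_{N-1}] as finite lists of monomials
-- (coefficient, (t-exponent, x-exponent vector)); equal polynomials
-- are those with equal coefficient extraction.

Mono : ℕ → Set
Mono N = ℕ × Vec ℕ N

Poly : ℕ → Set
Poly N = List (ℤ × Mono N)

coeffP : ∀ {N} → Poly N → ℕ → Vec ℕ N → ℤ
coeffP p a e = sumℤ (map (λ { (c , (a' , e')) →
  if (a ℕ.≡ᵇ a') ∧ ⌊ ≡-dec ℕ._≟_ e e' ⌋ then c else + 0 }) p)

_≈P_ : ∀ {N} → Poly N → Poly N → Set
_≈P_ {N} p p' = ∀ (a : ℕ) (e : Vec ℕ N) → coeffP p a e ≡ coeffP p' a e

constP : ∀ {N} → ℤ → Poly N
constP c = (c , (0 , V.replicate _ 0)) ∷ []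

oneP : ∀ {N} → Poly N
oneP = constP (+ 1)

tP : ∀ {N} → Poly N
tP = (+ 1 , (1 , V.replicate _ 0)) ∷ []

xP : ∀ {N} → Fin N → Poly N
xP i = (+ 1 , (0 , tabulate (λ j → if ⌊ i ≟F j ⌋ then 1 else 0))) ∷ []

_+P_ : ∀ {N} → Poly N → Poly N → Poly N
_+P_ = _++_

negP : ∀ {N} → Poly N → Poly N
negP = map (λ { (c , m) → (ℤ.- c , m) })

_-P_ : ∀ {N} → Poly N → Poly N → Poly N
p -P q = p +P negP q

_*P_ : ∀ {N} → Poly N → Poly N → Poly N
p *P q = concatMap (λ { (c , (a , e)) →
           map (λ { (c' , (a' , e')) → (c ℤ.* c' , (a ℕ.+ a' , zipWith ℕ._+_ e e')) }) q }) p
infixl 7 _*P_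
infixl 6 _+P_ _-P_

prodP : ∀ {N} → List (Poly N) → Poly N
prodP = foldr _*P_ oneP

powP : ∀ {N} → Poly N → ℕ → Poly N
powP p zero    = oneP
powP p (suc k) = p *P powP p k

words : ∀ {A : Set} (L : ℕ) → List A → List (Vec A L)
words zero    xs = V.[] ∷ []
words (suc L) xs = concatMap (λ x → map (x V.∷_) (words L xs)) xs

elemF : ∀ {N} → Fin N → List (Fin N) → Bool
elemF i []       = false
elemF i (j ∷ js) = if ⌊ i ≟F j ⌋ then true else elemF i js

noDup : ∀ {N} → List (Fin N) → Bool
noDup []       = true
noDup (i ∷ is) = not (elemF i is) ∧ noDup is

perms : (N : ℕ) → List (Vec (Fin N) N)
perms N = filterᵇ (λ w → noDup (V.toList w)) (words N (allFin N))

ltPairs : (N : ℕ) → List (Fin N × Fin N)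
ltPairs N = concatMap (λ i → map (λ j → (i , j))
              (filterᵇ (λ j → toℕ i <ᵇ toℕ j) (allFin N))) (allFin N)

-- Hall–Littlewood P_λ(x_1..x_N ; t), λ given as a length-N vector
-- (padded with zeros).  With Δ = ∏_{i<j}(x_i - x_j) and w(Δ) = ±Δ,
--   P_λ = v_λ(t)^{-1} Σ_w w( x^λ ∏_{i<j} (x_i - t x_j)/(x_i - x_j) )
-- is equivalent (ℤ[t][x] being a domain) to
--   v_λ(t) Δ² P_λ = Σ_w w( x^λ ∏_{i<j}(x_i - t x_j) · Δ ).
-- Writing v_λ(t) = V_λ(t)/(1-t)^N with V_λ(t) = ∏_{i≥0} (t;t)_{m_i}
-- (note Σ_{i≥0} m_i = N), we clear the denominator.

tPoch : ∀ {N} → ℕ → Poly N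
tPoch m = prodP (map (λ j → oneP -P powP tP (suc j)) (upTo m))

mult : ∀ {N} → ℕ → Vec ℕ N → ℕ
mult i lam = L.length (filterᵇ (λ x → x ≡ᵇ i) (V.toList lam))

-- V_λ(t) = ∏_{i≥0} (t;t)_{m_i}  (i ranges over 0..|λ|, enough to cover all parts)
Vfac : ∀ {N} → Vec ℕ N → Poly N
Vfac lam = prodP (map (λ i → tPoch (mult i lam)) (upTo (suc (V.sum lam))))

bfac : ∀ {N} → Vec ℕ N → Poly N
bfac lam = prodP (map (λ i → tPoch (mult (suc i) lam)) (upTo (V.sum lam)))

Δ² : (N : ℕ) → Poly N
Δ² N = prodP (map (λ { (i , j) → powP (xP i -P xP j) 2 }) (ltPairs N))

wTerm : ∀ {N} → Vec ℕ N → Vec (Fin N) N → Poly N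
wTerm {N} lam w =
  prodP (map (λ i → powP (xP (lookup w i)) (lookup lam i)) (allFin N))
  *P prodP (map (λ { (i , j) →
         (xP (lookup w i) -P tP *P xP (lookup w j)) *P (xP (lookup w i) -P xP (lookup w j)) })
       (ltPairs N))

IsHallLittlewoodP : (N : ℕ) → Vec ℕ N → Poly N → Set
IsHallLittlewoodP N lam p =
  (Vfac lam *P Δ² N *P p) ≈P (powP (oneP -P tP) N *P concatMap (wTerm lam) (perms N))

-- Specialisation t = q^n, x_i = q^{i-1} (i ≥ 1), i.e. 0-indexed x_i ↦ q^i;
-- coefficient of q^d.

weight : ∀ {N} → Vec ℕ N → ℕ
weight e = V.sum (zipWith ℕ._*_ (tabulate toℕ) e)

specCoeff : ∀ {N} → ℕ → Poly N → ℕ → ℤ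
specCoeff n p d = sumℤ (map (λ { (c , (a , e)) →
  if (n ℕ.* a ℕ.+ weight e) ≡ᵇ d then c else + 0 }) p)

specCoeffℤ : ∀ {N} → ℕ → Poly N → ℤ → ℤ
specCoeffℤ n p (+ d)     = specCoeff n p d
specCoeffℤ n p -[1+ _ ]  = + 0

mrk : (m k r N : ℕ) → Vec ℕ N
mrk m k r N = tabulate (λ i → if toℕ i <ᵇ r then m else (if toℕ i ≡ᵇ r then k else 0))

shiftExp : (m k r : ℕ) → ℕ
shiftExp m k r = m ℕ.* (r C 2) ℕ.+ k ℕ.* r

{-# OPTIONS --safe #-}
-- Put t = q^n.  In the sum over permutations defining Q_λ(1, q, q², …; t) a term
-- vanishes unless the exponents in each residue class mod n appear in increasing
-- order.  Hence Q is a sum over walks y in ℕ^n that start at 0 and raise one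
-- coordinate at a time; with X_b = q^(b + n y_b), raising y_c has weight
-- ∏_{b≠c} X_c / (X_c - X_b).  Partial fractions give, by induction on r, the total
-- weight of the walks from 0 to y with r steps:
--   ± q^(-K_r) (t;t)_r q^(n e(y)) Δ(y) / (Δ(0) P(y)),
-- where Δ(y) is the Vandermonde product of the X_b, e(y) is the sum of the numbers
-- visited and P(y) = ∏_{b,c} (q^(n+c-b); q^n)_{y_c}.  Weighting the walks by
-- q^(m e(y)) P(y) and a last step by X_c^k turns the sum over y into the coefficient
-- of z^r in a determinant over power series in z.  Its entries are symmetric under
-- exchanging the modulus n and the residues 0, …, n-1 with the modulus κ and the
-- residues k+n-1, n-2, …, 0, so transposition yields the corresponding walk mod κ,
-- without the factor q^(m e(y)).  Up to high powers of q both walks stay balanced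
-- as r grows, so P(y) may be replaced by its limit, and the remaining infinite
-- products combine into theta functions.
module Submission where

open import Defs
open import Level using (0ℓ)
open import Algebra.Bundles using (CommutativeRing)
import Algebra.Solver.Ring as RingSolver
import Algebra.Solver.Ring.AlmostCommutativeRing as ACR
open import Data.Bool using (Bool; true; false; if_then_else_; not; _∧_; T)
open import Data.Nat as ℕ using (ℕ; zero; suc; z≤n; s≤s; _≤_; _<_; _∸_)
import Data.Nat.Properties as ℕₚ
import Data.Nat.ListAction as ℕL
import Data.Nat.Divisibility as ∣
open import Data.Nat.Solver using (module +-*-Solver)
open +-*-Solver using () renaming (solve to solveℕ; _:+_ to _⊕_; _:*_ to _⊗_; _:=_ to _⊜_; con to conℕ)
open import Data.Nat.Combinatorics using (_C_; nC1≡n; nCk+nC[k+1]≡[n+1]C[k+1])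
open import Data.Integer as ℤ using (ℤ; +_; -[1+_])
import Data.Integer.Properties as ℤₚ
open import Data.Fin as Fin using (Fin; toℕ)
import Data.Fin.Properties as Finₚ
open import Data.List as L using (List; []; _∷_; _++_; map; concatMap; length; upTo; allFin; downFrom; filterᵇ)
import Data.List.Properties as Lₚ
open import Data.List.Relation.Unary.All as All using (All; []; _∷_)
import Data.List.Relation.Unary.All.Properties as Allₚ
open import Data.List.Relation.Unary.AllPairs as AllPairs using (AllPairs; []; _∷_)
import Data.List.Relation.Unary.AllPairs.Properties as AllPairsₚ
import Data.List.Relation.Unary.Unique.Propositional.Properties as Uniqueₚ
open import Data.List.Relation.Binary.Permutation.Propositional as ↭ using (_↭_)
import Data.List.Relation.Binary.Permutation.Propositional.Properties as ↭ₚ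
open import Data.Vec as V using (Vec; lookup; tabulate)
import Data.Vec.Properties as Vₚ
open import Data.Maybe using (Maybe; just; nothing)
open import Data.Product using (_×_; _,_; proj₁; proj₂; ∃-syntax)
open import Data.Sum using (_⊎_; inj₁; inj₂)
open import Data.Empty using (⊥-elim)
open import Data.Unit using (⊤; tt)
open import Function using (_∘_; id; flip; const)
open import Relation.Binary using (tri<; tri≈; tri>)
open import Relation.Binary.PropositionalEquality as ≡ using (_≡_; _≢_)
import Relation.Binary.Reasoning.Setoid as SetoidReasoning
open import Relation.Nullary using (¬_; yes; no; Dec)
open import Relation.Nullary.Decidable using (⌊_⌋)

-- The weight of the walks is not stated endpoint by endpoint: `walk-formula` sums over all
-- endpoints against an arbitrary function `f`. So neither P(y) nor the Vandermonde products have to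
-- be inverted, and the induction may replace `f` by its image under a step. P(y) is inserted to
-- clear denominators; Q does not contain it, so it has to be removed again, and this is possible
-- only in the limit. The reasons for balance differ. In the walk mod n a coordinate that lags
-- leaves a small number unvisited, so e(y) exceeds its minimum r(r-1)/2 and q^(m e(y)) is small.
-- The walk mod κ has no such weight, but raising a coordinate far ahead of another brings in a
-- factor X_c / (X_c - X_b) divisible by a high power of q; since its step weights sum to 1, only
-- the limit of P(y) remains. The exponent m r(r-1)/2 + k r is the difference of the numbers K_r for
-- the moduli κ and n. With finitely many variables the arithmetic progressions end, and their ends
-- cause only errors of high order in q.

module Kit (R : CommutativeRing 0ℓ 0ℓ) where
  open CommutativeRing R hiding (zero)
  open import Algebra.Properties.Ring ring using (-‿distribˡ-*; -‿distribʳ-*; -‿involutive; -0#≈0#; -‿+-comm)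
  open import Algebra.Properties.Semiring.Mult.TCOptimised semiring using (×-homo-+; ×1-homo-*)
    renaming (_×_ to _⋆_)
  open SetoidReasoning setoid

  -- Integers in a commutative ring, as coefficients for the ring solver

  ι : ℤ → Carrier
  ι (+ n)    = n ⋆ 1#
  ι -[1+ n ] = - (suc n ⋆ 1#)

  suc⋆ : ∀ n → suc n ⋆ 1# ≈ 1# + n ⋆ 1#
  suc⋆ n = ×-homo-+ 1# 1 n

  cancel-1 : ∀ a b → (1# + a) - (1# + b) ≈ a - b
  cancel-1 a b = begin
    (1# + a) + - (1# + b)       ≈⟨ +-cong (+-comm 1# a) (sym (-‿+-comm 1# b)) ⟩
    (a + 1#) + (- 1# + - b)     ≈⟨ +-assoc a 1# _ ⟩
    a + (1# + (- 1# + - b))     ≈⟨ +-congˡ (sym (+-assoc _ _ _)) ⟩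
    a + ((1# + - 1#) + - b)     ≈⟨ +-congˡ (+-congʳ (-‿inverseʳ 1#)) ⟩
    a + (0# + - b)              ≈⟨ +-congˡ (+-identityˡ _) ⟩
    a + - b                     ∎

  ι-⊖ : ∀ m n → ι (m ℤ.⊖ n) ≈ m ⋆ 1# - n ⋆ 1#
  ι-⊖ m       zero    = sym (trans (+-congˡ -0#≈0#) (+-identityʳ _))
  ι-⊖ zero    (suc n) = sym (+-identityˡ _)
  ι-⊖ (suc m) (suc n) = begin
    ι (suc m ℤ.⊖ suc n)             ≡⟨ ≡.cong ι (ℤₚ.[1+m]⊖[1+n]≡m⊖n m n) ⟩
    ι (m ℤ.⊖ n)                     ≈⟨ ι-⊖ m n ⟩
    m ⋆ 1# - n ⋆ 1#                 ≈⟨ sym (cancel-1 _ _) ⟩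
    (1# + m ⋆ 1#) - (1# + n ⋆ 1#)   ≈⟨ sym (+-cong (suc⋆ m) (-‿cong (suc⋆ n))) ⟩
    suc m ⋆ 1# - suc n ⋆ 1#         ∎

  ι-+ : ∀ a b → ι (a ℤ.+ b) ≈ ι a + ι b
  ι-+ (+ m)    (+ n)    = ×-homo-+ 1# m n
  ι-+ (+ m)    -[1+ n ] = ι-⊖ m (suc n)
  ι-+ -[1+ m ] (+ n)    = trans (ι-⊖ n (suc m)) (+-comm _ _)
  ι-+ -[1+ m ] -[1+ n ] = begin
    - (suc (suc (m ℕ.+ n)) ⋆ 1#)       ≡⟨ ≡.cong (λ k → - (suc k ⋆ 1#)) (≡.sym (ℕₚ.+-suc m n)) ⟩
    - ((suc m ℕ.+ suc n) ⋆ 1#)         ≈⟨ -‿cong (×-homo-+ 1# (suc m) (suc n)) ⟩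
    - (suc m ⋆ 1# + suc n ⋆ 1#)        ≈⟨ sym (-‿+-comm _ _) ⟩
    - (suc m ⋆ 1#) + - (suc n ⋆ 1#)    ∎

  ι-neg : ∀ a → ι (ℤ.- a) ≈ - ι a
  ι-neg (+ zero)  = sym -0#≈0#
  ι-neg (+ suc n) = refl
  ι-neg -[1+ n ]  = sym (-‿involutive _)

  ι-pos* : ∀ m n → ι (+ m ℤ.* + n) ≈ ι (+ m) * ι (+ n)
  ι-pos* m n = trans (reflexive (≡.cong ι (≡.sym (ℤₚ.pos-* m n)))) (×1-homo-* m n)

  ι-* : ∀ a b → ι (a ℤ.* b) ≈ ι a * ι b
  ι-* (+ m)    (+ n)    = ι-pos* m n
  ι-* (+ m)    -[1+ n ] = begin
    ι (+ m ℤ.* -[1+ n ])       ≡⟨ ≡.cong ι (≡.sym (ℤₚ.neg-distribʳ-* (+ m) (+ suc n))) ⟩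
    ι (ℤ.- (+ m ℤ.* + suc n))  ≈⟨ ι-neg (+ m ℤ.* + suc n) ⟩
    - ι (+ m ℤ.* + suc n)      ≈⟨ -‿cong (ι-pos* m (suc n)) ⟩
    - (ι (+ m) * ι (+ suc n))  ≈⟨ -‿distribʳ-* _ _ ⟩
    ι (+ m) * ι -[1+ n ]       ∎
  ι-* -[1+ m ] (+ n)    = begin
    ι (-[1+ m ] ℤ.* + n)       ≡⟨ ≡.cong ι (≡.sym (ℤₚ.neg-distribˡ-* (+ suc m) (+ n))) ⟩
    ι (ℤ.- (+ suc m ℤ.* + n))  ≈⟨ ι-neg (+ suc m ℤ.* + n) ⟩
    - ι (+ suc m ℤ.* + n)      ≈⟨ -‿cong (ι-pos* (suc m) n) ⟩
    - (ι (+ suc m) * ι (+ n))  ≈⟨ -‿distribˡ-* _ _ ⟩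
    ι -[1+ m ] * ι (+ n)       ∎
  ι-* -[1+ m ] -[1+ n ] = begin
    (suc m ℕ.* suc n) ⋆ 1#           ≈⟨ ×1-homo-* (suc m) (suc n) ⟩
    suc m ⋆ 1# * suc n ⋆ 1#          ≈⟨ sym (-‿involutive _) ⟩
    - - (suc m ⋆ 1# * suc n ⋆ 1#)    ≈⟨ -‿cong (-‿distribʳ-* _ _) ⟩
    - (suc m ⋆ 1# * - (suc n ⋆ 1#))  ≈⟨ -‿distribˡ-* _ _ ⟩
    - (suc m ⋆ 1#) * - (suc n ⋆ 1#)  ∎

  ℤ-raw = CommutativeRing.rawRing ℤₚ.+-*-commutativeRing

  ℤ⟶R : ℤ-raw ACR.-Raw-AlmostCommutative⟶ ACR.fromCommutativeRing R
  ℤ⟶R = record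
    { ⟦_⟧ = ι ; +-homo = ι-+ ; *-homo = ι-* ; -‿homo = ι-neg ; 0-homo = refl ; 1-homo = refl }

  ι-≟ : ∀ a b → Maybe (ι a ≈ ι b)
  ι-≟ a b with a ℤ.≟ b
  ... | yes ≡.refl = just refl
  ... | no _       = nothing

  module S = RingSolver ℤ-raw (ACR.fromCommutativeRing R) ℤ⟶R ι-≟
  open S public using (solve; _:=_; _:+_; _:*_; _:-_; :-_; con)

  :1 : ∀ {n} → S.Polynomial n
  :1 = con (+ 1)

  -- Finite sums and products, sums over a marked entry, sums over antidiagonals

  sum : ∀ {A : Set} → (A → Carrier) → List A → Carrier
  sum f []       = 0#
  sum f (x ∷ xs) = f x + sum f xs

  prod : ∀ {A : Set} → (A → Carrier) → List A → Carrier
  prod f []       = 1#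
  prod f (x ∷ xs) = f x * prod f xs

  module _ {A : Set} where
    sum-congᴬ : ∀ {f g : A → Carrier} {xs} → All (λ x → f x ≈ g x) xs → sum f xs ≈ sum g xs
    sum-congᴬ []       = refl
    sum-congᴬ (e ∷ es) = +-cong e (sum-congᴬ es)

    sum-cong : ∀ {f g : A → Carrier} → (∀ x → f x ≈ g x) → ∀ xs → sum f xs ≈ sum g xs
    sum-cong e xs = sum-congᴬ (All.universal e xs)

    prod-congᴬ : ∀ {f g : A → Carrier} {xs} → All (λ x → f x ≈ g x) xs → prod f xs ≈ prod g xs
    prod-congᴬ []       = refl
    prod-congᴬ (e ∷ es) = *-cong e (prod-congᴬ es)

    prod-cong : ∀ {f g : A → Carrier} → (∀ x → f x ≈ g x) → ∀ xs → prod f xs ≈ prod g xs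
    prod-cong e xs = prod-congᴬ (All.universal e xs)

    sum-++ : ∀ (f : A → Carrier) xs ys → sum f (xs ++ ys) ≈ sum f xs + sum f ys
    sum-++ f []       ys = sym (+-identityˡ _)
    sum-++ f (x ∷ xs) ys = trans (+-congˡ (sum-++ f xs ys)) (sym (+-assoc _ _ _))

    prod-++ : ∀ (f : A → Carrier) xs ys → prod f (xs ++ ys) ≈ prod f xs * prod f ys
    prod-++ f []       ys = sym (*-identityˡ _)
    prod-++ f (x ∷ xs) ys = trans (*-congˡ (prod-++ f xs ys)) (sym (*-assoc _ _ _))

    prod-* : ∀ (f g : A → Carrier) xs → prod (λ x → f x * g x) xs ≈ prod f xs * prod g xs
    prod-* f g []       = sym (*-identityˡ _)
    prod-* f g (x ∷ xs) = trans (*-congˡ (prod-* f g xs))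
      (solve 4 (λ a b c d → (a :* b) :* (c :* d) := (a :* c) :* (b :* d)) refl _ _ _ _)

    prod-↭ : ∀ (f : A → Carrier) {xs ys} → xs ↭ ys → prod f xs ≈ prod f ys
    prod-↭ f ↭.refl         = refl
    prod-↭ f (↭.prep x p)   = *-congˡ (prod-↭ f p)
    prod-↭ f (↭.swap x y p) = trans (*-congˡ (*-congˡ (prod-↭ f p)))
      (solve 3 (λ a b c → a :* (b :* c) := b :* (a :* c)) refl _ _ _)
    prod-↭ f (↭.trans p q)  = trans (prod-↭ f p) (prod-↭ f q)

    prod-1 : ∀ {f : A → Carrier} xs → All (λ x → f x ≈ 1#) xs → prod f xs ≈ 1#
    prod-1 []       []       = refl
    prod-1 (x ∷ xs) (e ∷ es) = trans (*-cong e (prod-1 xs es)) (*-identityˡ _)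

    sum-0 : ∀ {f : A → Carrier} xs → (∀ x → f x ≈ 0#) → sum f xs ≈ 0#
    sum-0 []       e = refl
    sum-0 (x ∷ xs) e = trans (+-cong (e x) (sum-0 xs e)) (+-identityˡ _)

    sum-map : ∀ {B : Set} (f : B → Carrier) (g : A → B) xs → sum f (map g xs) ≡ sum (f ∘ g) xs
    sum-map f g []       = ≡.refl
    sum-map f g (x ∷ xs) = ≡.cong (λ z → f (g x) + z) (sum-map f g xs)

    prod-map : ∀ {B : Set} (f : B → Carrier) (g : A → B) xs → prod f (map g xs) ≡ prod (f ∘ g) xs
    prod-map f g []       = ≡.refl
    prod-map f g (x ∷ xs) = ≡.cong (λ z → f (g x) * z) (prod-map f g xs)

  sum-concatMap : ∀ {A B : Set} (f : B → Carrier) (g : A → List B) xs →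
    sum f (concatMap g xs) ≈ sum (λ x → sum f (g x)) xs
  sum-concatMap f g []       = refl
  sum-concatMap f g (x ∷ xs) = trans (sum-++ f (g x) _) (+-congˡ (sum-concatMap f g xs))

  prod-concatMap : ∀ {A B : Set} (f : B → Carrier) (g : A → List B) xs →
    prod f (concatMap g xs) ≈ prod (λ x → prod f (g x)) xs
  prod-concatMap f g []       = refl
  prod-concatMap f g (x ∷ xs) = trans (prod-++ f (g x) _) (*-congˡ (prod-concatMap f g xs))

  infixr 8 _^_
  _^_ : Carrier → ℕ → Carrier
  a ^ zero  = 1#
  a ^ suc n = a * a ^ n

  ^-cong : ∀ {a b} n → a ≈ b → a ^ n ≈ b ^ n
  ^-cong zero    e = refl
  ^-cong (suc n) e = *-cong e (^-cong n e)

  *-^ : ∀ a b n → (a * b) ^ n ≈ a ^ n * b ^ n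
  *-^ a b zero    = sym (*-identityˡ _)
  *-^ a b (suc n) = trans (*-congˡ (*-^ a b n))
    (solve 4 (λ a b c d → (a :* b) :* (c :* d) := (a :* c) :* (b :* d)) refl _ _ _ _)

  1^ : ∀ n → 1# ^ n ≈ 1#
  1^ zero    = refl
  1^ (suc n) = trans (*-identityˡ _) (1^ n)

  -- Sums over the ways to pick one entry of a list, remembering its position.
  Foc : Set → Set
  Foc A = List A → A → List A → Carrier

  foc : ∀ {A : Set} → Foc A → List A → Carrier
  foc f []       = 0#
  foc f (x ∷ xs) = f [] x xs + foc (λ p → f (x ∷ p)) xs

  module _ {A : Set} where
    -- Every marked list reassembles to the original one, so a property of the original list is
    -- available at each term.
    foc-congˢ : ∀ (P : List A → Set) {f g : Foc A} → (∀ p x q → P (p ++ x ∷ q) → f p x q ≈ g p x q) →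
      ∀ xs → P xs → foc f xs ≈ foc g xs
    foc-congˢ P e []       _  = refl
    foc-congˢ P e (x ∷ xs) px =
      +-cong (e [] x xs px) (foc-congˢ (P ∘ (x ∷_)) (λ p → e (x ∷ p)) xs px)

    foc-cong : ∀ {f g : Foc A} → (∀ p x q → f p x q ≈ g p x q) → ∀ xs → foc f xs ≈ foc g xs
    foc-cong e xs = foc-congˢ (const ⊤) (λ p x q _ → e p x q) xs tt

    foc-+ : ∀ (f g : Foc A) xs → foc (λ p x q → f p x q + g p x q) xs ≈ foc f xs + foc g xs
    foc-+ f g []       = sym (+-identityˡ _)
    foc-+ f g (x ∷ xs) = trans (+-congˡ (foc-+ _ _ xs))
      (solve 4 (λ a b c d → (a :+ b) :+ (c :+ d) := (a :+ c) :+ (b :+ d)) refl _ _ _ _)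

    *-foc : ∀ a (f : Foc A) xs → a * foc f xs ≈ foc (λ p x q → a * f p x q) xs
    *-foc a f []       = zeroʳ a
    *-foc a f (x ∷ xs) = trans (distribˡ _ _ _) (+-congˡ (*-foc a _ xs))

    foc-map : ∀ {B : Set} (g : B → A) (f : Foc A) xs →
      foc f (map g xs) ≈ foc (λ p x q → f (map g p) (g x) (map g q)) xs
    foc-map g f []       = refl
    foc-map g f (x ∷ xs) = +-congˡ (foc-map g (λ p → f (g x ∷ p)) xs)

    foc-++ : ∀ (f : Foc A) xs ys →
      foc f (xs ++ ys) ≈ foc (λ p x q → f p x (q ++ ys)) xs + foc (λ p → f (xs ++ p)) ys
    foc-++ f []       ys = sym (+-identityˡ _)
    foc-++ f (x ∷ xs) ys = trans (+-congˡ (foc-++ (λ p → f (x ∷ p)) xs ys)) (sym (+-assoc _ _ _))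

  -- The sum of `f a b` over a + b = r; the recursion keeps both indices at hand without
  -- subtraction.
  anti : (ℕ → ℕ → Carrier) → ℕ → Carrier
  anti f zero    = f 0 0
  anti f (suc r) = f 0 (suc r) + anti (λ a b → f (suc a) b) r

  anti-congˢ : ∀ {f g} r → (∀ a b → a ℕ.+ b ≡ r → f a b ≈ g a b) → anti f r ≈ anti g r
  anti-congˢ zero    e = e 0 0 ≡.refl
  anti-congˢ (suc r) e = +-cong (e 0 _ ≡.refl) (anti-congˢ r (λ a b p → e (suc a) b (≡.cong suc p)))

  anti-cong : ∀ {f g} → (∀ a b → f a b ≈ g a b) → ∀ r → anti f r ≈ anti g r
  anti-cong e r = anti-congˢ r (λ a b _ → e a b)

  anti-+ : ∀ f g r → anti (λ a b → f a b + g a b) r ≈ anti f r + anti g r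
  anti-+ f g zero    = refl
  anti-+ f g (suc r) = trans (+-congˡ (anti-+ _ _ r))
    (solve 4 (λ a b c d → (a :+ b) :+ (c :+ d) := (a :+ c) :+ (b :+ d)) refl _ _ _ _)

  *-anti : ∀ a f r → a * anti f r ≈ anti (λ x y → a * f x y) r
  *-anti a f zero    = refl
  *-anti a f (suc r) = trans (distribˡ _ _ _) (+-congˡ (*-anti a _ r))

  anti-last : ∀ f r → anti f (suc r) ≈ anti (λ a b → f a (suc b)) r + f (suc r) 0
  anti-last f zero    = refl
  anti-last f (suc r) = trans (+-congˡ (anti-last (λ a → f (suc a)) r)) (sym (+-assoc _ _ _))

  anti-flip : ∀ f r → anti f r ≈ anti (flip f) r
  anti-flip f zero    = refl
  anti-flip f (suc r) = trans (anti-last f r) (trans (+-congʳ (anti-flip _ r)) (+-comm _ _))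

  -- Both sides sum `F` over the triples with total `r`; this is associativity of the Cauchy
  -- product.
  anti-assoc : ∀ (F : ℕ → ℕ → ℕ → Carrier) r →
    anti (λ a b → anti (λ c d → F c d b) a) r ≈ anti (λ a b → anti (λ c d → F a c d) b) r
  anti-assoc F zero    = refl
  anti-assoc F (suc r) = begin
    F 0 0 (suc r) + anti (λ a b → F 0 (suc a) b + anti (λ c d → F (suc c) d b) a) r
      ≈⟨ +-congˡ (anti-+ _ _ r) ⟩
    F 0 0 (suc r) + (anti (λ a b → F 0 (suc a) b) r + anti (λ a b → anti (λ c d → F (suc c) d b) a) r)
      ≈⟨ +-congˡ (+-congˡ (anti-assoc (λ c → F (suc c)) r)) ⟩
    F 0 0 (suc r) + (anti (λ a b → F 0 (suc a) b) r + anti (λ a b → anti (λ c d → F (suc a) c d) b) r)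
      ≈⟨ sym (+-assoc _ _ _) ⟩
    anti (λ c d → F 0 c d) (suc r) + anti (λ a b → anti (λ c d → F (suc a) c d) b) r ∎

  anti-0 : ∀ {f} r → (∀ a b → f a b ≈ 0#) → anti f r ≈ 0#
  anti-0 zero    e = e 0 0
  anti-0 (suc r) e = trans (+-cong (e _ _) (anti-0 r (λ a → e (suc a)))) (+-identityˡ _)

-- Formal power series over a commutative ring

module PowerSeries (R : CommutativeRing 0ℓ 0ℓ) where
  open CommutativeRing R hiding (zero)
  open Kit R

  oneₚ : ℕ → Carrier
  oneₚ zero    = 1#
  oneₚ (suc _) = 0#

  _*ₚ_ : (ℕ → Carrier) → (ℕ → Carrier) → ℕ → Carrier
  (f *ₚ g) r = anti (λ a b → f a * g b) r

  *ₚ-comm : ∀ f g r → (f *ₚ g) r ≈ (g *ₚ f) r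
  *ₚ-comm f g r = trans (anti-flip _ r) (anti-cong (λ a b → *-comm _ _) r)

  *ₚ-assoc : ∀ f g h r → ((f *ₚ g) *ₚ h) r ≈ (f *ₚ (g *ₚ h)) r
  *ₚ-assoc f g h r = begin
    anti (λ a b → anti (λ c d → f c * g d) a * h b) r
      ≈⟨ anti-cong (λ a b → trans (*-comm _ _) (trans (*-anti _ _ a)
           (anti-cong (λ c d → trans (*-comm _ _) (*-assoc _ _ _)) a))) r ⟩
    anti (λ a b → anti (λ c d → f c * (g d * h b)) a) r
      ≈⟨ anti-assoc (λ c d b → f c * (g d * h b)) r ⟩
    anti (λ a b → anti (λ c d → f a * (g c * h d)) b) r
      ≈⟨ anti-cong (λ a b → sym (*-anti _ _ b)) r ⟩
    anti (λ a b → f a * anti (λ c d → g c * h d) b) r ∎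
    where open SetoidReasoning setoid

  *ₚ-identityˡ : ∀ f r → (oneₚ *ₚ f) r ≈ f r
  *ₚ-identityˡ f zero    = *-identityˡ _
  *ₚ-identityˡ f (suc r) =
    trans (+-cong (*-identityˡ _) (anti-0 r (λ _ _ → zeroˡ _))) (+-identityʳ _)

  *ₚ-distribˡ : ∀ f g h r → (f *ₚ (λ d → g d + h d)) r ≈ (f *ₚ g) r + (f *ₚ h) r
  *ₚ-distribˡ f g h r = trans (anti-cong (λ a b → distribˡ _ _ _) r) (anti-+ _ _ r)

  powerSeries : CommutativeRing 0ℓ 0ℓ
  powerSeries = record
    { Carrier = ℕ → Carrier
    ; _≈_ = λ f g → ∀ r → f r ≈ g r
    ; _+_ = λ f g r → f r + g r
    ; _*_ = _*ₚ_
    ; -_  = λ f r → - f r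
    ; 0#  = λ _ → 0#
    ; 1#  = oneₚ
    ; isCommutativeRing = record
      { isRing = record
        { +-isAbelianGroup = record
          { isGroup = record
            { isMonoid = record
              { isSemigroup = record
                { isMagma = record
                  { isEquivalence = record
                    { refl = λ _ → refl ; sym = λ e r → sym (e r) ; trans = λ e e′ r → trans (e r) (e′ r) }
                  ; ∙-cong = λ e e′ r → +-cong (e r) (e′ r) }
                ; assoc = λ f g h r → +-assoc _ _ _ }
              ; identity = (λ f r → +-identityˡ _) , (λ f r → +-identityʳ _) }
            ; inverse = (λ f r → -‿inverseˡ _) , (λ f r → -‿inverseʳ _)
            ; ⁻¹-cong = λ e r → -‿cong (e r) }
          ; comm = λ f g r → +-comm _ _ }
        ; *-cong = λ e e′ r → anti-cong (λ a b → *-cong (e a) (e′ b)) r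
        ; *-assoc = *ₚ-assoc
        ; *-identity = *ₚ-identityˡ , (λ f r → trans (*ₚ-comm f oneₚ r) (*ₚ-identityˡ f r))
        ; distrib = *ₚ-distribˡ , (λ f g h r → trans (*ₚ-comm _ f r)
            (trans (*ₚ-distribˡ f g h r) (+-cong (*ₚ-comm f g r) (*ₚ-comm f h r))))
        }
      ; *-comm = *ₚ-comm
      }
    }

-- Determinants by Laplace expansion over lists of rows and columns

module Det (R : CommutativeRing 0ℓ 0ℓ) where
  open CommutativeRing R hiding (zero)
  open Kit R
  open SetoidReasoning setoid

  -- The shape of one Laplace expansion: a signed sum over the choice of an entry, `g` receiving it
  -- together with the entries that remain.
  alt : ∀ {A : Set} → (A → List A → Carrier) → List A → Carrier
  alt g []       = 0#
  alt g (x ∷ xs) = g x xs - alt (λ y ys → g y (x ∷ ys)) xs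

  -- An arbitrary linear `Λ` covers both uses, convolution sums and sums over compositions.
  alt-lin : ∀ {I A : Set} (Λ : (I → Carrier) → Carrier) → (∀ f g → Λ (λ i → f i - g i) ≈ Λ f - Λ g) →
    Λ (λ _ → 0#) ≈ 0# → ∀ (h : I → A → List A → Carrier) xs →
    Λ (λ i → alt (h i) xs) ≈ alt (λ x q → Λ (λ i → h i x q)) xs
  alt-lin Λ Λ- Λ0 h []       = Λ0
  alt-lin Λ Λ- Λ0 h (x ∷ xs) = trans (Λ- _ _) (+-congˡ (-‿cong (alt-lin Λ Λ- Λ0 _ xs)))

  module _ {A : Set} where
    alt-cong : ∀ {f g : A → List A → Carrier} → (∀ x q → f x q ≈ g x q) → ∀ xs → alt f xs ≈ alt g xs
    alt-cong e []       = refl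
    alt-cong e (x ∷ xs) = +-cong (e x xs) (-‿cong (alt-cong (λ y ys → e y (x ∷ ys)) xs))

    alt-0 : ∀ xs → alt {A} (λ _ _ → 0#) xs ≈ 0#
    alt-0 []       = refl
    alt-0 (x ∷ xs) = trans (+-congˡ (-‿cong (alt-0 xs))) (-‿inverseʳ _)

    alt-- : ∀ (f g : A → List A → Carrier) xs →
      alt (λ x q → f x q - g x q) xs ≈ alt f xs - alt g xs
    alt-- f g []       = sym (-‿inverseʳ _)
    alt-- f g (x ∷ xs) = trans (+-congˡ (-‿cong (alt-- _ _ xs)))
      (solve 4 (λ a b c d → (a :- b) :- (c :- d) := (a :- c) :- (b :- d)) refl _ _ _ _)

    *-alt : ∀ a (f : A → List A → Carrier) xs → a * alt f xs ≈ alt (λ x q → a * f x q) xs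
    *-alt a f []       = zeroʳ a
    *-alt a f (x ∷ xs) =
      trans (solve 3 (λ a b c → a :* (b :- c) := a :* b :- a :* c) refl _ _ _)
            (+-congˡ (-‿cong (*-alt a _ xs)))

  alt-swap : ∀ {A B : Set} (h : A → List A → B → List B → Carrier) xs ys →
    alt (λ x q → alt (h x q) ys) xs ≈ alt (λ y q′ → alt (λ x q → h x q y q′) xs) ys
  alt-swap h []       ys = sym (alt-0 ys)
  alt-swap h (x ∷ xs) ys = trans (+-congˡ (-‿cong (alt-swap _ xs ys))) (sym (alt-- _ _ ys))

  module _ {A B : Set} where
    det : (A → B → Carrier) → List A → List B → Carrier
    det M []       []      = 1#
    det M []       (_ ∷ _) = 0#
    det M (a ∷ as) js      = alt (λ j js′ → M a j * det M as js′) js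

    det-cong : ∀ {M M′} → (∀ a j → M a j ≈ M′ a j) → ∀ as js → det M as js ≈ det M′ as js
    det-cong e []       []      = refl
    det-cong e []       (_ ∷ _) = refl
    det-cong e (a ∷ as) js      = alt-cong (λ j q → *-cong (e a j) (det-cong e as q)) js

    det-scale : ∀ w M as js → prod w as * det M as js ≈ det (λ a j → w a * M a j) as js
    det-scale w M []       []      = *-identityˡ _
    det-scale w M []       (_ ∷ _) = *-identityˡ _
    det-scale w M (a ∷ as) js      = trans (*-alt _ _ js) (alt-cong (λ j q → trans
      (solve 4 (λ a b c d → (a :* b) :* (c :* d) := (a :* c) :* (b :* d)) refl _ _ _ _)
      (*-congˡ (det-scale w M as q))) js)

    -- Expand along the first row, expand each minor along its first column by induction, and
    -- interchange the two signed sums.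
    det-column : ∀ M as j js → det M as (j ∷ js) ≈ alt (λ a as′ → M a j * det M as′ js) as
    det-column M []       j js = refl
    det-column M (a ∷ as) j js = +-congˡ (-‿cong (begin
      alt (λ j′ q → M a j′ * det M as (j ∷ q)) js
        ≈⟨ alt-cong (λ j′ q → trans (*-congˡ (det-column M as j q)) (*-alt _ _ as)) js ⟩
      alt (λ j′ q → alt (λ a′ as′ → M a j′ * (M a′ j * det M as′ q)) as) js
        ≈⟨ alt-swap _ js as ⟩
      alt (λ a′ as′ → alt (λ j′ q → M a j′ * (M a′ j * det M as′ q)) js) as
        ≈⟨ alt-cong (λ a′ as′ → trans (alt-cong (λ j′ q →
             solve 3 (λ a b c → a :* (b :* c) := b :* (a :* c)) refl _ _ _) js) (sym (*-alt _ _ js))) as ⟩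
      alt (λ a′ as′ → M a′ j * alt (λ j′ q → M a j′ * det M as′ q) js) as ∎))

  det-transpose : ∀ {A B : Set} (M : A → B → Carrier) as js → det M as js ≈ det (flip M) js as
  det-transpose M []       []       = refl
  det-transpose M (a ∷ as) []       = refl
  det-transpose M as       (j ∷ js) =
    trans (det-column M as j js) (alt-cong (λ a q → *-congˡ (det-transpose M q js)) as)

-- Sums over compositions, and coefficients of determinants of power series

module Compositions (R : CommutativeRing 0ℓ 0ℓ) where
  open CommutativeRing R hiding (zero)
  open Kit R
  open Det R
  open PowerSeries R
  open SetoidReasoning setoid

  size : ∀ {A : Set} → List (A × ℕ) → ℕ
  size []            = 0
  size ((_ , y) ∷ s) = y ℕ.+ size s

  up : ∀ {A : Set} → A × ℕ → A × ℕ
  up a = proj₁ a , suc (proj₂ a)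

  -- The sum of `f` over the weak compositions of `r` whose parts are labelled by the entries of
  -- `cs`.
  comps : ∀ {A : Set} → (List (A × ℕ) → Carrier) → List A → ℕ → Carrier
  comps f []       zero    = f []
  comps f []       (suc _) = 0#
  comps f (c ∷ cs) r       = anti (λ y r′ → comps (λ s → f ((c , y) ∷ s)) cs r′) r

  module _ {A : Set} where
    comps-congˢ : ∀ {f g : List (A × ℕ) → Carrier} cs r →
      (∀ s → map proj₁ s ≡ cs → size s ≡ r → f s ≈ g s) → comps f cs r ≈ comps g cs r
    comps-congˢ []       zero    e = e [] ≡.refl ≡.refl
    comps-congˢ []       (suc r) e = refl
    comps-congˢ (c ∷ cs) r       e = anti-congˢ r (λ y r′ y+r′ → comps-congˢ cs r′
      (λ s p q → e ((c , y) ∷ s) (≡.cong (c ∷_) p) (≡.trans (≡.cong (y ℕ.+_) q) y+r′)))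

    comps-cong : ∀ {f g : List (A × ℕ) → Carrier} cs r → (∀ s → f s ≈ g s) → comps f cs r ≈ comps g cs r
    comps-cong cs r e = comps-congˢ cs r (λ s _ _ → e s)

    *-comps : ∀ a (f : List (A × ℕ) → Carrier) cs r → a * comps f cs r ≈ comps (λ s → a * f s) cs r
    *-comps a f []       zero    = refl
    *-comps a f []       (suc r) = zeroʳ a
    *-comps a f (c ∷ cs) r       = trans (*-anti _ _ r) (anti-cong (λ y r′ → *-comps a _ cs r′) r)

    comps-+ : ∀ (f g : List (A × ℕ) → Carrier) cs r →
      comps (λ s → f s + g s) cs r ≈ comps f cs r + comps g cs r
    comps-+ f g []       zero    = refl
    comps-+ f g []       (suc r) = sym (+-identityˡ _)
    comps-+ f g (c ∷ cs) r       = trans (anti-cong (λ y r′ → comps-+ _ _ cs r′) r) (anti-+ _ _ r)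

    comps-0 : ∀ (f : List (A × ℕ) → Carrier) cs r → (∀ s → size s ≡ r → f s ≈ 0#) → comps f cs r ≈ 0#
    comps-0 f cs r e = begin
      comps f cs r                     ≈⟨ comps-congˢ cs r (λ s _ q → trans (e s q) (sym (zeroˡ _))) ⟩
      comps (λ s → 0# * f s) cs r      ≈⟨ sym (*-comps 0# f cs r) ⟩
      0# * comps f cs r                ≈⟨ zeroˡ _ ⟩
      0#                               ∎

    -- Moving one unit into a marked part is a bijection onto the marked
    -- compositions whose marked part is positive.
    comps-shift : ∀ (G : Foc (A × ℕ)) → (∀ p c q → G p (c , 0) q ≈ 0#) → ∀ cs r →
      comps (foc (λ p a q → G p (up a) q)) cs r ≈ comps (foc G) cs (suc r)
    comps-foc-0 : ∀ (G : Foc (A × ℕ)) → (∀ p c q → G p (c , 0) q ≈ 0#) → ∀ cs →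
      comps (foc G) cs 0 ≈ 0#

    comps-foc-0 G e []       = refl
    comps-foc-0 G e (c ∷ cs) = trans (comps-+ _ _ cs 0)
      (trans (+-cong (comps-0 _ cs 0 (λ s _ → e [] c s)) (comps-foc-0 _ (λ p → e ((c , 0) ∷ p)) cs))
             (+-identityˡ _))

    comps-shift G e []       zero    = refl
    comps-shift G e []       (suc r) = refl
    comps-shift G e (c ∷ cs) r       = begin
      anti (λ y r′ → comps (λ s → G [] (c , suc y) s + foc (λ p a q → G ((c , y) ∷ p) (up a) q) s) cs r′) r
        ≈⟨ anti-cong (λ y r′ → trans (comps-+ _ _ cs r′)
             (+-congˡ (comps-shift (λ p → G ((c , y) ∷ p)) (λ p → e _) cs r′))) r ⟩
      anti (λ y r′ → X (suc y) r′ + Y y (suc r′)) r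
        ≈⟨ anti-+ _ _ r ⟩
      anti (λ y r′ → X (suc y) r′) r + anti (λ y r′ → Y y (suc r′)) r
        -- The two terms added here vanish, one because its marked part is 0 and the other because
        -- its total is 0. They complete both sums to antidiagonals of `suc r`.
        ≈⟨ +-cong (sym (trans (+-congʳ (comps-0 _ cs (suc r) (λ s _ → e [] c s))) (+-identityˡ _)))
                  (sym (trans (+-congˡ (comps-foc-0 _ (λ p → e _) cs)) (+-identityʳ _))) ⟩
      (X 0 (suc r) + anti (λ y r′ → X (suc y) r′) r) + (anti (λ y r′ → Y y (suc r′)) r + Y (suc r) 0)
        ≈⟨ +-congˡ (sym (anti-last Y r)) ⟩
      anti X (suc r) + anti Y (suc r)
        ≈⟨ sym (anti-+ X Y (suc r)) ⟩
      anti (λ y r′ → X y r′ + Y y r′) (suc r)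
        ≈⟨ anti-cong (λ y r′ → sym (comps-+ (λ s → G [] (c , y) s) (foc (λ p → G ((c , y) ∷ p))) cs r′)) (suc r) ⟩
      comps (foc G) (c ∷ cs) (suc r) ∎
      where
      X Y : ℕ → ℕ → Carrier
      X y r′ = comps (λ s → G [] (c , y) s) cs r′
      Y y r′ = comps (foc (λ p → G ((c , y) ∷ p))) cs r′

  private
    a-b : ∀ a b → a - b ≈ a + (- 1#) * b
    a-b = solve 2 (λ a b → a :- b := a :+ (:- :1) :* b) refl

  module P = Det powerSeries

  -- Each row contributes some power of the series variable. The exponents form a composition of
  -- `r`, and by linearity the sum over it moves out of the signed sums.
  det-coefficient : ∀ {A B : Set} (N : A → B → ℕ → Carrier) cs js r →
    P.det N cs js r ≈ comps (λ s → det (λ a j → N (proj₁ a) j (proj₂ a)) s js) cs r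
  det-coefficient N []       []      zero    = refl
  det-coefficient N []       []      (suc r) = refl
  det-coefficient N []       (_ ∷ _) zero    = refl
  det-coefficient N []       (_ ∷ _) (suc r) = refl
  det-coefficient {A} {B} N (c ∷ cs) js      r       = begin
    P.alt (λ j q → N c j *ₚ P.det N cs q) js r
      ≈⟨ pointwise _ js ⟩
    alt (λ j q → anti (λ y r′ → N c j y * P.det N cs q r′) r) js
      ≈⟨ alt-cong (λ j q → anti-cong (λ y r′ →
           trans (*-congˡ (det-coefficient N cs q r′)) (*-comps _ _ cs r′)) r) js ⟩
    alt (λ j q → anti (λ y r′ → comps (λ s → N c j y * D s q) cs r′) r) js
      ≈⟨ sym (alt-lin (λ f → anti (λ y r′ → f (y , r′)) r) (λ f g → anti-- _ _) (anti-0 r (λ _ _ → refl)) _ js) ⟩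
    anti (λ y r′ → alt (λ j q → comps (λ s → N c j y * D s q) cs r′) js) r
      ≈⟨ anti-cong (λ y r′ → sym (alt-lin (λ f → comps f cs r′) (λ f g → comps-- f g r′)
           (comps-0 _ cs r′ (λ _ _ → refl)) _ js)) r ⟩
    anti (λ y r′ → comps (λ s → alt (λ j q → N c j y * D s q) js) cs r′) r ∎
    where
    D : List (A × ℕ) → List B → Carrier
    D = det (λ a j → N (proj₁ a) j (proj₂ a))
    pointwise : ∀ (g : B → List B → ℕ → Carrier) js → P.alt g js r ≈ alt (λ j q → g j q r) js
    pointwise g []       = refl
    pointwise g (j ∷ js) = +-congˡ (-‿cong (pointwise _ js))
    anti-- : ∀ f g → anti (λ a b → f a b - g a b) r ≈ anti f r - anti g r
    anti-- f g = trans (anti-cong (λ a b → a-b _ _) r) (trans (anti-+ _ _ r)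
      (trans (+-congˡ (sym (*-anti _ _ r))) (sym (a-b _ _))))
    comps-- : ∀ (f g : List (A × ℕ) → Carrier) r′ →
      comps (λ s → f s - g s) cs r′ ≈ comps f cs r′ - comps g cs r′
    comps-- f g r′ = trans (comps-cong cs r′ (λ s → a-b _ _)) (trans (comps-+ _ _ cs r′)
      (trans (+-congˡ (sym (*-comps _ _ cs r′))) (sym (a-b _ _))))

-- Partial fractions from two abstract relations

module PartialFractions (R : CommutativeRing 0ℓ 0ℓ) {A : Set} (ρ : A → A → CommutativeRing.Carrier R)
  (_#_ : A → A → Set)
  (ρ-sum : ∀ {a b} → a # b → CommutativeRing._≈_ R (CommutativeRing._+_ R (ρ a b) (ρ b a)) (CommutativeRing.1# R))
  (ρ-three : ∀ {c a b} → a # c → b # c → a # b →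
    CommutativeRing._≈_ R (CommutativeRing._*_ R (ρ c a) (ρ c b))
      (CommutativeRing._+_ R (CommutativeRing._*_ R (ρ c a) (ρ a b)) (CommutativeRing._*_ R (ρ c b) (ρ b a))))
  where
  open CommutativeRing R hiding (zero)
  open Kit R
  open SetoidReasoning setoid

  -- For `ρ c b` = X_c / (X_c - X_b) this is (X_c - s_b X_b) / (X_c - X_b).
  φ : (A → Carrier) → A → A → Carrier
  φ s c b = s b + (1# - s b) * ρ c b

  focus : ∀ {P : A → Set} p {c q} → All P (p ++ c ∷ q) → P c
  focus p h = All.head (Allₚ.++⁻ʳ p h)

  module _ (s : A → Carrier) where
    residue : Foc A
    residue p c q = (1# - s c) * prod (φ s c) (p ++ q)

    residue-at : A → Foc A
    residue-at x p c q = (1# - s c) * ρ c x * prod (φ s c) (p ++ q)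

    -- The partial fraction expansion of the product of (z - s_b X_b) / (z - X_b), evaluated at z =
    -- X_x. In the induction the three-term relation splits each residue of the longer list into
    -- residues relative to `x` and to `y`.
    foc-residue-at : ∀ x L → All (x #_) L → AllPairs _#_ L →
      prod (φ s x) L + foc (residue-at x) L ≈ 1#
    foc-residue-at x []       _        _        = +-identityʳ _
    foc-residue-at x (y ∷ L) (x#y ∷ x#L) (y#L ∷ L#) = begin
      φ s x y * prod (φ s x) L + ((1# - s y) * ρ y x * prod (φ s y) L
        + foc (λ p → residue-at x (y ∷ p)) L)
        ≈⟨ +-congˡ (+-congˡ (foc-congˢ (λ L → All (x #_) L × All (y #_) L)
             (λ p c q h → split (focus p (proj₁ h)) (focus p (proj₂ h)) (prod (φ s c) (p ++ q)))
             L (x#L , y#L))) ⟩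
      φ s x y * prod (φ s x) L + ((1# - s y) * ρ y x * prod (φ s y) L
        + foc (λ p c q → φ s x y * residue-at x p c q + (1# - s y) * ρ y x * residue-at y p c q) L)
        ≈⟨ +-congˡ (+-congˡ (trans (foc-+ _ _ L) (sym (+-cong (*-foc _ _ L) (*-foc _ _ L))))) ⟩
      φ s x y * prod (φ s x) L + ((1# - s y) * ρ y x * prod (φ s y) L
        + (φ s x y * foc (residue-at x) L + (1# - s y) * ρ y x * foc (residue-at y) L))
        ≈⟨ solve 6 (λ a b c d e f → a :* b :+ (c :* d :+ (a :* e :+ c :* f)) := a :* (b :+ e) :+ c :* (d :+ f)) refl _ _ _ _ _ _ ⟩
      φ s x y * (prod (φ s x) L + foc (residue-at x) L)
        + (1# - s y) * ρ y x * (prod (φ s y) L + foc (residue-at y) L)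
        ≈⟨ +-cong (*-congˡ (foc-residue-at x L x#L L#)) (*-congˡ (foc-residue-at y L y#L L#)) ⟩
      φ s x y * 1# + (1# - s y) * ρ y x * 1#
        ≈⟨ solve 3 (λ t a b → (t :+ (:1 :- t) :* a) :* :1 :+ (:1 :- t) :* b :* :1 := t :+ (:1 :- t) :* (a :+ b)) refl _ _ _ ⟩
      s y + (1# - s y) * (ρ x y + ρ y x)  ≈⟨ +-congˡ (*-congˡ (ρ-sum x#y)) ⟩
      s y + (1# - s y) * 1#               ≈⟨ solve 1 (λ t → t :+ (:1 :- t) :* :1 := :1) refl _ ⟩
      1# ∎
      where
      split : ∀ {c} → x # c → y # c → ∀ z →
        (1# - s c) * ρ c x * (φ s c y * z) ≈
        φ s x y * ((1# - s c) * ρ c x * z) + (1# - s y) * ρ y x * ((1# - s c) * ρ c y * z)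
      split {c} x#c y#c z = begin
        (1# - s c) * ρ c x * (φ s c y * z)
          ≈⟨ solve 5 (λ e t a b z → e :* a :* ((t :+ (:1 :- t) :* b) :* z) := e :* z :* (t :* a :+ (:1 :- t) :* (a :* b))) refl _ _ _ _ _ ⟩
        (1# - s c) * z * (s y * ρ c x + (1# - s y) * (ρ c x * ρ c y))
          ≈⟨ *-congˡ (+-congˡ (*-congˡ (ρ-three x#c y#c x#y))) ⟩
        (1# - s c) * z * (s y * ρ c x + (1# - s y) * (ρ c x * ρ x y + ρ c y * ρ y x))
          ≈⟨ solve 7 (λ e z t a b u v →
               e :* z :* (t :* a :+ (:1 :- t) :* (a :* u :+ b :* v)) :=
               (t :+ (:1 :- t) :* u) :* (e :* a :* z) :+ (:1 :- t) :* v :* (e :* b :* z)) refl _ _ _ _ _ _ _ ⟩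
        φ s x y * ((1# - s c) * ρ c x * z) + (1# - s y) * ρ y x * ((1# - s c) * ρ c y * z) ∎

    -- The same expansion at z = 0, where the product takes the value `prod s L`.
    foc-residue : ∀ L → AllPairs _#_ L → foc residue L + prod s L ≈ 1#
    foc-residue []      _           = +-identityˡ _
    foc-residue (x ∷ L) (x#L ∷ L#) = begin
      ((1# - s x) * prod (φ s x) L + foc (λ p → residue (x ∷ p)) L) + s x * prod s L
        ≈⟨ +-congʳ (+-congˡ (foc-cong (λ p c q →
             solve 4 (λ e t a z → e :* ((t :+ (:1 :- t) :* a) :* z) := t :* (e :* z) :+ (:1 :- t) :* (e :* a :* z))
               refl _ _ _ _) L)) ⟩
      ((1# - s x) * prod (φ s x) L + foc (λ p c q → s x * residue p c q + (1# - s x) * residue-at x p c q) L)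
        + s x * prod s L
        ≈⟨ +-congʳ (+-congˡ (trans (foc-+ _ _ L) (sym (+-cong (*-foc _ _ L) (*-foc _ _ L))))) ⟩
      ((1# - s x) * prod (φ s x) L + (s x * foc residue L + (1# - s x) * foc (residue-at x) L))
        + s x * prod s L
        ≈⟨ solve 5 (λ t a b c d → ((:1 :- t) :* a :+ (t :* b :+ (:1 :- t) :* c)) :+ t :* d
             := (:1 :- t) :* (a :+ c) :+ t :* (b :+ d)) refl _ _ _ _ _ ⟩
      (1# - s x) * (prod (φ s x) L + foc (residue-at x) L) + s x * (foc residue L + prod s L)
        ≈⟨ +-cong (*-congˡ (foc-residue-at x L x#L L#)) (*-congˡ (foc-residue L L#)) ⟩
      (1# - s x) * 1# + s x * 1#
        ≈⟨ solve 1 (λ t → (:1 :- t) :* :1 :+ t :* :1 := :1) refl _ ⟩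
      1# ∎

-- A ring containing the powers q^a = mon a of a cancellable element q,
-- over which 1 - q^a is invertible for a ≥ 1.
record QRing : Set₁ where
  field
    cring : CommutativeRing 0ℓ 0ℓ
  open CommutativeRing cring
  field
    mon        : ℕ → Carrier
    mon-0      : mon 0 ≈ 1#
    mon-+      : ∀ a b → mon (a ℕ.+ b) ≈ mon a * mon b
    mon-cancel : ∀ a {x y} → mon a * x ≈ mon a * y → x ≈ y
    geo        : ℕ → Carrier
    geo-inv    : ∀ {a} → 1 ≤ a → (1# - mon a) * geo a ≈ 1#

-- The fractions q^i / (q^i - q^j)

module QKit (Q : QRing) where
  open QRing Q
  open CommutativeRing cring hiding (zero)
  open Kit cring
  open SetoidReasoning setoid

  mon-≡ : ∀ {a b} → a ≡ b → mon a ≈ mon b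
  mon-≡ e = reflexive (≡.cong mon e)

  mon-∸ : ∀ {a b} → a ≤ b → mon b ≈ mon a * mon (b ∸ a)
  mon-∸ {a} a≤b = trans (mon-≡ (≡.sym (ℕₚ.m+[n∸m]≡n a≤b))) (mon-+ _ _)

  abstract
    -- ρ i j = q^i / (q^i - q^j)
    ρ : ℕ → ℕ → Carrier
    ρ i j with ℕₚ.<-cmp i j
    ... | tri< _ _ _ = geo (j ∸ i)
    -- A default where the fraction has no value; the relations for `ρ` are stated for distinct
    -- exponents.
    ... | tri≈ _ _ _ = 0#
    ... | tri> _ _ _ = - (mon (i ∸ j) * geo (i ∸ j))

    ρ-mul : ∀ {i j} → i ≢ j → (mon i - mon j) * ρ i j ≈ mon i
    ρ-mul {i} {j} i≢j with ℕₚ.<-cmp i j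
    ... | tri≈ _ e _ = ⊥-elim (i≢j e)
    ... | tri< i<j _ _ = begin
      (mon i - mon j) * geo (j ∸ i)                   ≈⟨ *-congʳ (+-congˡ (-‿cong (mon-∸ (ℕₚ.<⇒≤ i<j)))) ⟩
      (mon i - mon i * mon (j ∸ i)) * geo (j ∸ i)
        ≈⟨ solve 3 (λ a b c → (a :- a :* b) :* c := a :* ((:1 :- b) :* c)) refl _ _ _ ⟩
      mon i * ((1# - mon (j ∸ i)) * geo (j ∸ i))      ≈⟨ *-congˡ (geo-inv (ℕₚ.m<n⇒0<n∸m i<j)) ⟩
      mon i * 1#                                      ≈⟨ *-identityʳ _ ⟩
      mon i ∎
    ... | tri> _ _ j<i = begin
      (mon i - mon j) * - (mon (i ∸ j) * geo (i ∸ j))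
        ≈⟨ *-congʳ (+-congʳ (mon-∸ (ℕₚ.<⇒≤ j<i))) ⟩
      (mon j * mon (i ∸ j) - mon j) * - (mon (i ∸ j) * geo (i ∸ j))
        ≈⟨ solve 3 (λ a b c → (a :* b :- a) :* (:- (b :* c)) := a :* b :* ((:1 :- b) :* c)) refl _ _ _ ⟩
      mon j * mon (i ∸ j) * ((1# - mon (i ∸ j)) * geo (i ∸ j))
        ≈⟨ *-congˡ (geo-inv (ℕₚ.m<n⇒0<n∸m j<i)) ⟩
      mon j * mon (i ∸ j) * 1#                        ≈⟨ *-identityʳ _ ⟩
      mon j * mon (i ∸ j)                             ≈⟨ sym (mon-∸ (ℕₚ.<⇒≤ j<i)) ⟩
      mon i ∎

    -- With the higher power in the numerator the fraction is small. This penalises a step that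
    -- raises a coordinate far ahead of another.
    ρ-mon : ∀ {i j} → j < i → ∃[ y ] ρ i j ≈ mon (i ∸ j) * y
    ρ-mon {i} {j} j<i with ℕₚ.<-cmp i j
    ... | tri< i<j _ _ = ⊥-elim (ℕₚ.<-asym i<j j<i)
    ... | tri≈ _ e _   = ⊥-elim (ℕₚ.<⇒≢ j<i (≡.sym e))
    ... | tri> _ _ _   = - geo (i ∸ j) , solve 2 (λ a b → :- (a :* b) := a :* (:- b)) refl _ _

  -- Multiplication by `ρ i j` turns q^i - q^j into q^i, which is cancellable.
  diff-cancel : ∀ {i j a b} → i ≢ j → (mon i - mon j) * a ≈ (mon i - mon j) * b → a ≈ b
  diff-cancel {i} {j} {a} {b} i≢j e = mon-cancel i (begin
    mon i * a                        ≈⟨ *-congʳ (sym (ρ-mul i≢j)) ⟩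
    (mon i - mon j) * ρ i j * a      ≈⟨ swap _ _ _ ⟩
    (mon i - mon j) * a * ρ i j      ≈⟨ *-congʳ e ⟩
    (mon i - mon j) * b * ρ i j      ≈⟨ swap _ _ _ ⟩
    (mon i - mon j) * ρ i j * b      ≈⟨ *-congʳ (ρ-mul i≢j) ⟩
    mon i * b ∎)
    where
    swap : ∀ x y z → x * y * z ≈ x * z * y
    swap = solve 3 (λ x y z → x :* y :* z := x :* z :* y) refl

  ρ-sum : ∀ {i j} → i ≢ j → ρ i j + ρ j i ≈ 1#
  ρ-sum {i} {j} i≢j = diff-cancel i≢j (begin
    (mon i - mon j) * (ρ i j + ρ j i)
      ≈⟨ solve 4 (λ x y a b → (x :- y) :* (a :+ b) := (x :- y) :* a :- (y :- x) :* b) refl _ _ _ _ ⟩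
    (mon i - mon j) * ρ i j - (mon j - mon i) * ρ j i
      ≈⟨ +-cong (ρ-mul i≢j) (-‿cong (ρ-mul (i≢j ∘ ≡.sym))) ⟩
    mon i - mon j      ≈⟨ sym (*-identityʳ _) ⟩
    (mon i - mon j) * 1# ∎)

  -- Clearing the three denominators leaves (x - y) z² = (z - y) z x - (z - x) z y.
  ρ-three : ∀ {c a b} → a ≢ c → b ≢ c → a ≢ b → ρ c a * ρ c b ≈ ρ c a * ρ a b + ρ c b * ρ b a
  ρ-three {c} {a} {b} a≢c b≢c a≢b =
    diff-cancel a≢b (diff-cancel (b≢c ∘ ≡.sym) (diff-cancel (a≢c ∘ ≡.sym) (begin
      (z - x) * ((z - y) * ((x - y) * (ρ c a * ρ c b)))
        ≈⟨ solve 5 (λ x y z u v → (z :- x) :* ((z :- y) :* ((x :- y) :* (u :* v)))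
             := (x :- y) :* (((z :- x) :* u) :* ((z :- y) :* v))) refl _ _ _ _ _ ⟩
      (x - y) * (((z - x) * ρ c a) * ((z - y) * ρ c b))
        ≈⟨ *-congˡ (*-cong ca cb) ⟩
      (x - y) * (z * z)
        ≈⟨ solve 3 (λ x y z → (x :- y) :* (z :* z) := (z :- y) :* (z :* x) :- (z :- x) :* (z :* y)) refl _ _ _ ⟩
      (z - y) * (z * x) - (z - x) * (z * y)
        ≈⟨ sym (+-cong (*-congˡ (*-cong ca ab)) (-‿cong (*-congˡ (*-cong cb ba)))) ⟩
      (z - y) * (((z - x) * ρ c a) * ((x - y) * ρ a b)) - (z - x) * (((z - y) * ρ c b) * ((y - x) * ρ b a))
        ≈⟨ solve 7 (λ x y z u v s t →
             (z :- y) :* (((z :- x) :* u) :* ((x :- y) :* s)) :- (z :- x) :* (((z :- y) :* v) :* ((y :- x) :* t))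
             := (z :- x) :* ((z :- y) :* ((x :- y) :* (u :* s :+ v :* t)))) refl _ _ _ _ _ _ _ ⟩
      (z - x) * ((z - y) * ((x - y) * (ρ c a * ρ a b + ρ c b * ρ b a))) ∎)))
    where
    x = mon a
    y = mon b
    z = mon c
    ca : (z - x) * ρ c a ≈ z
    ca = ρ-mul (a≢c ∘ ≡.sym)
    cb : (z - y) * ρ c b ≈ z
    cb = ρ-mul (b≢c ∘ ≡.sym)
    ab : (x - y) * ρ a b ≈ x
    ab = ρ-mul a≢b
    ba : (y - x) * ρ b a ≈ y
    ba = ρ-mul (a≢b ∘ ≡.sym)

  -- The relation for the reversed fractions, obtained from `ρ-three` because the two orientations
  -- sum to 1.
  ρ-three′ : ∀ {c a b} → a ≢ c → b ≢ c → a ≢ b → ρ a c * ρ b c ≈ ρ a c * ρ b a + ρ b c * ρ a b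
  ρ-three′ {c} {a} {b} a≢c b≢c a≢b = begin
    ρ a c * ρ b c
      ≈⟨ solve 3 (λ u v w → u :* v := u :* (v :+ w) :- u :* w) refl _ _ _ ⟩
    ρ a c * (ρ b c + ρ c b) - ρ a c * ρ c b
      ≈⟨ +-congʳ (*-congˡ (trans (ρ-sum b≢c) (sym (ρ-sum a≢b)))) ⟩
    ρ a c * (ρ a b + ρ b a) - ρ a c * ρ c b
      ≈⟨ solve 4 (λ u s t w → u :* (s :+ t) :- u :* w := u :* t :+ (u :* s :- u :* w)) refl _ _ _ _ ⟩
    ρ a c * ρ b a + (ρ a c * ρ a b - ρ a c * ρ c b)
      ≈⟨ +-congˡ (+-congʳ (ρ-three (a≢c ∘ ≡.sym) (a≢b ∘ ≡.sym) (b≢c ∘ ≡.sym))) ⟩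
    ρ a c * ρ b a + ((ρ a c * ρ c b + ρ a b * ρ b c) - ρ a c * ρ c b)
      ≈⟨ solve 5 (λ u t w s v → u :* t :+ ((u :* w :+ s :* v) :- u :* w) := u :* t :+ v :* s) refl _ _ _ _ _ ⟩
    ρ a c * ρ b a + ρ b c * ρ a b ∎

AllPairs-↭ : ∀ {A : Set} {R : A → A → Set} → (∀ {x y} → R x y → R y x) →
  ∀ {xs ys} → xs ↭ ys → AllPairs R xs → AllPairs R ys
AllPairs-↭ R-sym ↭.refl         rs                        = rs
AllPairs-↭ R-sym (↭.prep x p)   (r ∷ rs)                  = ↭ₚ.All-resp-↭ p r ∷ AllPairs-↭ R-sym p rs
AllPairs-↭ R-sym (↭.swap x y p) ((xy ∷ r) ∷ (r′ ∷ rs))    =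
  (R-sym xy ∷ ↭ₚ.All-resp-↭ p r′) ∷ (↭ₚ.All-resp-↭ p r ∷ AllPairs-↭ R-sym p rs)
AllPairs-↭ R-sym (↭.trans p q)  rs                        = AllPairs-↭ R-sym q (AllPairs-↭ R-sym p rs)

-- Signs and Vandermonde products

module Vandermonde (R : CommutativeRing 0ℓ 0ℓ) where
  open CommutativeRing R hiding (zero)
  open Kit R

  sgn : ℕ → Carrier
  sgn k = (- 1#) ^ k

  sgn² : ∀ k → sgn k * sgn k ≈ 1#
  sgn² zero    = *-identityˡ _
  sgn² (suc k) = trans (solve 1 (λ a → (:- :1 :* a) :* (:- :1 :* a) := a :* a) refl _) (sgn² k)

  prod-focus : ∀ {A : Set} (g : A → Carrier) p {x q} → prod g (p ++ x ∷ q) ≈ g x * prod g (p ++ q)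
  prod-focus g p {x} {q} = prod-↭ g (↭ₚ.shift x p q)

  prod-const : ∀ {A : Set} a (xs : List A) → prod (λ _ → a) xs ≈ a ^ length xs
  prod-const a []       = refl
  prod-const a (x ∷ xs) = *-congˡ (prod-const a xs)

  module _ {A : Set} (X : A → Carrier) where
    vand : List A → Carrier
    vand []      = 1#
    vand (a ∷ s) = prod (λ b → X a - X b) s * vand s

    -- Moving `a` to the front reverses one difference for each entry of `p`.
    vand-focus : ∀ p a q →
      vand (p ++ a ∷ q) ≈ sgn (length p) * (prod (λ b → X a - X b) (p ++ q) * vand (p ++ q))
    vand-focus []      a q = sym (*-identityˡ _)
    vand-focus (d ∷ p) a q = trans (*-cong (prod-focus _ p) (vand-focus p a q))
      (solve 6 (λ x y b s d v → ((x :- y) :* b) :* (s :* (d :* v)) := (:- :1 :* s) :* (((y :- x) :* d) :* (b :* v)))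
        refl _ _ _ _ _ _)

-- Weighted walks that raise one coordinate at a time

module Walk (Q : QRing) (T : ℕ) where
  open QRing Q
  open CommutativeRing cring hiding (zero)
  open Kit cring
  open QKit Q
  open Compositions cring using (size; comps; up; comps-congˢ; comps-shift; *-comps)
  open Vandermonde cring
  open SetoidReasoning setoid

  State : Set
  State = List (ℕ × ℕ)

  -- The number that is visited when this coordinate is raised next.
  u : ℕ × ℕ → ℕ
  u a = proj₁ a ℕ.+ T ℕ.* proj₂ a

  X : ℕ × ℕ → Carrier
  X a = mon (u a)

  ∏ρ : ℕ × ℕ → State → Carrier
  ∏ρ a = prod (λ b → ρ (u a) (u b))

  step : (State → Carrier) → State → Carrier
  step f = foc (λ p a q → ∏ρ a (p ++ q) * f (p ++ up a ∷ q))

  -- The sum over all walks with `r` steps of their weight times `f` at the endpoint; the recursion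
  -- absorbs the last step into `f`.
  walk : ℕ → (State → Carrier) → State → Carrier
  walk zero    f = f
  walk (suc r) f = walk r (step f)

  -- The total height records how many steps have been made since the origin.
  Inv : List ℕ → ℕ → State → Set
  Inv cs r s = map proj₁ s ≡ cs × size s ≡ r

  size-++ : ∀ p (s : State) → size (p ++ s) ≡ size p ℕ.+ size s
  size-++ []      s = ≡.refl
  size-++ (a ∷ p) s = ≡.trans (≡.cong (proj₂ a ℕ.+_) (size-++ p s)) (≡.sym (ℕₚ.+-assoc (proj₂ a) _ _))

  up-Inv : ∀ {cs r} p a q → Inv cs r (p ++ a ∷ q) → Inv cs (suc r) (p ++ up a ∷ q)
  up-Inv p a q (e , e′) =
    ≡.trans (≡.trans (Lₚ.map-++ proj₁ p _) (≡.sym (Lₚ.map-++ proj₁ p _))) e ,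
    ≡.trans (size-++ p _) (≡.trans (ℕₚ.+-suc _ _) (≡.cong suc (≡.trans (≡.sym (size-++ p _)) e′)))

  step-congˢ : ∀ {cs r} {f g : State → Carrier} → (∀ s → Inv cs (suc r) s → f s ≈ g s) →
    ∀ s → Inv cs r s → step f s ≈ step g s
  step-congˢ e s i = foc-congˢ (Inv _ _) (λ p a q j → *-congˡ (e _ (up-Inv p a q j))) s i

  walk-congˢ : ∀ {cs r₀} r {f g : State → Carrier} → (∀ s → Inv cs (r ℕ.+ r₀) s → f s ≈ g s) →
    ∀ s → Inv cs r₀ s → walk r f s ≈ walk r g s
  walk-congˢ zero    e s i = e s i
  walk-congˢ (suc r) e s i = walk-congˢ r (step-congˢ e) s i

  *-step : ∀ a f s → a * step f s ≈ step (λ s → a * f s) s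
  *-step a f s = trans (*-foc a _ s) (foc-cong (λ p x q →
    solve 3 (λ a b c → a :* (b :* c) := b :* (a :* c)) refl _ _ _) s)

  step-+ : ∀ f g s → step (λ s → f s + g s) s ≈ step f s + step g s
  step-+ f g s = trans (foc-cong (λ p x q → distribˡ _ _ _) s) (foc-+ _ _ s)

  walk-cong : ∀ r {f g : State → Carrier} → (∀ s → f s ≈ g s) → ∀ s → walk r f s ≈ walk r g s
  walk-cong r e s = walk-congˢ r (λ s _ → e s) s (≡.refl , ≡.refl)

  *-walk : ∀ a r f s → a * walk r f s ≈ walk r (λ s → a * f s) s
  *-walk a zero    f s = refl
  *-walk a (suc r) f s = trans (*-walk a r (step f) s) (walk-cong r (*-step a f) s)

  walk-+ : ∀ r f g s → walk r (λ s → f s + g s) s ≈ walk r f s + walk r g s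
  walk-+ zero    f g s = refl
  walk-+ (suc r) f g s = trans (walk-cong r (step-+ f g) s) (walk-+ r _ _ s)

  -- (q^a; q^T)_y
  poch : ℕ → ℕ → Carrier
  poch a zero    = 1#
  poch a (suc y) = poch a y * (1# - mon (a ℕ.+ T ℕ.* y))

  -- The sum of the numbers c, c + T, c + 2T, ... visited on the way up to height `y`.
  ladder : ℕ → ℕ → ℕ
  ladder c zero    = 0
  ladder c (suc y) = ladder c y ℕ.+ (c ℕ.+ T ℕ.* y)

  energy : State → ℕ
  energy []      = 0
  energy (a ∷ s) = ladder (proj₁ a) (proj₂ a) ℕ.+ energy s

  energy-focus : ∀ p a q → energy (p ++ a ∷ q) ≡ ladder (proj₁ a) (proj₂ a) ℕ.+ energy (p ++ q)
  energy-focus []      a q = ≡.refl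
  energy-focus (d ∷ p) a q = ≡.trans (≡.cong (x ℕ.+_) (energy-focus p a q))
    (≡.trans (≡.sym (ℕₚ.+-assoc x y z)) (≡.trans (≡.cong (ℕ._+ z) (ℕₚ.+-comm x y)) (ℕₚ.+-assoc y x z)))
    where
    x = ladder (proj₁ d) (proj₂ d)
    y = ladder (proj₁ a) (proj₂ a)
    z = energy (p ++ q)

  energy-up : ∀ p a q → energy (p ++ up a ∷ q) ≡ energy (p ++ a ∷ q) ℕ.+ u a
  energy-up p a q = ≡.trans (energy-focus p (up a) q) (≡.trans (rearr (ladder (proj₁ a) (proj₂ a)) (u a) (energy (p ++ q)))
    (≡.cong (ℕ._+ u a) (≡.sym (energy-focus p a q))))
    where
    rearr : ∀ x y z → (x ℕ.+ y) ℕ.+ z ≡ (x ℕ.+ z) ℕ.+ y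
    rearr x y z = ≡.trans (ℕₚ.+-assoc x y z) (≡.trans (≡.cong (x ℕ.+_) (ℕₚ.+-comm y z)) (≡.sym (ℕₚ.+-assoc x z y)))

  mon-* : ∀ k v → mon (k ℕ.* v) ≈ mon v ^ k
  mon-* zero    v = mon-0
  mon-* (suc k) v = trans (mon-+ v _) (*-congˡ (mon-* k v))

  -- Total weight of the walks from the origin

  module Parts (cs : List ℕ) (cs<T : All (_< T) cs) (cs# : AllPairs _≢_ cs) where
    n : ℕ
    n = length cs

    pochs : ℕ × ℕ → Carrier
    pochs a = prod (λ b → poch ((T ℕ.+ proj₁ a) ∸ b) (proj₂ a)) cs

    P : State → Carrier
    P = prod pochs

    origin : State
    origin = map (λ c → c , 0) cs

    -- The increment is the exponent in the product of all `X` after `r` steps, by which each step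
    -- has to be multiplied.
    K : ℕ → ℕ
    K zero    = 0
    K (suc r) = K r ℕ.+ (T ℕ.* r ℕ.+ ℕL.sum cs)

    sg : Carrier
    sg = sgn (n ∸ 1)

    pfac : ℕ × ℕ → ℕ → Carrier
    pfac a b = 1# - mon (((T ℕ.+ proj₁ a) ∸ b) ℕ.+ T ℕ.* proj₂ a)

    P-up : ∀ p a q → P (p ++ up a ∷ q) ≈ P (p ++ a ∷ q) * prod (pfac a) cs
    P-up p a q = begin
      P (p ++ up a ∷ q)                        ≈⟨ prod-focus pochs p ⟩
      pochs (up a) * P (p ++ q)                ≈⟨ *-congʳ (prod-* _ _ cs) ⟩
      pochs a * prod (pfac a) cs * P (p ++ q)  ≈⟨ solve 3 (λ a b c → (a :* b) :* c := (a :* c) :* b) refl _ _ _ ⟩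
      pochs a * P (p ++ q) * prod (pfac a) cs  ≈⟨ *-congʳ (sym (prod-focus pochs p)) ⟩
      P (p ++ a ∷ q) * prod (pfac a) cs ∎

    -- Residues below T are recovered by reduction modulo T; matching T against a successor in `go`
    -- supplies the nonzero modulus.
    u-mod : ∀ {c d y z} → c < T → d < T → c ℕ.+ T ℕ.* y ≡ d ℕ.+ T ℕ.* z → c ≡ d
    u-mod {c} {d} {y} {z} c<T d<T e = go c<T d<T e
      where
      open import Data.Nat.DivMod using (_%_; [m+kn]%n≡m%n; m<n⇒m%n≡m)
      go : ∀ {T} → c < T → d < T → c ℕ.+ T ℕ.* y ≡ d ℕ.+ T ℕ.* z → c ≡ d
      go {zero} ()
      go {suc t} c<T d<T e = ≡.trans (≡.sym (red c y c<T)) (≡.trans (≡.cong (_% suc t) e) (red d z d<T))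
        where
        red : ∀ c y → c < suc t → (c ℕ.+ suc t ℕ.* y) % suc t ≡ c
        red c y c<T = ≡.trans (≡.cong (λ v → (c ℕ.+ v) % suc t) (ℕₚ.*-comm (suc t) y))
          (≡.trans ([m+kn]%n≡m%n c y (suc t)) (m<n⇒m%n≡m c<T))

    distinct : ∀ s → All (λ a → proj₁ a < T) s → AllPairs _≢_ (map proj₁ s) → AllPairs (λ a b → u a ≢ u b) s
    distinct []      _          _          = []
    distinct (a ∷ s) (a<T ∷ h) (a# ∷ s#) =
      All.zipWith (λ { (b<T , a≢b) e → a≢b (u-mod {proj₁ a} a<T b<T e) }) (h , Allₚ.map⁻ a#) ∷ distinct s h s#

    Inv⇒distinct : ∀ {r} s → Inv cs r s → AllPairs (λ a b → u a ≢ u b) s × All (λ a → proj₁ a < T) s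
    Inv⇒distinct s (e , _) = distinct s s<T (≡.subst (AllPairs _≢_) (≡.sym e) cs#) , s<T
      where
      s<T = Allₚ.map⁻ (≡.subst (All (_< T)) (≡.sym e) cs<T)

    -- The parameters of the partial fractions. They satisfy: σ_b X(up a) is X_b times the power of
    -- q in the factor of `pfac a` for b, so that `pfac` supplies the numerators of `PF.φ`.
    σ : ℕ × ℕ → Carrier
    σ a = mon (T ℕ.* proj₂ a)

    prod-σ : ∀ s → prod σ s ≈ mon (T ℕ.* size s)
    prod-σ []      = sym (trans (mon-≡ (ℕₚ.*-zeroʳ T)) mon-0)
    prod-σ (a ∷ s) = trans (*-congˡ (prod-σ s))
      (trans (sym (mon-+ _ _)) (mon-≡ (≡.sym (ℕₚ.*-distribˡ-+ T (proj₂ a) (size s)))))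

    prod-X : ∀ s → prod X s ≈ mon (T ℕ.* size s ℕ.+ ℕL.sum (map proj₁ s))
    prod-X []      = sym (trans (mon-≡ (≡.trans (ℕₚ.+-identityʳ _) (ℕₚ.*-zeroʳ T))) mon-0)
    prod-X (a ∷ s) = trans (*-congˡ (prod-X s)) (trans (sym (mon-+ _ _)) (mon-≡ (rearr (proj₁ a) (proj₂ a) (size s) _)))
      where
      rearr : ∀ c y z w → (c ℕ.+ T ℕ.* y) ℕ.+ (T ℕ.* z ℕ.+ w) ≡ T ℕ.* (y ℕ.+ z) ℕ.+ (c ℕ.+ w)
      rearr c y z w = solveℕ 5 (λ c y z w t → (c ⊕ t ⊗ y) ⊕ (t ⊗ z ⊕ w) ⊜ t ⊗ (y ⊕ z) ⊕ (c ⊕ w)) ≡.refl c y z w T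

    -- The fractions are reversed: here `φ σ c b` is (X_b - σ_b X_c) / (X_b - X_c).
    module PF = PartialFractions cring (λ a b → ρ (u b) (u a)) (λ a b → u a ≢ u b)
      (λ e → trans (+-comm _ _) (ρ-sum e)) (λ {c} {a} {b} → ρ-three′ {u c} {u a} {u b})

    weight-f : (State → Carrier) → State → Carrier
    weight-f f s = mon (n ℕ.* energy s) * (vand X s * f s)

    G : (State → Carrier) → Foc (ℕ × ℕ)
    G f p a q = weight-f f (p ++ a ∷ q) * PF.residue σ p a q

    -- The step operator conjugated by multiplication with `P`.
    f′ : (State → Carrier) → State → Carrier
    f′ f = foc (λ p a q → ∏ρ a (p ++ q) * (f (p ++ up a ∷ q) * prod (pfac a) cs))

    module _ {p : State} {a : ℕ × ℕ} {q : State} {r} (inv : Inv cs r (p ++ a ∷ q)) where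
      rest : State
      rest = p ++ q

      x x′ : Carrier
      x  = X a
      x′ = X (up a)

      separate : ∀ {a} → Inv cs r (p ++ a ∷ q) ⊎ Inv cs (suc r) (p ++ a ∷ q) → All (λ b → u a ≢ u b) rest
      separate {a} i = AllPairs.head (AllPairs-↭ (λ h e → h (≡.sym e)) (↭ₚ.shift a p q) (get i))
        where
        get : Inv cs r (p ++ a ∷ q) ⊎ Inv cs (suc r) (p ++ a ∷ q) → AllPairs (λ a b → u a ≢ u b) (p ++ a ∷ q)
        get (inj₁ i) = proj₁ (Inv⇒distinct _ i)
        get (inj₂ i) = proj₁ (Inv⇒distinct _ i)

      rest<T : All (λ b → proj₁ b < T) rest
      rest<T = All.tail (↭ₚ.All-resp-↭ (↭ₚ.shift a p q) (proj₂ (Inv⇒distinct _ inv)))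

      -- The Vandermonde factor at the old position cancels the denominator of the step weight. What
      -- is left is the Vandermonde factor at the new position times a factor of the residue there.
      factor : ∀ b → u a ≢ u b → u (up a) ≢ u b → proj₁ b < T →
        ((x - X b) * ρ (u a) (u b)) * (X b * pfac a (proj₁ b)) ≈
        (- 1# * x) * ((x′ - X b) * PF.φ σ (up a) b)
      factor b a≢b a′≢b b<T = begin
        ((x - X b) * ρ (u a) (u b)) * (X b * pfac a (proj₁ b))
          ≈⟨ *-cong (ρ-mul a≢b) (solve 2 (λ a b → a :* (:1 :- b) := a :- a :* b) refl _ _) ⟩
        x * (X b - X b * mon (((T ℕ.+ proj₁ a) ∸ proj₁ b) ℕ.+ T ℕ.* proj₂ a))
          ≈⟨ *-congˡ (+-congˡ (-‿cong (trans (sym (mon-+ _ _)) (trans (mon-≡ exponents) (mon-+ _ _))))) ⟩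
        x * (X b - σ b * x′)
          ≈⟨ solve 4 (λ x b s x′ → x :* (b :- s :* x′) := x :* (s :* (b :- x′) :+ (:1 :- s) :* b)) refl _ _ _ _ ⟩
        x * (σ b * (X b - x′) + (1# - σ b) * X b)
          ≈⟨ *-congˡ (+-congˡ (*-congˡ (sym (ρ-mul (a′≢b ∘ ≡.sym))))) ⟩
        x * (σ b * (X b - x′) + (1# - σ b) * ((X b - x′) * ρ (u b) (u (up a))))
          ≈⟨ solve 5 (λ x b s x′ r → x :* (s :* (b :- x′) :+ (:1 :- s) :* ((b :- x′) :* r))
               := (:- :1 :* x) :* ((x′ :- b) :* (s :+ (:1 :- s) :* r))) refl _ _ _ _ _ ⟩
        (- 1# * x) * ((x′ - X b) * PF.φ σ (up a) b) ∎
        where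
        exponents : u b ℕ.+ (((T ℕ.+ proj₁ a) ∸ proj₁ b) ℕ.+ T ℕ.* proj₂ a) ≡ T ℕ.* proj₂ b ℕ.+ u (up a)
        exponents = ≡.trans
          (solveℕ 5 (λ b t z d y → (b ⊕ t ⊗ z) ⊕ (d ⊕ t ⊗ y) ⊜ (b ⊕ d) ⊕ (t ⊗ z ⊕ t ⊗ y)) ≡.refl
             (proj₁ b) T (proj₂ b) ((T ℕ.+ proj₁ a) ∸ proj₁ b) (proj₂ a))
          (≡.trans (≡.cong (ℕ._+ (T ℕ.* proj₂ b ℕ.+ T ℕ.* proj₂ a))
             (ℕₚ.m+[n∸m]≡n (ℕₚ.≤-trans (ℕₚ.<⇒≤ b<T) (ℕₚ.m≤m+n T (proj₁ a)))))
          (solveℕ 4 (λ t c z y → (t ⊕ c) ⊕ (t ⊗ z ⊕ t ⊗ y) ⊜ t ⊗ z ⊕ (c ⊕ t ⊗ (conℕ 1 ⊕ y))) ≡.refl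
             T (proj₁ a) (proj₂ b) (proj₂ a)))

      factors : (prod (λ b → x - X b) rest * ∏ρ a rest) * (prod X rest * prod (λ b → pfac a (proj₁ b)) rest) ≈
        (sgn (length rest) * x ^ length rest) * (prod (λ b → x′ - X b) rest * prod (PF.φ σ (up a)) rest)
      factors = begin
        _ ≈⟨ *-cong (sym (prod-* _ _ rest)) (sym (prod-* _ _ rest)) ⟩
        _ ≈⟨ sym (prod-* _ _ rest) ⟩
        _ ≈⟨ prod-congᴬ (All.zipWith (λ { ((h , h′) , h″) → factor _ h h′ h″ })
               (All.zip (separate (inj₁ inv) , separate (inj₂ (up-Inv p a q inv))) , rest<T)) ⟩
        _ ≈⟨ prod-* _ _ rest ⟩
        _ ≈⟨ *-cong (trans (prod-const _ rest) (*-^ _ _ (length rest))) (prod-* _ _ rest) ⟩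
        _ ∎

      cs↭ : cs ↭ proj₁ a ∷ map proj₁ rest
      cs↭ = ≡.subst (_↭ (proj₁ a ∷ map proj₁ rest)) (proj₁ inv) (↭ₚ.map⁺ proj₁ (↭ₚ.shift a p q))

      n≡ : n ≡ suc (length rest)
      n≡ = ≡.trans (↭ₚ.↭-length cs↭) (≡.cong suc (Lₚ.length-map proj₁ rest))

      prod-pfac : prod (pfac a) cs ≈ (1# - σ (up a)) * prod (λ b → pfac a (proj₁ b)) rest
      prod-pfac = begin
        prod (pfac a) cs                             ≈⟨ prod-↭ _ cs↭ ⟩
        pfac a (proj₁ a) * prod (pfac a) (map proj₁ rest)
          ≈⟨ *-cong (+-congˡ (-‿cong (mon-≡ (≡.trans (≡.cong (ℕ._+ T ℕ.* proj₂ a) (ℕₚ.m+n∸n≡m T (proj₁ a))) (≡.sym (ℕₚ.*-suc T _))))))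
                    (reflexive (prod-map (pfac a) proj₁ rest)) ⟩
        (1# - σ (up a)) * prod (λ b → pfac a (proj₁ b)) rest ∎

      prod-X-focus : mon (T ℕ.* r ℕ.+ ℕL.sum cs) ≈ x * prod X rest
      prod-X-focus = begin
        mon (T ℕ.* r ℕ.+ ℕL.sum cs)
          ≡⟨ ≡.cong₂ (λ r cs → mon (T ℕ.* r ℕ.+ ℕL.sum cs)) (≡.sym (proj₂ inv)) (≡.sym (proj₁ inv)) ⟩
        mon (T ℕ.* size (p ++ a ∷ q) ℕ.+ ℕL.sum (map proj₁ (p ++ a ∷ q)))  ≈⟨ sym (prod-X (p ++ a ∷ q)) ⟩
        prod X (p ++ a ∷ q)                                               ≈⟨ prod-focus X p ⟩
        x * prod X rest ∎

      mon-energy-up : mon (n ℕ.* energy (p ++ up a ∷ q)) ≈ mon (n ℕ.* energy (p ++ a ∷ q)) * (x * x ^ length rest)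
      mon-energy-up = begin
        mon (n ℕ.* energy (p ++ up a ∷ q))
          ≡⟨ ≡.cong mon (≡.trans (≡.cong (n ℕ.*_) (energy-up p a q)) (ℕₚ.*-distribˡ-+ n _ (u a))) ⟩
        mon (n ℕ.* energy (p ++ a ∷ q) ℕ.+ n ℕ.* u a)         ≈⟨ mon-+ _ _ ⟩
        mon (n ℕ.* energy (p ++ a ∷ q)) * mon (n ℕ.* u a)     ≈⟨ *-congˡ (mon-* n (u a)) ⟩
        mon (n ℕ.* energy (p ++ a ∷ q)) * x ^ n               ≡⟨ ≡.cong (λ k → mon (n ℕ.* energy (p ++ a ∷ q)) * x ^ k) n≡ ⟩
        mon (n ℕ.* energy (p ++ a ∷ q)) * (x * x ^ length rest) ∎

      -- A step seen from its target. The product of all `X` supplies the X_b that `factor`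
      -- requires, and the sign from the other entries meets `sg`, giving a square.
      transfer : ∀ f → (mon (T ℕ.* r ℕ.+ ℕL.sum cs) * sg) * (mon (n ℕ.* energy (p ++ a ∷ q)) * (vand X (p ++ a ∷ q)
          * (∏ρ a rest * (f (p ++ up a ∷ q) * prod (pfac a) cs)))) ≈ G f p (up a) q
      transfer f = begin
        _ ≈⟨ *-cong (*-cong prod-X-focus (reflexive (≡.cong (λ k → sgn (k ∸ 1)) n≡)))
               (*-congˡ (*-cong (vand-focus X p a q) (*-congˡ (*-congˡ prod-pfac)))) ⟩
        ((x * ΠX) * s) * (e * ((sp * (Πd * v)) * (Πρ * (fs * ((1# - σ (up a)) * Πp)))))
          ≈⟨ solve 11 (λ x X s e sp d v r f w p → ((x :* X) :* s) :* (e :* ((sp :* (d :* v)) :* (r :* (f :* (w :* p)))))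
               := ((d :* r) :* (X :* p)) :* ((s :* x) :* (e :* ((sp :* v) :* (f :* w))))) refl _ _ _ _ _ _ _ _ _ _ _ ⟩
        ((Πd * Πρ) * (ΠX * Πp)) * ((s * x) * (e * ((sp * v) * (fs * (1# - σ (up a))))))
          ≈⟨ *-congʳ factors ⟩
        ((s * xk) * (Πd′ * Πφ)) * ((s * x) * (e * ((sp * v) * (fs * (1# - σ (up a))))))
          ≈⟨ solve 10 (λ s xk d φ x e sp v f w → ((s :* xk) :* (d :* φ)) :* ((s :* x) :* (e :* ((sp :* v) :* (f :* w))))
               := (s :* s) :* (((e :* (x :* xk)) :* ((sp :* (d :* v)) :* f)) :* (w :* φ))) refl _ _ _ _ _ _ _ _ _ _ ⟩
        (s * s) * (((e * (x * xk)) * ((sp * (Πd′ * v)) * fs)) * ((1# - σ (up a)) * Πφ))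
          ≈⟨ trans (*-congʳ (sgn² (length rest))) (*-identityˡ _) ⟩
        ((e * (x * xk)) * ((sp * (Πd′ * v)) * fs)) * ((1# - σ (up a)) * Πφ)
          ≈⟨ *-congʳ (*-cong (sym mon-energy-up) (*-congʳ (sym (vand-focus X p (up a) q)))) ⟩
        G f p (up a) q ∎
        where
        s   = sgn (length rest)
        ΠX  = prod X rest
        e   = mon (n ℕ.* energy (p ++ a ∷ q))
        sp  = sgn (length p)
        Πd  = prod (λ b → x - X b) rest
        Πd′ = prod (λ b → x′ - X b) rest
        v   = vand X rest
        Πρ  = ∏ρ a rest
        fs  = f (p ++ up a ∷ q)
        Πp  = prod (λ b → pfac a (proj₁ b)) rest
        xk  = x ^ length rest
        Πφ  = prod (PF.φ σ (up a)) rest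

    -- The factor 1 - σ vanishes at height 0, in accordance with the fact that a coordinate just
    -- raised is positive.
    G-0 : ∀ f p c q → G f p (c , 0) q ≈ 0#
    G-0 f p c q = trans (*-congˡ (trans (*-congʳ (trans (+-congˡ (-‿cong (trans (mon-≡ (ℕₚ.*-zeroʳ T)) mon-0))) (-‿inverseʳ _))) (zeroˡ _))) (zeroʳ _)

    foc-G : ∀ f {r} s → Inv cs r s → foc (G f) s ≈ (1# - mon (T ℕ.* r)) * weight-f f s
    foc-G f {r} s i = begin
      foc (G f) s
        ≈⟨ foc-congˢ (_≡ s) (λ { p a q ≡.refl → refl }) s ≡.refl ⟩
      foc (λ p a q → weight-f f s * PF.residue σ p a q) s
        ≈⟨ sym (*-foc _ _ s) ⟩
      weight-f f s * foc (PF.residue σ) s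
        ≈⟨ solve 3 (λ w a b → w :* a := ((a :+ b) :- b) :* w) refl _ _ (prod σ s) ⟩
      ((foc (PF.residue σ) s + prod σ s) - prod σ s) * weight-f f s
        ≈⟨ *-congʳ (+-cong (PF.foc-residue σ s (proj₁ (Inv⇒distinct s i)))
             (-‿cong (trans (prod-σ s) (mon-≡ (≡.cong (T ℕ.*_) (proj₂ i)))))) ⟩
      (1# - mon (T ℕ.* r)) * weight-f f s ∎

    -- Summing over pairs of a start and a raised coordinate is summing over pairs of a target and a
    -- positive coordinate. At a fixed target the residues add up to 1 minus the product of the σ,
    -- which depends only on the total height.
    comps-step : ∀ f r → (mon (T ℕ.* r ℕ.+ ℕL.sum cs) * sg) * comps (weight-f (f′ f)) cs r ≈
      (1# - mon (T ℕ.+ T ℕ.* r)) * comps (weight-f f) cs (suc r)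
    comps-step f r = begin
      M * comps (weight-f (f′ f)) cs r
        ≈⟨ *-comps _ _ cs r ⟩
      comps (λ s → M * weight-f (f′ f) s) cs r
        ≈⟨ comps-congˢ cs r (λ s e e′ → trans
             (solve 4 (λ m a b c → m :* (a :* (b :* c)) := (m :* (a :* b)) :* c) refl _ _ _ _)
             (trans (*-foc _ _ s) (foc-congˢ (λ s′ → s′ ≡ s × Inv cs r s′) (λ { p a q (≡.refl , i) →
               trans (solve 4 (λ m a b c → (m :* (a :* b)) :* c := m :* (a :* (b :* c))) refl _ _ _ _)
                     (transfer i f) }) s (≡.refl , e , e′)))) ⟩
      comps (foc (λ p a q → G f p (up a) q)) cs r
        ≈⟨ comps-shift (G f) (G-0 f) cs r ⟩
      comps (foc (G f)) cs (suc r)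
        ≈⟨ comps-congˢ cs (suc r) (λ s e e′ → foc-G f s (e , e′)) ⟩
      comps (λ s → (1# - mon (T ℕ.* suc r)) * weight-f f s) cs (suc r)
        ≈⟨ sym (*-comps _ _ cs (suc r)) ⟩
      (1# - mon (T ℕ.* suc r)) * comps (weight-f f) cs (suc r)
        ≈⟨ *-congʳ (+-congˡ (-‿cong (mon-≡ (ℕₚ.*-suc T r)))) ⟩
      (1# - mon (T ℕ.+ T ℕ.* r)) * comps (weight-f f) cs (suc r) ∎
      where
      M = mon (T ℕ.* r ℕ.+ ℕL.sum cs) * sg

    origin-Inv : Inv cs 0 origin
    origin-Inv = ≡.trans (≡.sym (Lₚ.map-∘ cs)) (Lₚ.map-id cs) , size-0 cs
      where
      size-0 : ∀ cs → size (map (λ c → (c , 0)) cs) ≡ 0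
      size-0 []       = ≡.refl
      size-0 (_ ∷ cs) = size-0 cs

    -- Keeping `f` arbitrary is what closes the induction: the last step turns `f` into `f′ f`, and
    -- `comps-step` turns it back at the cost of one factor of the symbol.
    walk-formula : ∀ r f → vand X origin * ((mon (K r) * sg ^ r) * walk r (λ s → f s * P s) origin) ≈
      poch T r * comps (weight-f f) cs r
    walk-formula zero f = begin
      vand X origin * ((mon 0 * 1#) * (f origin * P origin))
        ≈⟨ *-congˡ (*-cong (trans (*-identityʳ _) mon-0) (*-congˡ (P-0 cs))) ⟩
      vand X origin * (1# * (f origin * 1#))
        ≈⟨ solve 2 (λ a b → a :* (:1 :* (b :* :1)) := :1 :* (:1 :* (a :* b))) refl _ _ ⟩
      1# * (1# * (vand X origin * f origin))
        ≈⟨ *-congˡ (*-congʳ (sym (trans (mon-≡ (≡.trans (≡.cong (n ℕ.*_) (energy-0 cs)) (ℕₚ.*-zeroʳ n))) mon-0))) ⟩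
      1# * weight-f f origin
        ≈⟨ *-congˡ (sym (at-0 (weight-f f) cs)) ⟩
      1# * comps (weight-f f) cs 0 ∎
      where
      P-0 : ∀ ds → P (map (λ c → (c , 0)) ds) ≈ 1#
      P-0 ds = prod-1 _ (Allₚ.map⁺ (All.universal (λ _ → prod-1 cs (All.universal (λ _ → refl) cs)) ds))
      energy-0 : ∀ cs → energy (map (λ c → (c , 0)) cs) ≡ 0
      energy-0 []       = ≡.refl
      energy-0 (_ ∷ cs) = energy-0 cs
      at-0 : ∀ (g : State → Carrier) cs → comps g cs 0 ≈ g (map (λ c → (c , 0)) cs)
      at-0 g []       = refl
      at-0 g (c ∷ cs) = at-0 (λ s → g ((c , 0) ∷ s)) cs
    walk-formula (suc r) f = begin
      vand X origin * ((mon (K r ℕ.+ k) * (sg * sg ^ r)) * walk r (step (λ s → f s * P s)) origin)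
        ≈⟨ *-congˡ (*-cong (*-congʳ (mon-+ (K r) k)) (walk-congˢ r (λ s _ → step-P s) origin origin-Inv)) ⟩
      vand X origin * (((mon (K r) * mon k) * (sg * sg ^ r)) * walk r (λ s → f′ f s * P s) origin)
        ≈⟨ solve 6 (λ v a b c d w → v :* (((a :* b) :* (c :* d)) :* w) := (b :* c) :* (v :* ((a :* d) :* w))) refl _ _ _ _ _ _ ⟩
      (mon k * sg) * (vand X origin * ((mon (K r) * sg ^ r) * walk r (λ s → f′ f s * P s) origin))
        ≈⟨ *-congˡ (walk-formula r (f′ f)) ⟩
      (mon k * sg) * (poch T r * comps (weight-f (f′ f)) cs r)
        ≈⟨ solve 3 (λ a b c → a :* (b :* c) := b :* (a :* c)) refl _ _ _ ⟩
      poch T r * ((mon k * sg) * comps (weight-f (f′ f)) cs r)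
        ≈⟨ *-congˡ (comps-step f r) ⟩
      poch T r * ((1# - mon (T ℕ.+ T ℕ.* r)) * comps (weight-f f) cs (suc r))
        ≈⟨ sym (*-assoc _ _ _) ⟩
      poch T (suc r) * comps (weight-f f) cs (suc r) ∎
      where
      k = T ℕ.* r ℕ.+ ℕL.sum cs
      step-P : ∀ s → step (λ s → f s * P s) s ≈ f′ f s * P s
      step-P s = begin
        step (λ s → f s * P s) s
          ≈⟨ foc-congˢ (_≡ s) (λ { p a q ≡.refl → trans (*-congˡ (*-congˡ (P-up p a q)))
               (solve 4 (λ r f P d → r :* (f :* (P :* d)) := P :* (r :* (f :* d))) refl _ _ _ _) }) s ≡.refl ⟩
        foc (λ p a q → P s * (∏ρ a (p ++ q) * (f (p ++ up a ∷ q) * prod (pfac a) cs))) s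
          ≈⟨ sym (*-foc _ _ s) ⟩
        P s * f′ f s
          ≈⟨ *-comm _ _ ⟩
        f′ f s * P s ∎

rest-length : ∀ {A : Set} (p : List A) {x q k} → length (p ++ x ∷ q) ≡ suc k → length (p ++ q) ≡ k
rest-length p {x} {q} e = ℕₚ.suc-injective (≡.trans (≡.sym (↭ₚ.↭-length (↭ₚ.shift x p q))) e)

downFrom-< : ∀ l → All (_< l) (downFrom l)
downFrom-< zero    = []
downFrom-< (suc l) = ℕₚ.≤-refl ∷ All.map ℕₚ.m≤n⇒m≤1+n (downFrom-< l)

downFrom-# : ∀ l → AllPairs _≢_ (downFrom l)
downFrom-# zero    = []
downFrom-# (suc l) = All.map (λ h e → ℕₚ.<⇒≢ h (≡.sym e)) (downFrom-< l) ∷ downFrom-# l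

downFrom-> : ∀ l → AllPairs (λ a b → b < a) (downFrom l)
downFrom-> zero    = []
downFrom-> (suc l) = downFrom-< l ∷ downFrom-> l

-- Alternants and the exchange of the two moduli

module Duality (Q : QRing) where
  open QRing Q
  open CommutativeRing cring hiding (zero)
  open Kit cring
  open QKit Q
  open Compositions cring using (size; comps; up; comps-congˢ; det-coefficient; module P)
  open Vandermonde cring
  open Det cring
  open SetoidReasoning setoid

  foc-alt : ∀ {A : Set} (g : A → List A → Carrier) xs →
    foc (λ p a q → sgn (length p) * g a (p ++ q)) xs ≈ alt g xs
  foc-alt g []       = refl
  foc-alt g (x ∷ xs) = +-cong (*-identityˡ _) (begin
    foc (λ p a q → (- 1# * sgn (length p)) * g a (x ∷ p ++ q)) xs
      ≈⟨ foc-cong (λ p a q → *-assoc _ _ _) xs ⟩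
    foc (λ p a q → - 1# * (sgn (length p) * g a (x ∷ p ++ q))) xs
      ≈⟨ sym (*-foc _ _ xs) ⟩
    - 1# * foc (λ p a q → sgn (length p) * g a (x ∷ p ++ q)) xs
      ≈⟨ *-congˡ (foc-alt (λ a q → g a (x ∷ q)) xs) ⟩
    - 1# * alt (λ a q → g a (x ∷ q)) xs
      ≈⟨ solve 1 (λ a → :- :1 :* a := :- a) refl _ ⟩
    - alt (λ a q → g a (x ∷ q)) xs ∎)

  module _ {A : Set} (u : A → ℕ) where
    X : A → Carrier
    X a = mon (u a)

    Distinct : List A → Set
    Distinct = AllPairs (λ a b → u a ≢ u b)

    module PF = PartialFractions cring (λ a b → ρ (u a) (u b)) (λ a b → u a ≢ u b)
      ρ-sum (λ {c} {a} {b} → ρ-three {u c} {u a} {u b})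

    -- The complete homogeneous symmetric polynomial of degree k in the `X a`, written as the sum of
    -- X_a^(k+l) over the product of the X_a - X_b, for l + 1 entries.
    h : ℕ → List A → Carrier
    h k = foc (λ p a q → mon (k ℕ.* u a) * prod (λ b → ρ (u a) (u b)) (p ++ q))

    -- Partial fractions with all s_b = 0, where `φ` reduces to `ρ` and the product of the s_b
    -- vanishes.
    h-0 : ∀ a s → Distinct (a ∷ s) → h 0 (a ∷ s) ≈ 1#
    h-0 a s d = begin
      h 0 (a ∷ s)
        ≈⟨ foc-cong (λ p a q → *-cong (trans mon-0 (solve 0 (:1 := :1 :- con (+ 0)) refl)) (prod-cong (λ b →
             solve 1 (λ r → r := con (+ 0) :+ (:1 :- con (+ 0)) :* r) refl (ρ (u a) (u b))) (p ++ q))) (a ∷ s) ⟩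
      foc (PF.residue (λ _ → 0#)) (a ∷ s)
        ≈⟨ solve 2 (λ x y → x := x :+ con (+ 0) :* y) refl _ _ ⟩
      foc (PF.residue (λ _ → 0#)) (a ∷ s) + prod (λ _ → 0#) (a ∷ s)
        ≈⟨ PF.foc-residue (λ _ → 0#) (a ∷ s) d ⟩
      1# ∎

    module _ (p : List A) (a : A) (q : List A) (d : Distinct (p ++ a ∷ q)) where
      split-Distinct : All (λ b → u a ≢ u b) (p ++ q) × Distinct (p ++ q)
      split-Distinct with AllPairs-↭ (λ h e → h (≡.sym e)) (↭ₚ.shift a p q) d
      ... | a# ∷ d′ = a# , d′

    -- The Vandermonde factors containing `a` cancel the denominators at `a`; the numerators of its
    -- `l` fractions raise the exponent by `l`.
    vand-h : ∀ k {l} s → Distinct s → length s ≡ suc l →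
      vand X s * h k s ≈ alt (λ a q → mon ((k ℕ.+ l) ℕ.* u a) * vand X q) s
    vand-h k {l} s d e = begin
      vand X s * h k s
        ≈⟨ *-foc _ _ s ⟩
      foc (λ p a q → vand X s * (mon (k ℕ.* u a) * prod (λ b → ρ (u a) (u b)) (p ++ q))) s
        ≈⟨ foc-congˢ (λ s′ → s′ ≡ s × Distinct s′) (λ { p a q (≡.refl , d) → term p a q d e }) s (≡.refl , d) ⟩
      foc (λ p a q → sgn (length p) * (mon ((k ℕ.+ l) ℕ.* u a) * vand X (p ++ q))) s
        ≈⟨ foc-alt _ s ⟩
      alt (λ a q → mon ((k ℕ.+ l) ℕ.* u a) * vand X q) s ∎
      where
      term : ∀ p a q → Distinct (p ++ a ∷ q) → length (p ++ a ∷ q) ≡ suc l →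
        vand X (p ++ a ∷ q) * (mon (k ℕ.* u a) * prod (λ b → ρ (u a) (u b)) (p ++ q)) ≈
        sgn (length p) * (mon ((k ℕ.+ l) ℕ.* u a) * vand X (p ++ q))
      term p a q d e = begin
        vand X (p ++ a ∷ q) * (mon (k ℕ.* u a) * prod (λ b → ρ (u a) (u b)) (p ++ q))
          ≈⟨ *-congʳ (vand-focus X p a q) ⟩
        (sgn (length p) * (prod (λ b → X a - X b) (p ++ q) * vand X (p ++ q))) * (mon (k ℕ.* u a) * prod (λ b → ρ (u a) (u b)) (p ++ q))
          ≈⟨ solve 5 (λ s d v m r → (s :* (d :* v)) :* (m :* r) := s :* ((m :* (d :* r)) :* v)) refl _ _ _ _ _ ⟩
        sgn (length p) * ((mon (k ℕ.* u a) * (prod (λ b → X a - X b) (p ++ q) * prod (λ b → ρ (u a) (u b)) (p ++ q))) * vand X (p ++ q))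
          ≈⟨ *-congˡ (*-congʳ (*-congˡ (trans (sym (prod-* _ _ (p ++ q)))
               (trans (prod-congᴬ (All.map ρ-mul (proj₁ (split-Distinct p a q d)))) (prod-const _ (p ++ q)))))) ⟩
        sgn (length p) * ((mon (k ℕ.* u a) * X a ^ length (p ++ q)) * vand X (p ++ q))
          ≡⟨ ≡.cong (λ l → sgn (length p) * ((mon (k ℕ.* u a) * X a ^ l) * vand X (p ++ q))) (rest-length p e) ⟩
        sgn (length p) * ((mon (k ℕ.* u a) * X a ^ l) * vand X (p ++ q))
          ≈⟨ *-congˡ (*-congʳ (trans (*-congˡ (sym (Walk.mon-* Q 0 l (u a)))) (trans (sym (mon-+ _ _))
               (mon-≡ (≡.sym (ℕₚ.*-distribʳ-+ (u a) k l)))))) ⟩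
        sgn (length p) * (mon ((k ℕ.+ l) ℕ.* u a) * vand X (p ++ q)) ∎

    monomial : A → ℕ → Carrier
    monomial a j = mon (j ℕ.* u a)

    -- Inserting the factor `h 0`, which is 1, turns the Vandermonde product into the column
    -- expansion of the alternant; the minors are handled by induction.
    vand-det : ∀ l s → Distinct s → length s ≡ l → vand X s ≈ det monomial s (downFrom l)
    alt-vand : ∀ e l s → Distinct s → length s ≡ suc l →
      alt (λ a q → mon (e ℕ.* u a) * vand X q) s ≈ det monomial s (e ∷ downFrom l)

    alt-vand e l s d s≡ = begin
      alt (λ a q → mon (e ℕ.* u a) * vand X q) s
        ≈⟨ sym (foc-alt _ s) ⟩
      foc (λ p a q → sgn (length p) * (mon (e ℕ.* u a) * vand X (p ++ q))) s
        ≈⟨ foc-congˢ (λ s → Distinct s × length s ≡ suc l) (λ { p a q (d , e) → *-congˡ (*-congˡ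
             (vand-det l (p ++ q) (proj₂ (split-Distinct p a q d)) (rest-length p e))) }) s (d , s≡) ⟩
      foc (λ p a q → sgn (length p) * (mon (e ℕ.* u a) * det monomial (p ++ q) (downFrom l))) s
        ≈⟨ foc-alt _ s ⟩
      alt (λ a q → mon (e ℕ.* u a) * det monomial q (downFrom l)) s
        ≈⟨ sym (det-column monomial s e (downFrom l)) ⟩
      det monomial s (e ∷ downFrom l) ∎

    vand-det zero    []      d e = refl
    vand-det (suc l) (a ∷ s) d e = begin
      vand X (a ∷ s)                                                  ≈⟨ sym (*-identityʳ _) ⟩
      vand X (a ∷ s) * 1#                                             ≈⟨ *-congˡ (sym (h-0 a s d)) ⟩
      vand X (a ∷ s) * h 0 (a ∷ s)                                    ≈⟨ vand-h 0 (a ∷ s) d e ⟩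
      alt (λ a q → mon (l ℕ.* u a) * vand X q) (a ∷ s)                ≈⟨ alt-vand l l (a ∷ s) d e ⟩
      det monomial (a ∷ s) (downFrom (suc l)) ∎

    -- The bialternant formula for the Schur function of the one-row partition (k).
    vand-h-det : ∀ k l s → Distinct s → length s ≡ suc l →
      vand X s * h k s ≈ det monomial s ((k ℕ.+ l) ∷ downFrom l)
    vand-h-det k l s d e = trans (vand-h k s d e) (alt-vand (k ℕ.+ l) l s d e)

  -- Both walks count lattice paths weighted by the same determinant over
  -- power series in an auxiliary variable, up to transposition.
  module Dual (m l k : ℕ) (k≤m : k ≤ m) where
    n κ : ℕ
    n = suc l
    κ = m ℕ.+ n

    -- The exponents of the alternant for (k), which after transposition serve as residues mod κ.
    μ : List ℕ
    μ = (k ℕ.+ l) ∷ downFrom l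

    μ<κ : All (_< κ) μ
    μ<κ = ℕₚ.≤-trans (s≤s (ℕₚ.+-monoˡ-≤ l k≤m)) (ℕₚ.≤-reflexive (≡.sym (ℕₚ.+-suc m l)))
        ∷ All.map (λ h → ℕₚ.≤-trans h (ℕₚ.≤-trans (ℕₚ.n≤1+n l) (ℕₚ.m≤n+m n m))) (downFrom-< l)

    μ# : AllPairs _≢_ μ
    μ# = All.map (λ h e → ℕₚ.<⇒≢ (ℕₚ.<-≤-trans h (ℕₚ.m≤n+m l k)) (≡.sym e)) (downFrom-< l) ∷ downFrom-# l

    module W₁ = Walk Q n
    module W₂ = Walk Q κ
    module C₁ = Walk.Parts Q n (downFrom n) (downFrom-< n) (downFrom-# n)
    module C₂ = Walk.Parts Q κ μ μ<κ μ#

    -- The power of q accounts for the r parts equal to m, and `h` is a last step with the weight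
    -- belonging to the part k.
    f₁ : W₁.State → Carrier
    f₁ s = mon (m ℕ.* W₁.energy s) * h W₁.u k s

    N₁ : ℕ → ℕ → ℕ → Carrier
    N₁ c j y = mon (κ ℕ.* W₁.ladder c y) * mon (j ℕ.* (c ℕ.+ n ℕ.* y))

    N₂ : ℕ → ℕ → ℕ → Carrier
    N₂ j c y = mon (n ℕ.* W₂.ladder j y) * mon (c ℕ.* (j ℕ.+ κ ℕ.* y))

    -- Both exponents equal κ n y(y-1)/2 + κ c y + n j y + c j.
    N-flip : ∀ c j y → N₁ c j y ≈ N₂ j c y
    N-flip c j y = trans (sym (mon-+ _ _)) (trans (mon-≡ (exponent y)) (mon-+ _ _))
      where
      open ≡.≡-Reasoning
      exponent : ∀ y → κ ℕ.* W₁.ladder c y ℕ.+ j ℕ.* (c ℕ.+ n ℕ.* y) ≡ n ℕ.* W₂.ladder j y ℕ.+ c ℕ.* (j ℕ.+ κ ℕ.* y)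
      exponent zero    = solveℕ 4 (λ κ j c n → κ ⊗ conℕ 0 ⊕ j ⊗ (c ⊕ n ⊗ conℕ 0) ⊜ n ⊗ conℕ 0 ⊕ c ⊗ (j ⊕ κ ⊗ conℕ 0)) ≡.refl κ j c n
      exponent (suc y) =
        ≡.trans (solveℕ 6 (λ κ j c n y w → κ ⊗ (w ⊕ (c ⊕ n ⊗ y)) ⊕ j ⊗ (c ⊕ n ⊗ (conℕ 1 ⊕ y))
                    ⊜ (κ ⊗ w ⊕ j ⊗ (c ⊕ n ⊗ y)) ⊕ (κ ⊗ (c ⊕ n ⊗ y) ⊕ j ⊗ n)) ≡.refl κ j c n y (W₁.ladder c y))
        (≡.trans (≡.cong (ℕ._+ (κ ℕ.* (c ℕ.+ n ℕ.* y) ℕ.+ j ℕ.* n)) (exponent y))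
        (solveℕ 6 (λ κ j c n y w → (n ⊗ w ⊕ c ⊗ (j ⊕ κ ⊗ y)) ⊕ (κ ⊗ (c ⊕ n ⊗ y) ⊕ j ⊗ n)
                    ⊜ n ⊗ (w ⊕ (j ⊕ κ ⊗ y)) ⊕ c ⊗ (j ⊕ κ ⊗ (conℕ 1 ⊕ y))) ≡.refl κ j c n y (W₂.ladder j y)))

    energy-prod : ∀ (T e : ℕ) s → mon (e ℕ.* Walk.energy Q T s) ≈ prod (λ a → mon (e ℕ.* Walk.ladder Q T (proj₁ a) (proj₂ a))) s
    energy-prod T e []      = trans (mon-≡ (ℕₚ.*-zeroʳ e)) mon-0
    energy-prod T e (a ∷ s) = trans (mon-≡ (ℕₚ.*-distribˡ-+ e _ _)) (trans (mon-+ _ _) (*-congˡ (energy-prod T e s)))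

    length-Inv : ∀ {cs l} {s : W₁.State} → map proj₁ s ≡ cs → length cs ≡ l → length s ≡ l
    length-Inv {s = s} ≡.refl ≡.refl = ≡.sym (Lₚ.length-map proj₁ s)

    n₁≡n : C₁.n ≡ n
    n₁≡n = Lₚ.length-downFrom n

    n₂≡n : C₂.n ≡ n
    n₂≡n = ≡.cong suc (Lₚ.length-downFrom l)

    comps₁ : ∀ r → comps (C₁.weight-f f₁) (downFrom n) r ≈ P.det N₁ (downFrom n) μ r
    comps₁ r = trans (comps-congˢ (downFrom n) r term) (sym (det-coefficient N₁ (downFrom n) μ r))
      where
      term : ∀ s → map proj₁ s ≡ downFrom n → size s ≡ r →
        C₁.weight-f f₁ s ≈ det (λ a j → N₁ (proj₁ a) j (proj₂ a)) s μ
      term s e e′ = begin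
        mon (C₁.n ℕ.* W₁.energy s) * (vand W₁.X s * (mon (m ℕ.* W₁.energy s) * h W₁.u k s))
          ≈⟨ solve 4 (λ a b c d → a :* (b :* (c :* d)) := (c :* a) :* (b :* d)) refl _ _ _ _ ⟩
        (mon (m ℕ.* W₁.energy s) * mon (C₁.n ℕ.* W₁.energy s)) * (vand W₁.X s * h W₁.u k s)
          -- The modulus κ = m + n arises here: q^(m e) from `f₁` meets q^(n e) from the walk
          -- formula.
          ≈⟨ *-cong (trans (sym (mon-+ _ _)) (mon-≡ (≡.trans (≡.sym (ℕₚ.*-distribʳ-+ (W₁.energy s) m C₁.n))
               (≡.cong (λ n → (m ℕ.+ n) ℕ.* W₁.energy s) n₁≡n))))
               (vand-h-det W₁.u k l s (proj₁ (C₁.Inv⇒distinct s (e , e′))) (length-Inv e n₁≡n)) ⟩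
        mon (κ ℕ.* W₁.energy s) * det (monomial W₁.u) s μ
          ≈⟨ *-congʳ (energy-prod n κ s) ⟩
        _ ≈⟨ det-scale _ _ s μ ⟩
        det (λ a j → N₁ (proj₁ a) j (proj₂ a)) s μ ∎

    comps₂ : ∀ r → comps (C₂.weight-f (λ _ → 1#)) μ r ≈ P.det N₂ μ (downFrom n) r
    comps₂ r = trans (comps-congˢ μ r term) (sym (det-coefficient N₂ μ (downFrom n) r))
      where
      term : ∀ s → map proj₁ s ≡ μ → size s ≡ r →
        C₂.weight-f (λ _ → 1#) s ≈ det (λ a j → N₂ (proj₁ a) j (proj₂ a)) s (downFrom n)
      term s e e′ = begin
        mon (C₂.n ℕ.* W₂.energy s) * (vand W₂.X s * 1#)
          ≈⟨ *-cong (mon-≡ (≡.cong (λ n → n ℕ.* W₂.energy s) n₂≡n)) (*-identityʳ _) ⟩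
        mon (n ℕ.* W₂.energy s) * vand W₂.X s
          ≈⟨ *-cong (energy-prod κ n s) (vand-det W₂.u n s (proj₁ (C₂.Inv⇒distinct s (e , e′))) (length-Inv e n₂≡n)) ⟩
        _ ≈⟨ det-scale _ _ s (downFrom n) ⟩
        det (λ a j → N₂ (proj₁ a) j (proj₂ a)) s (downFrom n) ∎

    comps≈ : ∀ r → comps (C₁.weight-f f₁) (downFrom n) r ≈ comps (C₂.weight-f (λ _ → 1#)) μ r
    comps≈ r = begin
      _ ≈⟨ comps₁ r ⟩
      P.det N₁ (downFrom n) μ r                  ≈⟨ Det.det-transpose PS N₁ (downFrom n) μ r ⟩
      P.det (flip N₁) μ (downFrom n) r           ≈⟨ Det.det-cong PS (λ j c y → N-flip c j y) μ (downFrom n) r ⟩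
      P.det N₂ μ (downFrom n) r                  ≈⟨ sym (comps₂ r) ⟩
      _ ∎
      where
      PS = PowerSeries.powerSeries cring

    -- The increments differ by m r + k, because κ - n = m and the sum of `μ` exceeds that of 0,
    -- ..., n-1 by k. This is the origin of the normalising exponent of the theorem.
    K-shift : ∀ r → C₂.K r ≡ C₁.K r ℕ.+ shiftExp m k r
    K-shift zero    = ≡.sym (≡.cong₂ ℕ._+_ (ℕₚ.*-zeroʳ m) (ℕₚ.*-zeroʳ k))
    K-shift (suc r) = ≡.trans (≡.cong (ℕ._+ (κ ℕ.* r ℕ.+ ℕL.sum μ)) (K-shift r))
      (≡.trans (solveℕ 8 (λ a m b k r n l d → (a ⊕ (m ⊗ b ⊕ k ⊗ r)) ⊕ ((m ⊕ n) ⊗ r ⊕ (k ⊕ l ⊕ d))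
         ⊜ (a ⊕ (n ⊗ r ⊕ (l ⊕ d))) ⊕ (m ⊗ (r ⊕ b) ⊕ k ⊗ (conℕ 1 ⊕ r))) ≡.refl
           (C₁.K r) m (r C 2) k r n l (ℕL.sum (downFrom l)))
       (≡.cong (λ b → C₁.K (suc r) ℕ.+ (m ℕ.* b ℕ.+ k ℕ.* suc r))
         (≡.trans (≡.cong (ℕ._+ r C 2) (≡.sym (nC1≡n r))) (nCk+nC[k+1]≡[n+1]C[k+1] r 1))))

    sg≡ : C₂.sg ≡ C₁.sg
    sg≡ = ≡.cong (λ n → sgn (n ∸ 1)) (≡.trans n₂≡n (≡.sym n₁≡n))

    -- The two walk formulas share their sum over compositions. Cancelling the common power of q and
    -- the signs leaves the shift; the finite symbols stay multiplied across.
    walk-duality : ∀ r →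
      W₂.poch κ r * (vand W₁.X C₁.origin * W₁.walk r (λ s → f₁ s * C₁.P s) C₁.origin) ≈
      W₁.poch n r * (vand W₂.X C₂.origin * (mon (shiftExp m k r) * W₂.walk r C₂.P C₂.origin))
    walk-duality r = mon-cancel (C₁.K r) (begin
      M * (p₂ * (V₁ * w₁))
        ≈⟨ trans (sym (*-identityˡ _)) (*-congʳ (sym S²)) ⟩
      (S * S) * (M * (p₂ * (V₁ * w₁)))
        ≈⟨ solve 5 (λ s m p v w → (s :* s) :* (m :* (p :* (v :* w))) := s :* (p :* (v :* ((m :* s) :* w)))) refl _ _ _ _ _ ⟩
      S * (p₂ * (V₁ * ((M * S) * w₁)))
        ≈⟨ *-congˡ (*-congˡ (trans (C₁.walk-formula r f₁) (*-congˡ (comps≈ r)))) ⟩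
      S * (p₂ * (p₁ * D))
        ≈⟨ solve 4 (λ s p r d → s :* (p :* (r :* d)) := s :* (r :* (p :* d))) refl _ _ _ _ ⟩
      S * (p₁ * (p₂ * D))
        ≈⟨ *-congˡ (*-congˡ (sym (C₂.walk-formula r (λ _ → 1#)))) ⟩
      S * (p₁ * (V₂ * ((mon (C₂.K r) * C₂.sg ^ r) * W₂.walk r (λ s → 1# * C₂.P s) C₂.origin)))
        ≈⟨ *-congˡ (*-congˡ (*-congˡ (*-cong (*-cong (trans (mon-≡ (K-shift r)) (mon-+ _ _)) (reflexive (≡.cong (_^ r) sg≡)))
             (W₂.walk-cong r (λ s → *-identityˡ _) C₂.origin)))) ⟩
      S * (p₁ * (V₂ * (((M * mon (shiftExp m k r)) * S) * w₂)))
        ≈⟨ solve 6 (λ s p v m x w → s :* (p :* (v :* (((m :* x) :* s) :* w))) := (s :* s) :* (m :* (p :* (v :* (x :* w))))) refl _ _ _ _ _ _ ⟩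
      (S * S) * (M * (p₁ * (V₂ * (mon (shiftExp m k r) * w₂))))
        ≈⟨ trans (*-congʳ S²) (*-identityˡ _) ⟩
      M * (p₁ * (V₂ * (mon (shiftExp m k r) * w₂))) ∎)
      where
      M  = mon (C₁.K r)
      S  = C₁.sg ^ r
      p₁ = W₁.poch n r
      p₂ = W₂.poch κ r
      V₁ = vand W₁.X C₁.origin
      V₂ = vand W₂.X C₂.origin
      w₁ = W₁.walk r (λ s → f₁ s * C₁.P s) C₁.origin
      w₂ = W₂.walk r C₂.P C₂.origin
      D  = comps (C₂.weight-f (λ _ → 1#)) μ r
      S² : S * S ≈ 1#
      S² = trans (sym (*-^ C₁.sg C₁.sg r)) (trans (^-cong r (sgn² (C₁.n ∸ 1))) (1^ r))

-- Divisibility by and congruence modulo powers of q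

module Order (Q : QRing) where
  open QRing Q
  open CommutativeRing cring hiding (zero)
  open Kit cring
  open QKit Q
  open SetoidReasoning setoid

  Ord : ℕ → Carrier → Set
  Ord B x = ∃[ y ] x ≈ mon B * y

  Ord-resp : ∀ {B x y} → x ≈ y → Ord B x → Ord B y
  Ord-resp e (z , h) = z , trans (sym e) h

  Ord-≤ : ∀ {A B x} → A ≤ B → Ord B x → Ord A x
  Ord-≤ {A} {B} A≤B (z , h) = mon (B ∸ A) * z , trans h (trans (*-congʳ (mon-∸ A≤B)) (*-assoc _ _ _))

  Ord-0 : ∀ {B} → Ord B 0#
  Ord-0 = 0# , sym (zeroʳ _)

  Ord-+ : ∀ {B x y} → Ord B x → Ord B y → Ord B (x + y)
  Ord-+ (z , h) (z′ , h′) = z + z′ , trans (+-cong h h′) (sym (distribˡ _ _ _))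

  Ord-* : ∀ {A B x y} → Ord A x → Ord B y → Ord (A ℕ.+ B) (x * y)
  Ord-* {A} {B} (z , h) (z′ , h′) = z * z′ , trans (*-cong h h′)
    (trans (solve 4 (λ a b c d → (a :* b) :* (c :* d) := (a :* c) :* (b :* d)) refl _ _ _ _) (*-congʳ (sym (mon-+ A B))))

  Ord-*ʳ : ∀ {B x} a → Ord B x → Ord B (a * x)
  Ord-*ʳ a (z , h) = a * z , trans (*-congˡ h) (solve 3 (λ a b c → a :* (b :* c) := b :* (a :* c)) refl _ _ _)

  Ord-*ˡ : ∀ {B x} a → Ord B x → Ord B (x * a)
  Ord-*ˡ a h = Ord-resp (*-comm _ _) (Ord-*ʳ a h)

  Ord-mon : ∀ {A B} y → A ≤ B → Ord A (mon B * y)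
  Ord-mon y A≤B = Ord-≤ A≤B (y , refl)

  infix 4 _≈_[mod_]
  _≈_[mod_] : Carrier → Carrier → ℕ → Set
  x ≈ y [mod B ] = Ord B (x - y)

  ≈⇒mod : ∀ {B x y} → x ≈ y → x ≈ y [mod B ]
  ≈⇒mod e = Ord-resp (sym (trans (+-congʳ e) (-‿inverseʳ _))) Ord-0

  mod-trans : ∀ {B x y z} → x ≈ y [mod B ] → y ≈ z [mod B ] → x ≈ z [mod B ]
  mod-trans {x = x} {y} {z} h h′ =
    Ord-resp (solve 3 (λ x y z → (x :- y) :+ (y :- z) := x :- z) refl x y z) (Ord-+ h h′)

  mod-sym : ∀ {B x y} → x ≈ y [mod B ] → y ≈ x [mod B ]
  mod-sym {x = x} {y} h = Ord-resp (solve 2 (λ x y → :- :1 :* (x :- y) := y :- x) refl x y) (Ord-*ʳ (- 1#) h)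

  mod-* : ∀ {B x y x′ y′} → x ≈ x′ [mod B ] → y ≈ y′ [mod B ] → x * y ≈ x′ * y′ [mod B ]
  mod-* {x = x} {y} {x′} {y′} h h′ =
    Ord-resp (solve 4 (λ x y x′ y′ → (x :- x′) :* y :+ x′ :* (y :- y′) := x :* y :- x′ :* y′) refl x y x′ y′)
             (Ord-+ (Ord-*ˡ y h) (Ord-*ʳ x′ h′))

  mod-*-1 : ∀ {B} x y z → x ≈ y [mod B ] → z ≈ 1# [mod B ] → x * z ≈ y [mod B ]
  mod-*-1 x y z h h′ = mod-trans (mod-* h h′) (≈⇒mod (*-identityʳ y))

  mod-inverse : ∀ {B} x y x′ y′ → x ≈ x′ [mod B ] → y ≈ y′ [mod B ] → x * y ≈ 1# → x′ * y′ ≈ 1# [mod B ]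
  mod-inverse x y x′ y′ h h′ e = mod-trans (mod-* (mod-sym h) (mod-sym h′)) (≈⇒mod e)

  mod-+ : ∀ {B x y x′ y′} → x ≈ x′ [mod B ] → y ≈ y′ [mod B ] → x + y ≈ x′ + y′ [mod B ]
  mod-+ {x = x} {y} {x′} {y′} h h′ =
    Ord-resp (solve 4 (λ x y x′ y′ → (x :- x′) :+ (y :- y′) := (x :+ y) :- (x′ :+ y′)) refl x y x′ y′) (Ord-+ h h′)

  -- Dividing by q^A costs A orders of precision.
  mod-cancel : ∀ {A B x y} → mon A * x ≈ mon A * y [mod A ℕ.+ B ] → x ≈ y [mod B ]
  mod-cancel {A} {B} {x} {y} (z , h) = z , mon-cancel A (begin
    mon A * (x - y)        ≈⟨ solve 3 (λ a x y → a :* (x :- y) := a :* x :- a :* y) refl _ _ _ ⟩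
    mon A * x - mon A * y  ≈⟨ h ⟩
    mon (A ℕ.+ B) * z      ≈⟨ *-congʳ (mon-+ A B) ⟩
    mon A * mon B * z      ≈⟨ *-assoc _ _ _ ⟩
    mon A * (mon B * z) ∎)

  mod-prod : ∀ {A : Set} {B} {f g : A → Carrier} xs → All (λ a → f a ≈ g a [mod B ]) xs → prod f xs ≈ prod g xs [mod B ]
  mod-prod []       []       = ≈⇒mod refl
  mod-prod (x ∷ xs) (h ∷ hs) = mod-* h (mod-prod xs hs)

  Ord-foc : ∀ {A : Set} {B} (P : List A → Set) {f : Foc A} → (∀ p x q → P (p ++ x ∷ q) → Ord B (f p x q)) →
    ∀ xs → P xs → Ord B (foc f xs)
  Ord-foc P h []       _  = Ord-0
  Ord-foc P h (x ∷ xs) px = Ord-+ (h [] x xs px) (Ord-foc (P ∘ (x ∷_)) (λ p → h (x ∷ p)) xs px)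

  mod-foc : ∀ {A : Set} {B} (P : List A → Set) {f g : Foc A} → (∀ p x q → P (p ++ x ∷ q) → f p x q ≈ g p x q [mod B ]) →
    ∀ xs → P xs → foc f xs ≈ foc g xs [mod B ]
  mod-foc P h []       _  = ≈⇒mod refl
  mod-foc P h (x ∷ xs) px = mod-+ (h [] x xs px) (mod-foc (P ∘ (x ∷_)) (λ p → h (x ∷ p)) xs px)

find : ∀ {A : Set} {P : A → Set} → (∀ a → Dec (P a)) → ∀ s →
  (∃[ p ] ∃[ a ] ∃[ q ] (s ≡ p ++ a ∷ q × P a)) ⊎ All (λ a → ¬ P a) s
find P? []      = inj₂ []
find P? (a ∷ s) with P? a | find P? s
... | yes pa | _                               = inj₁ ([] , a , s , ≡.refl , pa)
... | no ¬pa | inj₁ (p , b , q , ≡.refl , pb)  = inj₁ (a ∷ p , b , q , ≡.refl , pb)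
... | no ¬pa | inj₂ h                          = inj₂ (¬pa ∷ h)

C2-suc : ∀ r → suc r C 2 ≡ r ℕ.+ r C 2
C2-suc r = ≡.trans (≡.sym (nCk+nC[k+1]≡[n+1]C[k+1] r 1)) (≡.cong (ℕ._+ r C 2) (nC1≡n r))

-- Energy bounds and the spread of a walk

module WalkBounds (Q : QRing) (T : ℕ) (cs : List ℕ) (cs<T : All (_< T) cs) (cs# : AllPairs _≢_ cs) where
  open QRing Q
  open CommutativeRing cring hiding (zero)
  open Kit cring
  open QKit Q
  open Compositions cring using (size; up)
  open Walk Q T
  open Walk.Parts Q T cs cs<T cs#
  open Order Q

  step-Ord : ∀ {B r} {g : State → Carrier} → (∀ s → Inv cs (suc r) s → Ord B (g s)) → ∀ s → Inv cs r s → Ord B (step g s)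
  step-Ord h = Ord-foc (Inv cs _) (λ p a q i → Ord-*ʳ _ (h _ (up-Inv p a q i)))

  walk-Ord : ∀ {B r₀} r {g : State → Carrier} → (∀ s → Inv cs (r ℕ.+ r₀) s → Ord B (g s)) →
    ∀ s → Inv cs r₀ s → Ord B (walk r g s)
  walk-Ord zero    h s i = h s i
  walk-Ord (suc r) h s i = walk-Ord r (step-Ord h) s i

  u-up : ∀ a → u (up a) ≡ u a ℕ.+ T
  u-up a = ≡.trans (≡.cong (proj₁ a ℕ.+_) (≡.trans (ℕₚ.*-suc T (proj₂ a)) (ℕₚ.+-comm T _))) (≡.sym (ℕₚ.+-assoc (proj₁ a) _ T))

  -- The visited numbers c + T l are distinct, so r of them sum to at least
  -- 0 + 1 + ⋯ + (r - 1); the induction removes the largest one.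
  energy-bound : ∀ M {r} s → Inv cs r s → All (λ a → u a < M ℕ.+ T) s → r C 2 ≤ energy s × r ≤ M
  energy-bound zero {r} s i low = ≡.subst (λ r → r C 2 ≤ energy s × r ≤ 0) (≡.trans (≡.sym (size-0 s low)) (proj₂ i)) (z≤n , z≤n)
    where
    size-0 : ∀ s → All (λ a → u a < T) s → size s ≡ 0
    size-0 []                []       = ≡.refl
    size-0 ((c , zero) ∷ s)  (h ∷ hs) = size-0 s hs
    size-0 ((c , suc y) ∷ s) (h ∷ hs) = ⊥-elim (ℕₚ.<⇒≱ h
      (ℕₚ.≤-trans (ℕₚ.≤-trans (ℕₚ.m≤m+n T (T ℕ.* y)) (ℕₚ.≤-reflexive (≡.sym (ℕₚ.*-suc T y)))) (ℕₚ.m≤n+m _ c)))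
  -- By `low` all visited numbers are at most M; a coordinate standing at M + T is one that visited
  -- M last.
  energy-bound (suc M) {r} s i low with find (λ a → u a ℕ.≟ M ℕ.+ T) s
  ... | inj₂ none = let e , r≤M = energy-bound M s i (All.zipWith (λ { (h , ne) → ℕₚ.≤∧≢⇒< (ℕ.s≤s⁻¹ h) ne }) (low , none))
                    in e , ℕₚ.m≤n⇒m≤1+n r≤M
  ... | inj₁ (p , (c , zero) , q , ≡.refl , e) = ⊥-elim (ℕₚ.<⇒≱ (PF.focus p (proj₂ (Inv⇒distinct s i)))
      (ℕₚ.≤-trans (ℕₚ.m≤n+m T M) (ℕₚ.≤-reflexive (≡.trans (≡.sym e) (≡.trans (≡.cong (c ℕ.+_) (ℕₚ.*-zeroʳ T)) (ℕₚ.+-identityʳ c))))))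
  ... | inj₁ (p , (c , suc y) , q , ≡.refl , e) = lemma r i
    where
    a = (c , y)
    ua≡M : u a ≡ M
    ua≡M = ℕₚ.+-cancelʳ-≡ T (u a) M (≡.trans (≡.sym (u-up a)) e)
    c<T : c < T
    c<T = PF.focus p (proj₂ (Inv⇒distinct s i))
    others : All (λ b → u b < M ℕ.+ T) (p ++ q)
    others with AllPairs-↭ (λ h e → h (≡.sym e)) (↭ₚ.shift (up a) p q) (proj₁ (Inv⇒distinct s i))
              | ↭ₚ.All-resp-↭ (↭ₚ.shift (up a) p q) low
    ... | a# ∷ _ | _ ∷ low′ = All.zipWith (λ { (ne , h) → ℕₚ.≤∧≢⇒< (ℕ.s≤s⁻¹ h) (λ e′ → ne (≡.trans e (≡.sym e′))) }) (a# , low′)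
    low′ : All (λ b → u b < M ℕ.+ T) (p ++ a ∷ q)
    low′ = ↭ₚ.All-resp-↭ (↭.↭-sym (↭ₚ.shift a p q))
      (≡.subst (_< M ℕ.+ T) (≡.sym ua≡M) (ℕₚ.m<m+n M (ℕₚ.≤-<-trans z≤n c<T)) ∷ others)
    size-up : size s ≡ suc (size (p ++ a ∷ q))
    size-up = ≡.trans (size-++ p _) (≡.trans (ℕₚ.+-suc _ _) (≡.cong suc (≡.sym (size-++ p _))))
    lemma : ∀ r → Inv cs r s → r C 2 ≤ energy s × r ≤ suc M
    lemma r (e₁ , e₂) with ≡.trans (≡.sym size-up) e₂
    ... | ≡.refl with energy-bound M (p ++ a ∷ q)
                      (≡.trans (≡.trans (Lₚ.map-++ proj₁ p _) (≡.sym (Lₚ.map-++ proj₁ p _))) e₁ , ≡.refl) low′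
    ...   | e , r≤M =
      ℕₚ.≤-trans (ℕₚ.≤-reflexive (≡.trans (C2-suc r′) (ℕₚ.+-comm r′ _)))
        (ℕₚ.≤-trans (ℕₚ.+-mono-≤ e (ℕₚ.≤-trans r≤M (ℕₚ.≤-reflexive (≡.sym ua≡M)))) (ℕₚ.≤-reflexive (≡.sym (energy-up p a q)))) , s≤s r≤M
      where
      r′ = size (p ++ a ∷ q)

  energy-≥ : ∀ {r} s → Inv cs r s → r C 2 ≤ energy s
  energy-≥ s i = proj₁ (energy-bound (suc (ℕL.sum (map u s))) s i (All.map (λ h → ℕₚ.≤-trans (s≤s h) (ℕₚ.m≤m+n _ T)) (bounded s)))
    where
    bounded : ∀ s → All (λ a → u a ≤ ℕL.sum (map u s)) s
    bounded []      = []
    bounded (a ∷ s) = ℕₚ.m≤m+n _ _ ∷ All.map (λ h → ℕₚ.≤-trans h (ℕₚ.m≤n+m _ (u a))) (bounded s)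

  -- This is `energy-≥` after one more step.
  energy-u-≥ : ∀ {r} p a q → Inv cs r (p ++ a ∷ q) → r C 2 ℕ.+ r ≤ energy (p ++ a ∷ q) ℕ.+ u a
  energy-u-≥ {r} p a q i = ℕₚ.≤-trans (ℕₚ.≤-reflexive (≡.trans (ℕₚ.+-comm _ r) (≡.sym (C2-suc r))))
    (ℕₚ.≤-trans (energy-≥ _ (up-Inv p a q i)) (ℕₚ.≤-reflexive (energy-up p a q)))

  All-energy-u-≥ : ∀ {r} s → Inv cs r s → All (λ b → r C 2 ℕ.+ r ≤ energy s ℕ.+ u b) s
  All-energy-u-≥ s i = go [] s i
    where
    go : ∀ {r} p t → Inv cs r (p ++ t) → All (λ b → r C 2 ℕ.+ r ≤ energy (p ++ t) ℕ.+ u b) t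
    go p []      i = []
    go {r} p (b ∷ t) i = energy-u-≥ p b t i ∷ ≡.subst (λ s → All (λ b → r C 2 ℕ.+ r ≤ energy s ℕ.+ u b) t)
      (Lₚ.++-assoc p (b ∷ []) t) (go (p ++ b ∷ []) t (≡.subst (Inv cs r) (≡.sym (Lₚ.++-assoc p (b ∷ []) t)) i))

  -- Two more steps, raising `a` and then `b`; the summand T covers the case that `b` is `a` itself.
  energy-u-u-≥ : ∀ {r} p a q → Inv cs r (p ++ a ∷ q) →
    All (λ b → r C 2 ℕ.+ r ℕ.+ r ≤ energy (p ++ a ∷ q) ℕ.+ u a ℕ.+ (u b ℕ.+ T)) (p ++ a ∷ q)
  energy-u-u-≥ {r} p a q i with ↭ₚ.All-resp-↭ (↭ₚ.shift (up a) p q) (All-energy-u-≥ _ (up-Inv p a q i))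
  ... | ha ∷ hs = ↭ₚ.All-resp-↭ (↭.↭-sym (↭ₚ.shift a p q)) (conv {up a} {a} (ℕₚ.≤-reflexive (u-up a)) ha
                    ∷ All.map (λ {b} → conv {b} {b} (ℕₚ.m≤m+n (u b) T)) hs)
    where
    conv : ∀ {b′ b} → u b′ ≤ u b ℕ.+ T → suc r C 2 ℕ.+ suc r ≤ energy (p ++ up a ∷ q) ℕ.+ u b′ →
      r C 2 ℕ.+ r ℕ.+ r ≤ energy (p ++ a ∷ q) ℕ.+ u a ℕ.+ (u b ℕ.+ T)
    conv {b′} {b} h h′ = ℕₚ.≤-trans (ℕₚ.+-mono-≤ (ℕₚ.≤-reflexive (≡.trans (ℕₚ.+-comm _ r) (≡.sym (C2-suc r)))) (ℕₚ.n≤1+n r))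
      (ℕₚ.≤-trans h′ (ℕₚ.+-mono-≤ (ℕₚ.≤-reflexive (energy-up p a q)) h))

  module _ (pinf : ℕ → Carrier) (approx : ∀ a y → poch a y ≈ pinf a [mod T ℕ.* y ]) where
    P∞ : Carrier
    P∞ = prod (λ c → prod (λ b → pinf ((T ℕ.+ c) ∸ b)) cs) cs

    P-approx : ∀ {B r} s → Inv cs r s → All (λ a → B ≤ T ℕ.* proj₂ a) s → P s ≈ P∞ [mod B ]
    P-approx s (≡.refl , _) h = mod-trans
      (mod-prod s (All.map (λ {a} B≤ → mod-prod cs (All.universal (λ b → Ord-≤ B≤ (approx ((T ℕ.+ proj₁ a) ∸ b) (proj₂ a))) cs)) h))
      (≈⇒mod (reflexive (≡.sym (prod-map (λ c → prod (λ b → pinf ((T ℕ.+ c) ∸ b)) cs) proj₁ s))))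

    Spread : ℕ → State → Set
    Spread D s = All (λ a → All (λ b → u a ≤ u b ℕ.+ D) s) s

    -- A step that widens the spread beyond D multiplies by a high power of q.
    step-spread : ∀ {B r} {g : State → Carrier} →
      (∀ s → Inv cs (suc r) s → Spread (B ℕ.+ T) s → Ord B (g s)) → ∀ s → Inv cs r s → Spread (B ℕ.+ T) s → Ord B (step g s)
    step-spread {B} {r} {g} h s i sp = Ord-foc (λ s → Inv cs r s × Spread D s) term s (i , sp)
      where
      D = B ℕ.+ T
      term : ∀ p a q → Inv cs r (p ++ a ∷ q) × Spread D (p ++ a ∷ q) → Ord B (∏ρ a (p ++ q) * g (p ++ up a ∷ q))
      term p a q (i , sp) with find (λ b → u b ℕ.+ D ℕ.<? u (up a)) (p ++ q)
      ... | inj₁ (p′ , b , q′ , e , far) = Ord-*ˡ _ (≡.subst (λ t → Ord B (∏ρ a t)) (≡.sym e)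
              (Ord-resp (sym (Vandermonde.prod-focus cring _ p′)) (Ord-*ˡ _ (Ord-≤ B≤ (ρ-mon ub<ua)))))
        where
        ub+B<ua : u b ℕ.+ B < u a
        ub+B<ua = ℕₚ.+-cancelʳ-< T (u b ℕ.+ B) (u a) (ℕₚ.≤-trans (ℕₚ.≤-reflexive (≡.cong suc (ℕₚ.+-assoc (u b) B T)))
          (ℕₚ.≤-trans far (ℕₚ.≤-reflexive (u-up a))))
        ub<ua : u b < u a
        ub<ua = ℕₚ.≤-<-trans (ℕₚ.m≤m+n (u b) B) ub+B<ua
        B≤ : B ≤ u a ∸ u b
        B≤ = ℕₚ.≤-trans (ℕₚ.≤-reflexive (≡.sym (ℕₚ.m+n∸m≡n (u b) B))) (ℕₚ.∸-monoˡ-≤ (u b) (ℕₚ.<⇒≤ ub+B<ua))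
      ... | inj₂ near = Ord-*ʳ _ (h _ (up-Inv p a q i) sp′)
        where
        near′ : All (λ b → u (up a) ≤ u b ℕ.+ D) (p ++ q)
        near′ = All.map ℕₚ.≮⇒≥ near
        ↭s = ↭.↭-sym (↭ₚ.shift (up a) p q)
        sp-rest : All (λ b → All (λ c → u b ≤ u c ℕ.+ D) (p ++ a ∷ q)) (p ++ q)
        sp-rest = All.tail (↭ₚ.All-resp-↭ (↭ₚ.shift a p q) sp)
        widen : ∀ {b} → All (λ c → u b ≤ u c ℕ.+ D) (p ++ a ∷ q) → All (λ c → u b ≤ u c ℕ.+ D) (p ++ up a ∷ q)
        widen hb with ↭ₚ.All-resp-↭ (↭ₚ.shift a p q) hb
        ... | ha ∷ hs = ↭ₚ.All-resp-↭ ↭s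
          (ℕₚ.≤-trans ha (ℕₚ.+-monoˡ-≤ D (ℕₚ.≤-trans (ℕₚ.m≤m+n (u a) T) (ℕₚ.≤-reflexive (≡.sym (u-up a))))) ∷ hs)
        sp′ : Spread D (p ++ up a ∷ q)
        sp′ = ↭ₚ.All-resp-↭ ↭s (↭ₚ.All-resp-↭ ↭s (ℕₚ.m≤m+n _ D ∷ near′) ∷ All.map widen sp-rest)

    walk-spread : ∀ {B r₀} r {g : State → Carrier} →
      (∀ s → Inv cs (r ℕ.+ r₀) s → Spread (B ℕ.+ T) s → Ord B (g s)) → ∀ s → Inv cs r₀ s → Spread (B ℕ.+ T) s → Ord B (walk r g s)
    walk-spread zero    h = h
    walk-spread (suc r) h = walk-spread r (step-spread h)

    origin-spread : ∀ B → Spread (B ℕ.+ T) origin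
    origin-spread B = Allₚ.map⁺ (All.map (λ {c} c<T → Allₚ.map⁺ (All.universal (λ d →
      ℕₚ.≤-trans (ℕₚ.≤-reflexive (≡.trans (≡.cong (c ℕ.+_) (ℕₚ.*-zeroʳ T)) (ℕₚ.+-identityʳ c)))
        (ℕₚ.≤-trans (ℕₚ.<⇒≤ c<T) (ℕₚ.≤-trans (ℕₚ.m≤n+m T B) (ℕₚ.m≤n+m (B ℕ.+ T) (d ℕ.+ T ℕ.* 0))))) cs)) cs<T)

    size-≤ : ∀ {Z} (s : State) → All (λ a → T ℕ.* proj₂ a ≤ Z) s → T ℕ.* size s ≤ length s ℕ.* Z
    size-≤ []      []       = ℕₚ.≤-reflexive (ℕₚ.*-zeroʳ T)
    size-≤ (a ∷ s) (h ∷ hs) = ℕₚ.≤-trans (ℕₚ.≤-reflexive (ℕₚ.*-distribˡ-+ T (proj₂ a) (size s))) (ℕₚ.+-mono-≤ h (size-≤ s hs))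

    -- A single low coordinate would bound all the others through the spread, and the total height
    -- could not reach r.
    spread-high : ∀ {B r} s → 1 ≤ T → n ℕ.* ((B ℕ.+ T) ℕ.+ (B ℕ.+ T)) < r → Inv cs r s → Spread (B ℕ.+ T) s →
      All (λ a → B ≤ T ℕ.* proj₂ a) s
    spread-high {B} {r} s 1≤T r> i sp with find (λ a → T ℕ.* proj₂ a ℕ.<? B) s
    ... | inj₂ h = All.map ℕₚ.≮⇒≥ h
    ... | inj₁ (p , b , q , ≡.refl , low) = ⊥-elim (ℕₚ.<⇒≱ r> (ℕₚ.≤-trans (ℕₚ.m≤m*n r T {{ℕ.>-nonZero 1≤T}})
            (ℕₚ.≤-trans (ℕₚ.≤-reflexive (≡.trans (ℕₚ.*-comm r T) (≡.cong (T ℕ.*_) (≡.sym (proj₂ i)))))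
            (ℕₚ.≤-trans (size-≤ s (All.map (λ {a} → small {a}) sp)) (ℕₚ.≤-reflexive (≡.cong (ℕ._* (D ℕ.+ D))
              (≡.trans (≡.sym (Lₚ.length-map proj₁ s)) (≡.cong length (proj₁ i)))))))))
      where
      D = B ℕ.+ T
      b<T : proj₁ b < T
      b<T = PF.focus p (proj₂ (Inv⇒distinct s i))
      small : ∀ {a} → All (λ c → u a ≤ u c ℕ.+ D) s → T ℕ.* proj₂ a ≤ D ℕ.+ D
      small {a} h = ℕₚ.≤-trans (ℕₚ.m≤n+m _ (proj₁ a)) (ℕₚ.≤-trans (PF.focus {λ c → u a ≤ u c ℕ.+ D} p h) (ℕₚ.+-monoˡ-≤ D
        (ℕₚ.≤-trans (ℕₚ.+-mono-≤ (ℕₚ.<⇒≤ b<T) (ℕₚ.<⇒≤ low)) (ℕₚ.≤-reflexive (ℕₚ.+-comm T B)))))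

    walk-P : ∀ B r → 1 ≤ T → n ℕ.* ((B ℕ.+ T) ℕ.+ (B ℕ.+ T)) < r → walk r (λ s → P s - P∞) origin ≈ 0# [mod B ]
    walk-P B r 1≤T r> = Ord-resp (solve 1 (λ x → x := x :- con (+ 0)) refl _)
      (walk-spread r (λ s i sp → P-approx s i (spread-high s 1≤T (ℕₚ.<-≤-trans r> (ℕₚ.m≤m+n r 0)) i sp)) origin origin-Inv (origin-spread B))

-- The limit of the duality

record QRing∞ : Set₁ where
  field
    base : QRing
  open QRing base
  open CommutativeRing cring
  open Order base using (_≈_[mod_])
  field
    -- pinf a T = (q^a; q^T)_∞
    pinf        : ℕ → ℕ → Carrier
    pinf-approx : ∀ T a y → Walk.poch base T a y ≈ pinf a T [mod T ℕ.* y ]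
    separated   : ∀ {x y} → (∀ B → x ≈ y [mod B ]) → x ≈ y

module Limit (Q∞ : QRing∞) (m l k : ℕ) (1≤m : 1 ≤ m) (k≤m : k ≤ m) where
  open QRing∞ Q∞
  open QRing base
  open CommutativeRing cring hiding (zero)
  open Kit cring
  open QKit base
  open Order base
  open Vandermonde cring
  open Duality base
  open Dual m l k k≤m
  module B₁ = WalkBounds base n (downFrom n) (downFrom-< n) (downFrom-# n)
  module B₂ = WalkBounds base κ μ μ<κ μ#
  open SetoidReasoning setoid

  P∞₁ P∞₂ : Carrier
  P∞₁ = B₁.P∞ (λ a → pinf a n) (pinf-approx n)
  P∞₂ = B₂.P∞ (λ a → pinf a κ) (pinf-approx κ)

  V₁ V₂ : Carrier
  V₁ = vand W₁.X C₁.origin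
  V₂ = vand W₂.X C₂.origin

  shift : ℕ → ℕ
  shift = shiftExp m k

  -- Write m e + k v as (m - k) e + k (e + v) and bound both parts, using k ≤ m. Since m ≥ 1, a
  -- surplus D in both bounds remains at least D.
  shift-bound : ∀ D {e v} r → r C 2 ℕ.+ D ≤ e → r C 2 ℕ.+ r ℕ.+ D ≤ e ℕ.+ v → shift r ℕ.+ D ≤ m ℕ.* e ℕ.+ k ℕ.* v
  shift-bound D {e} {v} r h h′ = go (m ∸ k) (ℕₚ.m∸n+n≡m k≤m)
    where
    go : ∀ j → j ℕ.+ k ≡ m → shift r ℕ.+ D ≤ m ℕ.* e ℕ.+ k ℕ.* v
    go j ≡.refl = ℕₚ.≤-trans
      (ℕₚ.+-monoʳ-≤ (shift r) (ℕₚ.m≤n*m D (j ℕ.+ k) {{ℕ.>-nonZero 1≤m}}))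
      (ℕₚ.≤-trans (ℕₚ.≤-reflexive (solveℕ 5 (λ j k c r d → ((j ⊕ k) ⊗ c ⊕ k ⊗ r) ⊕ (j ⊕ k) ⊗ d
          ⊜ j ⊗ (c ⊕ d) ⊕ k ⊗ (c ⊕ r ⊕ d)) ≡.refl j k (r C 2) r D))
      (ℕₚ.≤-trans (ℕₚ.+-mono-≤ (ℕₚ.*-monoʳ-≤ j h) (ℕₚ.*-monoʳ-≤ k h′))
      (ℕₚ.≤-reflexive (solveℕ 4 (λ j k e v → j ⊗ e ⊕ k ⊗ (e ⊕ v) ⊜ (j ⊕ k) ⊗ e ⊕ k ⊗ v) ≡.refl j k e v))))

  f₁-Ord : ∀ {B r} s → W₁.Inv (downFrom n) r s →
    (∀ p a q → s ≡ p ++ a ∷ q → B ≤ m ℕ.* W₁.energy s ℕ.+ k ℕ.* W₁.u a) → Ord B (f₁ s)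
  f₁-Ord {B} s i h = Ord-resp (sym (*-foc _ _ s)) (Ord-foc (_≡ s) term s ≡.refl)
    where
    term : ∀ p a q → p ++ a ∷ q ≡ s →
      Ord B (mon (m ℕ.* W₁.energy s) * (mon (k ℕ.* W₁.u a) * prod (λ b → ρ (W₁.u a) (W₁.u b)) (p ++ q)))
    term p a q e = Ord-resp (trans (*-congʳ (mon-+ _ _)) (*-assoc _ _ _))
      (Ord-mon (prod (λ b → ρ (W₁.u a) (W₁.u b)) (p ++ q)) (h p a q (≡.sym e)))

  f₁-shift : ∀ {r} s → W₁.Inv (downFrom n) r s → Ord (shift r) (f₁ s)
  f₁-shift {r} s i = f₁-Ord s i (λ { p a q ≡.refl → ℕₚ.≤-trans (ℕₚ.m≤m+n _ 0) (shift-bound 0 r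
    (ℕₚ.≤-trans (ℕₚ.≤-reflexive (ℕₚ.+-identityʳ _)) (B₁.energy-≥ s i))
    (ℕₚ.≤-trans (ℕₚ.≤-reflexive (ℕₚ.+-identityʳ _)) (B₁.energy-u-≥ p a q i))) })

  -- Either all coordinates are high and `P` is close to its limit, or some coordinate lags. In that
  -- case a number well below r is still unvisited, and raising that coordinate cheaply shows that
  -- the energy already exceeds its minimum by at least B.
  gap : ∀ B {r} → (B ℕ.+ n) ℕ.+ n ℕ.+ B ≤ r → ∀ s → W₁.Inv (downFrom n) r s → Ord (shift r ℕ.+ B) (f₁ s * (C₁.P s - P∞₁))
  gap B {r} R≤r s i with find (λ a → n ℕ.* proj₂ a ℕ.<? B) s
  ... | inj₂ high = Ord-* (f₁-shift s i) (B₁.P-approx _ (pinf-approx n) s i (All.map ℕₚ.≮⇒≥ high))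
  ... | inj₁ (p₀ , b , q₀ , ≡.refl , low) = Ord-*ˡ _ (f₁-Ord s i (λ { p a q e → shift-bound B r e-≥ (eu-≥ p a q e) }))
    where
    c2 = r C 2
    en = W₁.energy s
    ub = W₁.u b
    b<n : proj₁ b < n
    b<n = C₁.PF.focus p₀ (proj₂ (C₁.Inv⇒distinct s i))
    ub≤ : ub ℕ.+ n ℕ.+ B ≤ r
    ub≤ = ℕₚ.≤-trans (ℕₚ.+-monoˡ-≤ B (ℕₚ.+-monoˡ-≤ n (ℕₚ.≤-trans (ℕₚ.+-mono-≤ (ℕₚ.<⇒≤ b<n) (ℕₚ.<⇒≤ low)) (ℕₚ.≤-reflexive (ℕₚ.+-comm n B))))) R≤r
    e-≥ : c2 ℕ.+ B ≤ en
    e-≥ = ℕₚ.+-cancelʳ-≤ ub (c2 ℕ.+ B) en (ℕₚ.≤-trans (ℕₚ.≤-reflexive (ℕₚ.+-assoc c2 B ub))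
      (ℕₚ.≤-trans (ℕₚ.+-monoʳ-≤ c2 (ℕₚ.≤-trans (ℕₚ.≤-reflexive (ℕₚ.+-comm B ub)) (ℕₚ.≤-trans (ℕₚ.+-monoˡ-≤ B (ℕₚ.m≤m+n ub n)) ub≤)))
      (B₁.energy-u-≥ p₀ b q₀ i)))
    -- The term at `a` behaves like one more visit; the bound after raising both `a` and the lagging
    -- `b` gives the same surplus.
    eu-≥ : ∀ p a q → s ≡ p ++ a ∷ q → c2 ℕ.+ r ℕ.+ B ≤ en ℕ.+ W₁.u a
    eu-≥ p a q e = ℕₚ.+-cancelʳ-≤ (ub ℕ.+ n) (c2 ℕ.+ r ℕ.+ B) (en ℕ.+ W₁.u a)
      (ℕₚ.≤-trans (ℕₚ.≤-reflexive (ℕₚ.+-assoc (c2 ℕ.+ r) B _))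
      (ℕₚ.≤-trans (ℕₚ.+-monoʳ-≤ (c2 ℕ.+ r) (ℕₚ.≤-trans (ℕₚ.≤-reflexive (ℕₚ.+-comm B _)) ub≤))
      (C₁.PF.focus {λ b → c2 ℕ.+ r ℕ.+ r ≤ en ℕ.+ W₁.u a ℕ.+ (W₁.u b ℕ.+ n)} p₀
        (≡.subst (λ t → All (λ b → c2 ℕ.+ r ℕ.+ r ≤ W₁.energy t ℕ.+ W₁.u a ℕ.+ (W₁.u b ℕ.+ n)) t) (≡.sym e)
          (B₁.energy-u-u-≥ p a q (≡.subst (W₁.Inv (downFrom n) r) e i))))))

  κ≥1 : 1 ≤ κ
  κ≥1 = ℕₚ.≤-trans (s≤s z≤n) (ℕₚ.m≤n+m n m)

  poch-limit : ∀ T B r → 1 ≤ T → B ≤ r → Walk.poch base T T r ≈ pinf T T [mod B ]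
  poch-limit T B r 1≤T B≤r = Ord-≤ (ℕₚ.≤-trans B≤r (ℕₚ.m≤n*m r T {{ℕ.>-nonZero 1≤T}})) (pinf-approx T T r)

  -- The step weights at any state sum to `h 0`, which is 1.
  walk-1 : ∀ r s {r₀} → W₂.Inv μ r₀ s → W₂.walk r (λ _ → 1#) s ≈ 1#
  walk-1 zero    s i = refl
  walk-1 (suc r) s i = trans (W₂.walk-congˢ r (λ s i → step-1 s i) s i) (walk-1 r s i)
    where
    step-1 : ∀ {r} s → W₂.Inv μ r s → W₂.step (λ _ → 1#) s ≈ 1#
    step-1 (a ∷ s) i = trans (foc-cong (λ p a q → trans (*-comm (W₂.∏ρ a (p ++ q)) 1#) (*-congʳ (sym mon-0))) (a ∷ s))
      (h-0 W₂.u a s (proj₁ (C₂.Inv⇒distinct (a ∷ s) i)))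

  -- The first summand is the threshold of `gap`, the second that of `walk-P` for the modulus κ.
  bound : ℕ → ℕ
  bound B = ((B ℕ.+ n) ℕ.+ n ℕ.+ B) ℕ.+ suc (C₂.n ℕ.* ((B ℕ.+ κ) ℕ.+ (B ℕ.+ κ)))

  walk₂-limit : ∀ B r → bound B ≤ r → W₂.walk r C₂.P C₂.origin ≈ P∞₂ [mod B ]
  walk₂-limit B r R≤r = mod-trans (≈⇒mod split) (mod-trans
    (mod-+ (B₂.walk-P (λ a → pinf a κ) (pinf-approx κ) B r κ≥1 (ℕₚ.≤-trans (ℕₚ.m≤n+m _ _) R≤r)) (≈⇒mod refl)) (≈⇒mod (+-identityˡ _)))
    where
    split : W₂.walk r C₂.P C₂.origin ≈ W₂.walk r (λ s → C₂.P s - P∞₂) C₂.origin + P∞₂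
    split = begin
      W₂.walk r C₂.P C₂.origin
        ≈⟨ W₂.walk-cong r (λ s → solve 2 (λ x y → x := (x :- y) :+ y :* :1) refl _ P∞₂) C₂.origin ⟩
      W₂.walk r (λ s → (C₂.P s - P∞₂) + P∞₂ * 1#) C₂.origin
        ≈⟨ W₂.walk-+ r _ _ C₂.origin ⟩
      W₂.walk r (λ s → C₂.P s - P∞₂) C₂.origin + W₂.walk r (λ s → P∞₂ * 1#) C₂.origin
        ≈⟨ +-congˡ (trans (sym (W₂.*-walk P∞₂ r (λ _ → 1#) C₂.origin)) (trans (*-congˡ (walk-1 r C₂.origin C₂.origin-Inv)) (*-identityʳ _))) ⟩
      W₂.walk r (λ s → C₂.P s - P∞₂) C₂.origin + P∞₂ ∎

  walk₁-Ord : ∀ {B} r {g : W₁.State → Carrier} → (∀ s → W₁.Inv (downFrom n) r s → Ord B (g s)) → Ord B (W₁.walk r g C₁.origin)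
  walk₁-Ord r h = B₁.walk-Ord r (λ s i → h s (≡.subst (λ r → W₁.Inv (downFrom n) r s) (ℕₚ.+-identityʳ r) i)) C₁.origin C₁.origin-Inv

  -- Every endpoint value of `f₁` contains the shifted power, which gives `G`. Replacing `P` by its
  -- limit in the first walk causes an error of order shift + B, so order B survives the
  -- cancellation of the shift in the duality.
  walk-limit : ∀ B r → bound B ≤ r → ∃[ G ]
    ((W₁.walk r f₁ C₁.origin ≈ mon (shift r) * G) × ((pinf κ κ * (V₁ * P∞₁)) * G ≈ pinf n n * (V₂ * P∞₂) [mod B ]))
  walk-limit B r R≤r with walk₁-Ord r f₁-shift | walk₁-Ord r (gap B (ℕₚ.≤-trans (ℕₚ.m≤m+n _ _) R≤r))
  ... | G , hG | z , hz = G , hG ,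
    mod-trans (mod-trans (≈⇒mod (*-assoc _ _ _)) (mod-trans
      (mod-* (mod-sym (poch-limit κ B r κ≥1 B≤r)) (mod-trans (≈⇒mod (*-assoc _ _ _))
        (mod-* (≈⇒mod {x = V₁} refl) (mod-trans (≈⇒mod (sym (+-identityʳ _))) (mod-+ (≈⇒mod refl) (mod-sym mon-small))))))
      (≈⇒mod cancelled)))
    (mod-* (poch-limit n B r (s≤s z≤n) B≤r) (mod-* (≈⇒mod refl) (walk₂-limit B r R≤r)))
    where
    o = C₁.origin
    w₂ = W₂.walk r C₂.P C₂.origin
    p₁ = W₁.poch n r
    p₂ = W₂.poch κ r
    B≤r : B ≤ r
    B≤r = ℕₚ.≤-trans (ℕₚ.m≤n+m B ((B ℕ.+ n) ℕ.+ n)) (ℕₚ.≤-trans (ℕₚ.m≤m+n _ _) R≤r)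
    mon-small : mon B * z ≈ 0# [mod B ]
    mon-small = Ord-resp (solve 1 (λ x → x := x :- con (+ 0)) refl _) (z , refl)
    split : W₁.walk r (λ s → f₁ s * C₁.P s) o ≈ mon (shift r) * (P∞₁ * G + mon B * z)
    split = begin
      W₁.walk r (λ s → f₁ s * C₁.P s) o
        ≈⟨ W₁.walk-cong r (λ s → solve 3 (λ f x y → f :* x := y :* f :+ f :* (x :- y)) refl (f₁ s) (C₁.P s) P∞₁) o ⟩
      W₁.walk r (λ s → P∞₁ * f₁ s + f₁ s * (C₁.P s - P∞₁)) o
        ≈⟨ W₁.walk-+ r _ _ o ⟩
      W₁.walk r (λ s → P∞₁ * f₁ s) o + W₁.walk r (λ s → f₁ s * (C₁.P s - P∞₁)) o
        ≈⟨ +-cong (trans (sym (W₁.*-walk P∞₁ r f₁ o)) (*-congˡ hG)) (trans hz (*-congʳ (mon-+ _ _))) ⟩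
      P∞₁ * (mon (shift r) * G) + (mon (shift r) * mon B) * z
        ≈⟨ solve 5 (λ p s g b z → p :* (s :* g) :+ (s :* b) :* z := s :* (p :* g :+ b :* z)) refl _ _ _ _ _ ⟩
      mon (shift r) * (P∞₁ * G + mon B * z) ∎
    cancelled : p₂ * (V₁ * (P∞₁ * G + mon B * z)) ≈ p₁ * (V₂ * w₂)
    cancelled = mon-cancel (shift r) (begin
      mon (shift r) * (p₂ * (V₁ * (P∞₁ * G + mon B * z)))
        ≈⟨ solve 4 (λ s p v x → s :* (p :* (v :* x)) := p :* (v :* (s :* x))) refl _ _ _ _ ⟩
      p₂ * (V₁ * (mon (shift r) * (P∞₁ * G + mon B * z)))
        ≈⟨ *-congˡ (*-congˡ (sym split)) ⟩
      p₂ * (V₁ * W₁.walk r (λ s → f₁ s * C₁.P s) o)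
        ≈⟨ walk-duality r ⟩
      p₁ * (V₂ * (mon (shift r) * w₂))
        ≈⟨ solve 4 (λ s p v x → p :* (v :* (s :* x)) := s :* (p :* (v :* x))) refl _ _ _ _ ⟩
      mon (shift r) * (p₁ * (V₂ * w₂)) ∎)

-- Infinite products and theta functions

module ThetaProducts (Q∞ : QRing∞) where
  open QRing∞ Q∞
  open QRing base
  open CommutativeRing cring hiding (zero)
  open Kit cring
  open QKit base
  open Order base
  open Vandermonde cring
  open Walk base using (poch; X)
  open SetoidReasoning setoid

  approx-≤ : ∀ {B} T a y → 1 ≤ T → B ≤ y → poch T a y ≈ pinf a T [mod B ]
  approx-≤ T a y 1≤T B≤y = Ord-≤ (ℕₚ.≤-trans B≤y (ℕₚ.m≤n*m y T {{ℕ.>-nonZero 1≤T}})) (pinf-approx T a y)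

  poch-suc : ∀ T a y → poch T a (suc y) ≈ (1# - mon a) * poch T (a ℕ.+ T) y
  poch-suc T a zero    = trans (*-comm _ _) (*-congʳ (+-congˡ (-‿cong (mon-≡ (≡.trans (≡.cong (a ℕ.+_) (ℕₚ.*-zeroʳ T)) (ℕₚ.+-identityʳ a))))))
  poch-suc T a (suc y) = trans (*-cong (poch-suc T a y) (+-congˡ (-‿cong (mon-≡
    (≡.trans (≡.cong (a ℕ.+_) (ℕₚ.*-suc T y)) (≡.sym (ℕₚ.+-assoc a T _))))))) (*-assoc _ _ _)

  pinf-suc : ∀ T a → 1 ≤ T → pinf a T ≈ (1# - mon a) * pinf (a ℕ.+ T) T
  pinf-suc T a 1≤T = separated (λ B → mod-trans (mod-sym (approx-≤ T a (suc B) 1≤T (ℕₚ.n≤1+n B)))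
    (mod-trans (≈⇒mod (poch-suc T a B)) (mod-* (≈⇒mod refl) (approx-≤ T (a ℕ.+ T) B 1≤T ℕₚ.≤-refl))))

  θ : ℕ → ℕ → Carrier
  θ T d = pinf d T * pinf (T ∸ d) T

  Θ : ℕ → List ℕ → Carrier
  Θ T []       = 1#
  Θ T (c ∷ cs) = prod (λ b → θ T (c ∸ b)) cs * Θ T cs

  -- The factors -q^b split off when the differences q^c - q^b are absorbed into theta functions.
  lead : List ℕ → Carrier
  lead []       = 1#
  lead (c ∷ cs) = prod (λ b → - mon b) cs * lead cs

  module _ (T : ℕ) where
    PP : List ℕ → List ℕ → Carrier
    PP ds cs = prod (λ c → prod (λ b → pinf ((T ℕ.+ c) ∸ b) T) ds) cs

    -- With d = c - b the difference is -q^b (1 - q^d), and 1 - q^d is the missing first factor of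
    -- the symbol starting at q^(T+d).
    pair : ∀ {b c} → b < c → c < T →
      (mon c - mon b) * (pinf ((T ℕ.+ c) ∸ b) T * pinf ((T ℕ.+ b) ∸ c) T) ≈ - mon b * θ T (c ∸ b)
    pair {b} {c} b<c c<T = begin
      (mon c - mon b) * (pinf ((T ℕ.+ c) ∸ b) T * pinf ((T ℕ.+ b) ∸ c) T)
        ≈⟨ *-cong (+-congʳ (mon-∸ b≤c)) (*-cong (reflexive (≡.cong (λ a → pinf a T) e₁)) (reflexive (≡.cong (λ a → pinf a T) e₂))) ⟩
      (mon b * mon d - mon b) * (pinf (d ℕ.+ T) T * pinf (T ∸ d) T)
        ≈⟨ solve 4 (λ b d p r → (b :* d :- b) :* (p :* r) := (:- b) :* (((:1 :- d) :* p) :* r)) refl _ _ _ _ ⟩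
      - mon b * (((1# - mon d) * pinf (d ℕ.+ T) T) * pinf (T ∸ d) T)
        ≈⟨ *-congˡ (*-congʳ (sym (pinf-suc T d (ℕₚ.≤-<-trans z≤n c<T)))) ⟩
      - mon b * θ T d ∎
      where
      d = c ∸ b
      b≤c = ℕₚ.<⇒≤ b<c
      e₁ : (T ℕ.+ c) ∸ b ≡ d ℕ.+ T
      e₁ = ≡.trans (ℕₚ.+-∸-assoc T b≤c) (ℕₚ.+-comm T d)
      e₂ : (T ℕ.+ b) ∸ c ≡ T ∸ d
      e₂ = ≡.trans (≡.cong₂ _∸_ (ℕₚ.+-comm T b) (≡.sym (ℕₚ.m+[n∸m]≡n b≤c))) (ℕₚ.[m+n]∸[m+o]≡n∸o b T d)

    vand-PP : ∀ cs → All (_< T) cs → AllPairs (λ a b → b < a) cs →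
      vand (X T) (map (λ c → c , 0) cs) * PP cs cs ≈ lead cs * (pinf T T ^ length cs * Θ T cs)
    vand-PP []       _           _           = solve 0 (:1 :* :1 := :1 :* (:1 :* :1)) refl
    vand-PP (c ∷ cs) (c<T ∷ h) (c> ∷ hs) = begin
      (prod (λ b → X T (c , 0) - X T b) (map (λ c → c , 0) cs) * vand (X T) (map (λ c → c , 0) cs))
        * ((pinf ((T ℕ.+ c) ∸ c) T * r₁) * PP (c ∷ cs) cs)
        ≈⟨ *-cong (*-congʳ (trans (reflexive (prod-map (λ b → X T (c , 0) - X T b) (λ c → c , 0) cs))
             (prod-cong (λ b → +-cong (X-0 c) (-‿cong (X-0 b))) cs)))
             (*-cong (*-congʳ (reflexive (≡.cong (λ a → pinf a T) (ℕₚ.m+n∸n≡m T c)))) (prod-* _ _ cs)) ⟩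
      (prod (λ b → mon c - mon b) cs * v) * ((t * r₁) * (r₂ * PP cs cs))
        ≈⟨ solve 6 (λ d v t a b p → (d :* v) :* ((t :* a) :* (b :* p)) := (d :* (a :* b)) :* (t :* (v :* p))) refl _ _ _ _ _ _ ⟩
      (prod (λ b → mon c - mon b) cs * (r₁ * r₂)) * (t * (v * PP cs cs))
        ≈⟨ *-cong (trans (*-congˡ (sym (prod-* _ _ cs))) (trans (sym (prod-* _ _ cs))
             (trans (prod-congᴬ (All.map (λ b<c → pair b<c c<T) c>)) (prod-* _ _ cs)))) (*-congˡ (vand-PP cs h hs)) ⟩
      (prod (λ b → - mon b) cs * prod (λ b → θ T (c ∸ b)) cs) * (t * (lead cs * (t ^ length cs * Θ T cs)))
        ≈⟨ solve 6 (λ a b t l p z → (a :* b) :* (t :* (l :* (p :* z))) := (a :* l) :* ((t :* p) :* (b :* z))) refl _ _ _ _ _ _ ⟩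
      lead (c ∷ cs) * (t ^ suc (length cs) * Θ T (c ∷ cs)) ∎
      where
      t = pinf T T
      v = vand (X T) (map (λ c → c , 0) cs)
      r₁ = prod (λ b → pinf ((T ℕ.+ c) ∸ b) T) cs
      r₂ = prod (λ b → pinf ((T ℕ.+ b) ∸ c) T) cs
      X-0 : ∀ c → X T (c , 0) ≈ mon c
      X-0 c = mon-≡ (≡.trans (≡.cong (c ℕ.+_) (ℕₚ.*-zeroʳ T)) (ℕₚ.+-identityʳ c))

  prod-downFrom-suc : ∀ (f : ℕ → Carrier) l → prod f (downFrom (suc l)) ≈ prod (f ∘ suc) (downFrom l) * f 0
  prod-downFrom-suc f zero    = *-comm _ _
  prod-downFrom-suc f (suc l) = trans (*-congˡ (prod-downFrom-suc f l)) (sym (*-assoc _ _ _))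

  prod-reverse : ∀ (f : ℕ → Carrier) l → prod (λ b → f (l ∸ suc b)) (downFrom l) ≈ prod f (downFrom l)
  prod-reverse f zero    = refl
  prod-reverse f (suc l) = begin
    f (l ∸ l) * prod (λ b → f (l ∸ b)) (downFrom l)
      ≈⟨ *-cong (reflexive (≡.cong f (ℕₚ.n∸n≡0 l)))
           (prod-congᴬ (All.map (λ {b} b<l → reflexive (≡.cong f (≡.trans (≡.cong (_∸ b) (≡.sym (ℕₚ.m+[n∸m]≡n {1} (ℕₚ.≤-<-trans z≤n b<l))))
             (≡.trans (ℕₚ.+-∸-assoc 1 {l ∸ 1} {b} (ℕₚ.∸-monoˡ-≤ 1 b<l)) (≡.cong suc (ℕₚ.∸-+-assoc l 1 b)))))) (downFrom-< l))) ⟩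
    f 0 * prod (λ b → f (suc (l ∸ suc b))) (downFrom l)
      ≈⟨ *-congˡ (prod-reverse (f ∘ suc) l) ⟩
    f 0 * prod (f ∘ suc) (downFrom l)
      ≈⟨ trans (*-comm _ _) (sym (prod-downFrom-suc f l)) ⟩
    prod f (downFrom (suc l)) ∎

  module _ (n : ℕ) (1≤n : 1 ≤ n) where
    p : ℕ → Carrier
    p d = pinf d n

    low high : ℕ → Carrier
    low  j = prod (λ e → p (suc e)) (downFrom j)
    high j = prod (λ e → p (n ∸ e)) (downFrom j)

    low-high : ∀ j → j ≤ n → low (n ∸ j) * high j ≈ low n
    low-high zero    _   = *-identityʳ _
    low-high (suc j) j<n = begin
      low (n ∸ suc j) * (p (n ∸ j) * high j)
        ≈⟨ solve 3 (λ a b c → a :* (b :* c) := (b :* a) :* c) refl _ _ _ ⟩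
      (p (n ∸ j) * low (n ∸ suc j)) * high j
        ≡⟨ ≡.cong (λ d → (p d * low (n ∸ suc j)) * high j) e ⟩
      low (suc (n ∸ suc j)) * high j
        ≡⟨ ≡.cong (λ d → low d * high j) (≡.sym e) ⟩
      low (n ∸ j) * high j
        ≈⟨ low-high j (ℕₚ.<⇒≤ j<n) ⟩
      low n ∎
      where
      e : n ∸ j ≡ suc (n ∸ suc j)
      e = ℕₚ.+-∸-assoc 1 j<n

    -- The differences i - b run through 1, ..., i. The first symbols of the theta functions give
    -- `low i`; the second ones, completed by `p n`, give `high (suc i)`.
    Θ-row : ∀ i → prod (λ b → θ n (i ∸ b)) (downFrom i) * p n ≈ low i * high (suc i)
    Θ-row i = begin
      prod (λ b → θ n (i ∸ b)) (downFrom i) * p n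
        ≈⟨ *-congʳ (prod-congᴬ (All.map (λ {b} b<i → reflexive (≡.cong (θ n) (ℕₚ.+-∸-assoc 1 b<i))) (downFrom-< i))) ⟩
      prod (λ b → θ n (suc (i ∸ suc b))) (downFrom i) * p n
        ≈⟨ *-congʳ (prod-reverse (λ e → θ n (suc e)) i) ⟩
      prod (λ e → θ n (suc e)) (downFrom i) * p n
        ≈⟨ *-congʳ (prod-* _ _ (downFrom i)) ⟩
      (low i * prod (λ e → p (n ∸ suc e)) (downFrom i)) * p n
        ≈⟨ *-assoc _ _ _ ⟩
      low i * (prod (λ e → p (n ∸ suc e)) (downFrom i) * p n)
        ≈⟨ *-congˡ (sym (prod-downFrom-suc (λ e → p (n ∸ e)) i)) ⟩
      low i * high (suc i) ∎

    Θ-rows : ∀ l → p n ^ l * Θ n (downFrom l) ≈ prod low (downFrom l) * prod (λ i → high (suc i)) (downFrom l)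
    Θ-rows zero    = refl
    Θ-rows (suc l) = begin
      (p n * p n ^ l) * (prod (λ b → θ n (l ∸ b)) (downFrom l) * Θ n (downFrom l))
        ≈⟨ solve 4 (λ a b c d → (a :* b) :* (c :* d) := (c :* a) :* (b :* d)) refl _ _ _ _ ⟩
      (prod (λ b → θ n (l ∸ b)) (downFrom l) * p n) * (p n ^ l * Θ n (downFrom l))
        ≈⟨ *-cong (Θ-row l) (Θ-rows l) ⟩
      (low l * high (suc l)) * (prod low (downFrom l) * prod (λ i → high (suc i)) (downFrom l))
        ≈⟨ solve 4 (λ a b c d → (a :* b) :* (c :* d) := (a :* c) :* (b :* d)) refl _ _ _ _ ⟩
      prod low (downFrom (suc l)) * prod (λ i → high (suc i)) (downFrom (suc l)) ∎

    -- Reversing the order of the `low` factors pairs each of them with the `high` factor that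
    -- completes it to all classes mod n.
    Θ-full : p n ^ n * Θ n (downFrom n) ≈ low n ^ n
    Θ-full = begin
      p n ^ n * Θ n (downFrom n)
        ≈⟨ Θ-rows n ⟩
      prod low (downFrom n) * prod (λ i → high (suc i)) (downFrom n)
        ≈⟨ *-congʳ (sym (prod-reverse low n)) ⟩
      prod (λ i → low (n ∸ suc i)) (downFrom n) * prod (λ i → high (suc i)) (downFrom n)
        ≈⟨ sym (prod-* _ _ (downFrom n)) ⟩
      prod (λ i → low (n ∸ suc i) * high (suc i)) (downFrom n)
        ≈⟨ prod-congᴬ (All.map (λ {i} i<n → low-high (suc i) i<n) (downFrom-< n)) ⟩
      prod (λ _ → low n) (downFrom n)
        ≈⟨ prod-const _ (downFrom n) ⟩
      low n ^ length (downFrom n)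
        ≡⟨ ≡.cong (low n ^_) (Lₚ.length-downFrom n) ⟩
      low n ^ n ∎

    poch-++ : ∀ M j → poch 1 1 (j ℕ.+ M) ≈ poch 1 1 M * prod (λ i → 1# - mon (suc i ℕ.+ M)) (downFrom j)
    poch-++ M zero    = sym (*-identityʳ _)
    poch-++ M (suc j) = trans (*-cong (poch-++ M j) (+-congˡ (-‿cong (mon-≡ (≡.cong suc (ℕₚ.*-identityˡ (j ℕ.+ M)))))))
      (trans (*-assoc _ _ _) (*-congˡ (*-comm _ _)))

    poch-residues : ∀ L → poch 1 1 (n ℕ.* L) ≈ prod (λ i → poch n (suc i) L) (downFrom n)
    poch-residues zero    = trans (reflexive (≡.cong (poch 1 1) (ℕₚ.*-zeroʳ n)))
      (sym (prod-1 (downFrom n) (All.universal (λ _ → refl) _)))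
    poch-residues (suc L) = begin
      poch 1 1 (n ℕ.* suc L)          ≡⟨ ≡.cong (poch 1 1) (ℕₚ.*-suc n L) ⟩
      poch 1 1 (n ℕ.+ n ℕ.* L)        ≈⟨ poch-++ (n ℕ.* L) n ⟩
      poch 1 1 (n ℕ.* L) * prod (λ i → 1# - mon (suc i ℕ.+ n ℕ.* L)) (downFrom n)
                                      ≈⟨ *-congʳ (poch-residues L) ⟩
      prod (λ i → poch n (suc i) L) (downFrom n) * prod (λ i → 1# - mon (suc i ℕ.+ n ℕ.* L)) (downFrom n)
                                      ≈⟨ sym (prod-* _ _ (downFrom n)) ⟩
      prod (λ i → poch n (suc i) (suc L)) (downFrom n) ∎

    -- The factors 1 - q^j are sorted by the class of j mod n.
    pinf-residues : pinf 1 1 ≈ low n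
    pinf-residues = separated (λ B → mod-trans (mod-sym (approx-≤ 1 1 (n ℕ.* B) ℕₚ.≤-refl (ℕₚ.m≤n*m B n {{ℕ.>-nonZero 1≤n}})))
      (mod-trans (≈⇒mod (poch-residues B)) (mod-prod (downFrom n) (All.universal (λ i → approx-≤ n (suc i) B 1≤n ℕₚ.≤-refl) _))))

  -- An inverse of (q;q)_∞ thereby also inverts (q^n;q^n)_∞.
  pinf-divides : ∀ n → 1 ≤ n → ∃[ c ] pinf 1 1 ≈ pinf n n * c
  pinf-divides (suc l) 1≤n = _ , pinf-residues (suc l) 1≤n

  lead-mon : ∀ cs → ∃[ a ] ∃[ j ] lead cs ≈ mon a * sgn j
  lead-mon []       = 0 , 0 , trans (sym mon-0) (sym (*-identityʳ _))
  lead-mon (c ∷ cs) with row cs | lead-mon cs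
    where
    row : ∀ cs → ∃[ a ] prod (λ b → - mon b) cs ≈ mon a * sgn (length cs)
    row []       = 0 , trans (sym mon-0) (sym (*-identityʳ _))
    row (b ∷ cs) with row cs
    ... | a , h = b ℕ.+ a , trans (*-congˡ h) (trans (solve 3 (λ b a s → (:- b) :* (a :* s) := (b :* a) :* (:- :1 :* s)) refl _ _ _)
                              (*-congʳ (sym (mon-+ b a))))
  ... | a , h | a′ , j , h′ = a ℕ.+ a′ , length cs ℕ.+ j , trans (*-cong h h′)
    (trans (solve 4 (λ a b c d → (a :* b) :* (c :* d) := (a :* c) :* (b :* d)) refl _ _ _ _)
      (*-cong (sym (mon-+ a a′)) (sym (^-+ (length cs) j))))
    where
    ^-+ : ∀ i j → sgn (i ℕ.+ j) ≈ sgn i * sgn j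
    ^-+ zero    j = sym (*-identityˡ _)
    ^-+ (suc i) j = trans (*-congˡ (^-+ i j)) (sym (*-assoc _ _ _))

-- The limit in closed form

module LimitTheorem (Q∞ : QRing∞) (m l k : ℕ) (1≤m : 1 ≤ m) (k≤m : k ≤ m) where
  open QRing∞ Q∞
  open QRing base
  open CommutativeRing cring hiding (zero)
  open Kit cring
  open QKit base
  open Order base
  open Vandermonde cring
  open ThetaProducts Q∞
  open Limit Q∞ m l k 1≤m k≤m
  open Duality base
  open Dual m l k k≤m
  open SetoidReasoning setoid

  1≤n : 1 ≤ n
  1≤n = s≤s z≤n

  -- `lead` does not depend on the first entry of its list, the only one in which `downFrom n` and
  -- `μ` differ; hence both sides of the duality have the same `lead`.
  left : V₁ * P∞₁ ≈ lead μ * pinf 1 1 ^ n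
  left = begin
    V₁ * P∞₁
      ≈⟨ vand-PP n (downFrom n) (downFrom-< n) (downFrom-> n) ⟩
    lead (downFrom n) * (pinf n n ^ length (downFrom n) * Θ n (downFrom n))
      ≡⟨ ≡.cong (λ j → lead (downFrom n) * (pinf n n ^ j * Θ n (downFrom n))) (Lₚ.length-downFrom n) ⟩
    lead (downFrom n) * (pinf n n ^ n * Θ n (downFrom n))
      ≈⟨ *-congˡ (trans (Θ-full n 1≤n) (^-cong n (sym (pinf-residues n 1≤n)))) ⟩
    lead μ * pinf 1 1 ^ n ∎

  right : V₂ * P∞₂ ≈ lead μ * (pinf κ κ ^ n * Θ κ μ)
  right = begin
    V₂ * P∞₂
      ≈⟨ vand-PP κ μ μ<κ (All.map (λ h → ℕₚ.<-≤-trans h (ℕₚ.m≤n+m l k)) (downFrom-< l) ∷ downFrom-> l) ⟩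
    lead μ * (pinf κ κ ^ length μ * Θ κ μ)
      ≡⟨ ≡.cong (λ j → lead μ * (pinf κ κ ^ suc j * Θ κ μ)) (Lₚ.length-downFrom l) ⟩
    lead μ * (pinf κ κ ^ n * Θ κ μ) ∎

  module _ (i∞ : Carrier) (i∞-inv : pinf 1 1 * i∞ ≈ 1#) where
    rhs : Carrier
    rhs = ((pinf n n * pinf κ κ ^ l) * i∞ ^ n) * Θ κ μ

    limit-theorem : ∀ B → ∃[ R ] (∀ r → R ≤ r → ∃[ G ]
      ((W₁.walk r f₁ C₁.origin ≈ mon (shift r) * G) × (G ≈ rhs [mod B ])))
    limit-theorem B with lead-mon μ | pinf-divides κ κ≥1
    -- The common factor `lead μ` is q^a up to sign, and cancelling it costs `a` orders; hence the
    -- precision a + B.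
    ... | a , j , lead≈ | c , divides = bound (a ℕ.+ B) , λ r R≤r → let G , hG , h = walk-limit (a ℕ.+ B) r R≤r in G , hG , solved G h
      where
      s = sgn j
      solved : ∀ G → (pinf κ κ * (V₁ * P∞₁)) * G ≈ pinf n n * (V₂ * P∞₂) [mod a ℕ.+ B ] → G ≈ rhs [mod B ]
      solved G h = mod-trans (≈⇒mod (sym (unit G))) (mod-trans (mod-* (≈⇒mod {x = (i∞ ^ n * (i∞ * c)) * s} refl) core) (≈⇒mod value))
        where
        core : s * ((pinf κ κ * pinf 1 1 ^ n) * G) ≈ s * (pinf n n * (pinf κ κ ^ n * Θ κ μ)) [mod B ]
        core = mod-cancel {a} (mod-trans (≈⇒mod (begin
          mon a * (s * ((pinf κ κ * pinf 1 1 ^ n) * G))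
            ≈⟨ solve 5 (λ a s p x g → a :* (s :* ((p :* x) :* g)) := (p :* ((a :* s) :* x)) :* g) refl _ _ _ _ _ ⟩
          (pinf κ κ * ((mon a * s) * pinf 1 1 ^ n)) * G
            ≈⟨ *-congʳ (*-congˡ (trans (*-congʳ (sym lead≈)) (sym left))) ⟩
          (pinf κ κ * (V₁ * P∞₁)) * G ∎)) (mod-trans h (≈⇒mod (begin
          pinf n n * (V₂ * P∞₂)
            ≈⟨ *-congˡ (trans right (*-congʳ lead≈)) ⟩
          pinf n n * ((mon a * s) * (pinf κ κ ^ n * Θ κ μ))
            ≈⟨ solve 4 (λ p a s x → p :* ((a :* s) :* x) := a :* (s :* (p :* x))) refl _ _ _ _ ⟩
          mon a * (s * (pinf n n * (pinf κ κ ^ n * Θ κ μ))) ∎))))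
        κ-unit : (i∞ * c) * pinf κ κ ≈ 1#
        κ-unit = trans (solve 3 (λ i c p → (i :* c) :* p := (p :* c) :* i) refl _ _ _) (trans (*-congʳ (sym divides)) i∞-inv)
        n-unit : i∞ ^ n * pinf 1 1 ^ n ≈ 1#
        n-unit = trans (sym (*-^ i∞ (pinf 1 1) n)) (trans (^-cong n (trans (*-comm _ _) i∞-inv)) (1^ n))
        unit : ∀ G → ((i∞ ^ n * (i∞ * c)) * s) * (s * ((pinf κ κ * pinf 1 1 ^ n) * G)) ≈ G
        unit G = begin
          ((i∞ ^ n * (i∞ * c)) * s) * (s * ((pinf κ κ * pinf 1 1 ^ n) * G))
            ≈⟨ solve 6 (λ i d s p x g → ((i :* d) :* s) :* (s :* ((p :* x) :* g)) := ((s :* s) :* ((i :* x) :* (d :* p))) :* g) refl _ _ _ _ _ _ ⟩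
          ((s * s) * ((i∞ ^ n * pinf 1 1 ^ n) * ((i∞ * c) * pinf κ κ))) * G
            ≈⟨ *-congʳ (*-cong (sgn² j) (*-cong n-unit κ-unit)) ⟩
          (1# * (1# * 1#)) * G
            ≈⟨ solve 1 (λ g → (:1 :* (:1 :* :1)) :* g := g) refl _ ⟩
          G ∎
        value : ((i∞ ^ n * (i∞ * c)) * s) * (s * (pinf n n * (pinf κ κ ^ n * Θ κ μ))) ≈ rhs
        value = begin
          ((i∞ ^ n * (i∞ * c)) * s) * (s * (pinf n n * ((pinf κ κ * pinf κ κ ^ l) * Θ κ μ)))
            ≈⟨ solve 7 (λ i d s p x y t → ((i :* d) :* s) :* (s :* (p :* ((x :* y) :* t))) := ((s :* s) :* (d :* x)) :* (((p :* y) :* i) :* t)) refl _ _ _ _ _ _ _ ⟩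
          ((s * s) * ((i∞ * c) * pinf κ κ)) * rhs
            ≈⟨ trans (*-congʳ (trans (*-cong (sgn² j) κ-unit) (*-identityˡ _))) (*-identityˡ _) ⟩
          rhs ∎

-- Formal power series with integer coefficients

module ℤ⟦q⟧ where
  ℤR : CommutativeRing 0ℓ 0ℓ
  ℤR = ℤₚ.+-*-commutativeRing

  seriesRing : CommutativeRing 0ℓ 0ℓ
  seriesRing = PowerSeries.powerSeries ℤR

  open CommutativeRing seriesRing hiding (zero) public
  open Kit ℤR using (anti)

  q^ : ℕ → Series
  q^ a d = if d ℕ.≡ᵇ a then + 1 else + 0

  q^-0 : q^ 0 ≈ 1#
  q^-0 zero    = ≡.refl
  q^-0 (suc d) = ≡.refl

  q^-* : ∀ a f d → (q^ a * f) (a ℕ.+ d) ≡ f d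
  q^-* zero    f d = ≡.trans (*-congʳ {f} q^-0 d) (*-identityˡ f d)
  q^-* (suc a) f d = ≡.trans (ℤₚ.+-identityˡ _) (q^-* a f d)

  q^-*-< : ∀ a f {d} → d < a → (q^ a * f) d ≡ + 0
  q^-*-< (suc a) f {zero}  d<a       = ≡.refl
  q^-*-< (suc a) f {suc d} (s≤s d<a) = ≡.trans (ℤₚ.+-identityˡ _) (q^-*-< a f d<a)

  q^-+-coeff : ∀ a b e → q^ (a ℕ.+ b) (a ℕ.+ e) ≡ q^ b e
  q^-+-coeff zero    b e = ≡.refl
  q^-+-coeff (suc a) b e = q^-+-coeff a b e

  q^-< : ∀ a {d} → d < a → q^ a d ≡ + 0
  q^-< (suc a) {zero}  _         = ≡.refl
  q^-< (suc a) {suc d} (s≤s d<a) = q^-< a d<a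

  split-≤ : ∀ a d → d < a ⊎ (∃[ e ] d ≡ a ℕ.+ e)
  split-≤ a d with d ℕ.<? a
  ... | yes d<a = inj₁ d<a
  ... | no  d≮a = inj₂ (d ∸ a , ≡.sym (ℕₚ.m+[n∸m]≡n (ℕₚ.≮⇒≥ d≮a)))

  q^-+ : ∀ a b → q^ (a ℕ.+ b) ≈ q^ a * q^ b
  q^-+ a b d with split-≤ a d
  ... | inj₁ d<a          = ≡.trans (q^-< (a ℕ.+ b) (ℕₚ.<-≤-trans d<a (ℕₚ.m≤m+n a b))) (≡.sym (q^-*-< a (q^ b) d<a))
  ... | inj₂ (e , ≡.refl) = ≡.trans (q^-+-coeff a b e) (≡.sym (q^-* a (q^ b) e))

  q^-cancel : ∀ a {f g} → q^ a * f ≈ q^ a * g → f ≈ g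
  q^-cancel a {f} {g} e d = ≡.trans (≡.sym (q^-* a f d)) (≡.trans (e (a ℕ.+ d)) (q^-* a g d))

  geomS-yes : ∀ a d → a ∣.∣ d → geomS a d ≡ + 1
  geomS-yes a d a∣d with a ∣.∣? d
  ... | yes _ = ≡.refl
  ... | no ¬d = ⊥-elim (¬d a∣d)

  geomS-no : ∀ a d → ¬ (a ∣.∣ d) → geomS a d ≡ + 0
  geomS-no a d ¬d with a ∣.∣? d
  ... | yes a∣d = ⊥-elim (¬d a∣d)
  ... | no _    = ≡.refl

  geomS-< : ∀ a {d} → d < a → geomS a d ≡ 1# d
  geomS-< a {zero}  _   = geomS-yes a 0 (a ∣.∣0)
  geomS-< a {suc d} d<a = geomS-no a (suc d) (λ a∣d → ℕₚ.<⇒≱ d<a (∣.∣⇒≤ a∣d))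

  geomS-+ : ∀ a e → geomS a (a ℕ.+ e) ≡ geomS a e
  geomS-+ a e with a ∣.∣? e
  ... | yes a∣e = geomS-yes a _ (∣.∣m∣n⇒∣m+n ∣.∣-refl a∣e)
  ... | no ¬a∣e = geomS-no a _ (λ h → ¬a∣e (∣.∣m+n∣m⇒∣n h ∣.∣-refl))

  geomS-inv : ∀ {a} → 1 ≤ a → (1# - q^ a) * geomS a ≈ 1#
  geomS-inv {a} 1≤a = trans (solve 2 (λ x g → (:1 :- x) :* g := g :- x :* g) refl (q^ a) (geomS a)) coeff
    where
    open Kit seriesRing using (solve; _:=_; _:*_; _:-_; :1)
    coeff : geomS a - q^ a * geomS a ≈ 1#
    coeff d with split-≤ a d
    ... | inj₁ d<a          = ≡.trans (≡.cong (λ x → geomS a d ℤ.- x) (q^-*-< a (geomS a) d<a))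
                                (≡.trans (ℤₚ.+-identityʳ _) (geomS-< a d<a))
    ... | inj₂ (e , ≡.refl) = ≡.trans (≡.cong₂ (λ x y → x ℤ.- y) (geomS-+ a e) (q^-* a (geomS a) e))
                                (≡.trans (ℤₚ.+-inverseʳ (geomS a e)) (one-+ 1≤a e))
      where
      one-+ : ∀ {a} → 1 ≤ a → ∀ e → + 0 ≡ 1# (a ℕ.+ e)
      one-+ (s≤s _) e = ≡.refl

  seriesQ : QRing
  seriesQ = record
    { cring = seriesRing ; mon = q^ ; mon-0 = q^-0 ; mon-+ = q^-+ ; mon-cancel = q^-cancel
    ; geo = geomS ; geo-inv = geomS-inv }

  open Order seriesQ
  open Kit seriesRing using (prod; _^_; prod-++)

  Ord⇒coeff : ∀ {B x} → Ord B x → ∀ {d} → d < B → x d ≡ + 0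
  Ord⇒coeff {B} (y , e) {d} d<B = ≡.trans (e d) (q^-*-< B y d<B)

  coeff⇒Ord : ∀ {B x} → (∀ {d} → d < B → x d ≡ + 0) → Ord B x
  coeff⇒Ord {B} {x} h = y , λ d → eq d (split-≤ B d)
    where
    y : Series
    y d = x (B ℕ.+ d)
    eq : ∀ d → d < B ⊎ (∃[ e ] d ≡ B ℕ.+ e) → x d ≡ (q^ B * y) d
    eq d (inj₁ d<B)          = ≡.trans (h d<B) (≡.sym (q^-*-< B y d<B))
    eq d (inj₂ (e , ≡.refl)) = ≡.sym (q^-* B y e)

  mod⇒coeff : ∀ {B x y} → x ≈ y [mod B ] → ∀ {d} → d < B → x d ≡ y d
  mod⇒coeff {B} {x} {y} h {d} d<B = ℤₚ.i-j≡0⇒i≡j (x d) (y d) (Ord⇒coeff {x = x - y} h d<B)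

  coeff⇒mod : ∀ {B x y} → (∀ {d} → d < B → x d ≡ y d) → x ≈ y [mod B ]
  coeff⇒mod {B} {x} {y} h = coeff⇒Ord {x = x - y} (λ {d} d<B → ℤₚ.i≡j⇒i-j≡0 (h d<B))

  anti-sum : ∀ (F : ℕ → ℕ → ℤ) r → anti F r ≡ sumℤ (L.applyUpTo (λ i → F i (r ∸ i)) (suc r))
  anti-sum F zero    = ≡.sym (ℤₚ.+-identityʳ _)
  anti-sum F (suc r) = ≡.cong (λ x → F 0 (suc r) ℤ.+ x) (anti-sum (λ i → F (suc i)) r)

  ⊛≈* : ∀ f g → f ⊛ g ≈ f * g
  ⊛≈* f g d = ≡.sym (≡.trans (anti-sum (λ i j → f i ℤ.* g j) d)
    (≡.cong sumℤ (≡.sym (Lₚ.map-applyUpTo id (λ i → f i ℤ.* g (d ∸ i)) (suc d)))))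

  prodS≈ : ∀ {A : Set} (f : A → Series) xs → prodS (map f xs) ≈ prod f xs
  prodS≈ f []       = λ { zero → ≡.refl ; (suc d) → ≡.refl }
  prodS≈ f (x ∷ xs) = trans (⊛≈* (f x) _) (*-congˡ {f x} (prodS≈ f xs))

  powS≈ : ∀ f k → powS f k ≈ f ^ k
  powS≈ f zero    = λ { zero → ≡.refl ; (suc d) → ≡.refl }
  powS≈ f (suc k) = trans (⊛≈* f _) (*-congˡ {f} (powS≈ f k))

  oneMinusQ≈ : ∀ e → oneMinusQ e ≈ 1# - q^ e
  oneMinusQ≈ e zero    = ≡.refl
  oneMinusQ≈ e (suc d) = ≡.refl

  poch : ℕ → ℕ → ℕ → Series
  poch = Walk.poch seriesQ

  finite : ∀ a T y → prodS (map (λ j → oneMinusQ (a ℕ.+ T ℕ.* j)) (upTo y)) ≈ poch T a y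
  finite a T y = trans (prodS≈ _ (upTo y)) (go y)
    where
    f : ℕ → Series
    f j = oneMinusQ (a ℕ.+ T ℕ.* j)
    go : ∀ y → prod f (upTo y) ≈ poch T a y
    go zero    = refl
    go (suc y) = trans (reflexive (≡.cong (prod f) (≡.sym (Lₚ.upTo-∷ʳ y)))) (trans (prod-++ f (upTo y) (y ∷ []))
      (*-cong (go y) (trans (*-identityʳ (f y)) (oneMinusQ≈ _))))

  -- All factors after the first y are 1 modulo q^(T y).
  poch-stable : ∀ T a y j → poch T a (j ℕ.+ y) ≈ poch T a y [mod T ℕ.* y ]
  poch-stable T a y zero    = ≈⇒mod {x = poch T a y} refl
  poch-stable T a y (suc j) = mod-*-1 (poch T a (j ℕ.+ y)) (poch T a y) (1# - q^ (a ℕ.+ T ℕ.* (j ℕ.+ y))) (poch-stable T a y j)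
    (1-small (a ℕ.+ T ℕ.* (j ℕ.+ y)) (ℕₚ.≤-trans (ℕₚ.*-monoʳ-≤ T (ℕₚ.m≤n+m y j)) (ℕₚ.m≤n+m _ a)))
    where
    1-small : ∀ e → T ℕ.* y ≤ e → 1# - q^ e ≈ 1# [mod T ℕ.* y ]
    1-small e h = coeff⇒mod {x = 1# - q^ e} {y = 1#} (λ {d} d< → ≡.trans (≡.cong (λ x → 1# d ℤ.- x) (q^-< e (ℕₚ.<-≤-trans d< h))) (ℤₚ.+-identityʳ _))

  -- The coefficient of q^d in `pochInf` uses d + 1 factors, the left side uses y; stability is
  -- applied from the shorter of the two.
  pochInf-approx : ∀ T a y → poch T a y ≈ pochInf a T [mod T ℕ.* y ]
  pochInf-approx T a y = coeff⇒mod {x = poch T a y} {y = pochInf a T} (λ {d} d< → ≡.trans (coeff d d< (ℕₚ.≤-total y (suc d))) (≡.sym (finite a T (suc d) d)))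
    where
    coeff : ∀ d → d < T ℕ.* y → y ≤ suc d ⊎ suc d ≤ y → poch T a y d ≡ poch T a (suc d) d
    coeff d d< (inj₁ y≤d) = ≡.sym (≡.trans (≡.cong (λ z → poch T a z d) (≡.sym (ℕₚ.m∸n+n≡m y≤d)))
      (mod⇒coeff {x = poch T a ((suc d ∸ y) ℕ.+ y)} {y = poch T a y} (poch-stable T a y (suc d ∸ y)) d<))
    coeff d d< (inj₂ d<y) = ≡.trans (≡.cong (λ z → poch T a z d) (≡.sym (ℕₚ.m∸n+n≡m d<y)))
      (mod⇒coeff {x = poch T a ((y ∸ suc d) ℕ.+ suc d)} {y = poch T a (suc d)} (poch-stable T a (suc d) (y ∸ suc d)) (T≥1 T d<))
      where
      T≥1 : ∀ T → d < T ℕ.* y → d < T ℕ.* suc d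
      T≥1 (suc T) _ = ℕₚ.m≤m+n (suc d) _

  seriesQ∞ : QRing∞
  seriesQ∞ = record
    { base = seriesQ ; pinf = pochInf ; pinf-approx = pochInf-approx
    ; separated = λ {x} {y} h d → mod⇒coeff {x = x} {y = y} (h (suc d)) ℕₚ.≤-refl }

  geoms : ℕ → Series
  geoms zero    = 1#
  geoms (suc L) = geoms L * geomS (suc L)

  geoms-finite : ∀ y → prodS (map (λ j → geomS (suc j)) (upTo y)) ≈ geoms y
  geoms-finite y = trans (prodS≈ _ (upTo y)) (go y)
    where
    f : ℕ → Series
    f j = geomS (suc j)
    go : ∀ y → prod f (upTo y) ≈ geoms y
    go zero    = refl
    go (suc y) = trans (reflexive (≡.cong (prod f) (≡.sym (Lₚ.upTo-∷ʳ y)))) (trans (prod-++ f (upTo y) (y ∷ []))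
      (*-cong (go y) (*-identityʳ (f y))))

  geoms-stable : ∀ y j → geoms (j ℕ.+ y) ≈ geoms y [mod suc y ]
  geoms-stable y zero    = ≈⇒mod {x = geoms y} refl
  geoms-stable y (suc j) = mod-*-1 (geoms (j ℕ.+ y)) (geoms y) (geomS (suc (j ℕ.+ y))) (geoms-stable y j)
    (coeff⇒mod {x = geomS (suc (j ℕ.+ y))} {y = 1#} (λ d< → geomS-< _ (ℕₚ.<-≤-trans d< (s≤s (ℕₚ.m≤n+m y j)))))

  geoms-poch : ∀ L → poch 1 1 L * geoms L ≈ 1#
  geoms-poch zero    = *-identityˡ 1#
  geoms-poch (suc L) = trans (solve 4 (λ a b c d → (a :* b) :* (c :* d) := (a :* c) :* (b :* d)) refl
      (poch 1 1 L) (1# - q^ (1 ℕ.+ 1 ℕ.* L)) (geoms L) (geomS (suc L)))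
    (trans (*-cong (geoms-poch L) (trans (*-congʳ {geomS (suc L)} (reflexive (≡.cong (λ e → 1# - q^ (suc e)) (ℕₚ.*-identityˡ L)))) (geomS-inv (s≤s z≤n))))
      (*-identityˡ 1#))
    where
    open Kit seriesRing using (solve; _:=_; _:*_)

  invQQ-approx : ∀ L → geoms L ≈ invQQ [mod L ]
  invQQ-approx L = coeff⇒mod {x = geoms L} {y = invQQ} (λ {d} d<L → ≡.trans
    (≡.trans (≡.cong (λ z → geoms z d) (≡.sym (ℕₚ.m∸n+n≡m (ℕₚ.<⇒≤ d<L)))) (mod⇒coeff {x = geoms ((L ∸ d) ℕ.+ d)} {y = geoms d} (geoms-stable d (L ∸ d)) ℕₚ.≤-refl))
    (≡.sym (geoms-finite d d)))

  -- The truncations are exact inverses of each other, so the product is 1 modulo every power of q.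
  invQQ-inv : pochInf 1 1 * invQQ ≈ 1#
  invQQ-inv = QRing∞.separated seriesQ∞ {pochInf 1 1 * invQQ} {1#} (λ B →
    mod-inverse (poch 1 1 B) (geoms B) (pochInf 1 1) invQQ
      (Ord-≤ {x = poch 1 1 B - pochInf 1 1} (ℕₚ.≤-reflexive (≡.sym (ℕₚ.*-identityˡ B))) (pochInf-approx 1 1 B))
      (invQQ-approx B) (geoms-poch B))

-- The right-hand side of the theorem and its coefficients

module RightHandSide where
  open ℤ⟦q⟧
  open Kit seriesRing using (prod; _^_; prod-cong; prod-map; prod-concatMap; prod-↭; prod-congᴬ; prod-*; prod-1)
  open Order seriesQ
  open ThetaProducts seriesQ∞ using (θ; Θ; prod-reverse)

  prod-filter : ∀ {A : Set} (f : A → Series) (P : A → Bool) xs →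
    prod f (filterᵇ P xs) ≈ prod (λ x → if P x then f x else 1#) xs
  prod-filter f P []       = refl
  prod-filter f P (x ∷ xs) with P x
  ... | true  = *-congˡ {f x} (prod-filter f P xs)
  ... | false = trans (prod-filter f P xs) (sym (*-identityˡ _))

  prod-swap : ∀ {A B : Set} (f : A → B → Series) xs ys →
    prod (λ x → prod (f x) ys) xs ≈ prod (λ y → prod (λ x → f x y) xs) ys
  prod-swap f []       ys = sym (prod-1 ys (All.universal (λ _ → refl) ys))
  prod-swap f (x ∷ xs) ys = trans (*-congˡ {prod (f x) ys} (prod-swap f xs ys)) (sym (prod-* (f x) (λ y → prod (λ x → f x y) xs) ys))

  upTo↭downFrom : ∀ l → upTo l ↭ downFrom l
  upTo↭downFrom l = ≡.subst (upTo l ↭_) (Lₚ.reverse-upTo l) (↭.↭-sym (↭ₚ.↭-reverse (upTo l)))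

  prod-range1 : ∀ (f : ℕ → Series) l → prod f (range1 (suc l)) ≈ prod (f ∘ suc) (downFrom l)
  prod-range1 f l = trans (reflexive (prod-map f suc (upTo l))) (prod-↭ (f ∘ suc) (upTo↭downFrom l))

  thetaS≈ : ∀ κ a → thetaS a κ ≈ θ κ a
  thetaS≈ κ a = ⊛≈* (pochInf a κ) (pochInf (κ ∸ a) κ)

  module _ (κ k : ℕ) where
    -- These theta functions belong to the pairs of the head k + n - 1 of `μ` with the residues b
    -- below n - 1: the differences run through i + k.
    row : ∀ l → prod (λ i → thetaS (i ℕ.+ k) κ) (range1 (suc l)) ≈ prod (λ b → θ κ ((k ℕ.+ l) ∸ b)) (downFrom l)
    row l = trans (prod-range1 (λ i → thetaS (i ℕ.+ k) κ) l) (trans (sym (prod-reverse (λ i → thetaS (suc i ℕ.+ k) κ) l))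
      (prod-congᴬ {f = λ b → thetaS (suc (l ∸ suc b) ℕ.+ k) κ} {g = λ b → θ κ ((k ℕ.+ l) ∸ b)}
        (All.map (λ {b} b<l → trans (thetaS≈ κ (suc (l ∸ suc b) ℕ.+ k)) (reflexive (≡.cong (θ κ) (e b<l)))) (downFrom-< l))))
      where
      e : ∀ {b} → b < l → suc (l ∸ suc b) ℕ.+ k ≡ (k ℕ.+ l) ∸ b
      e {b} b<l = ≡.trans (≡.cong (ℕ._+ k) (≡.sym (ℕₚ.+-∸-assoc 1 b<l)))
        (≡.trans (ℕₚ.+-comm (l ∸ b) k) (≡.sym (ℕₚ.+-∸-assoc k (ℕₚ.<⇒≤ b<l))))

    -- Filling the square with 1 outside i < j allows the products over rows and columns to be
    -- interchanged.
    entry : ℕ → ℕ → Series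
    entry i j = if i ℕ.<ᵇ j then θ κ (j ∸ i) else 1#

    <ᵇ-true : ∀ {i j} → i < j → (i ℕ.<ᵇ j) ≡ true
    <ᵇ-true i<j = go (ℕₚ.<⇒<ᵇ i<j)
      where
      go : ∀ {b} → T b → b ≡ true
      go {true} _ = ≡.refl

    <ᵇ-false : ∀ {i j} → j ≤ i → (i ℕ.<ᵇ j) ≡ false
    <ᵇ-false {i} {j} j≤i = go (λ t → ℕₚ.<⇒≱ (ℕₚ.<ᵇ⇒< i j t) j≤i)
      where
      go : ∀ {b} → ¬ T b → b ≡ false
      go {true}  h = ⊥-elim (h tt)
      go {false} h = ≡.refl

    entry-< : ∀ {i j} → i < j → entry i j ≈ θ κ (j ∸ i)
    entry-< {i} {j} i<j = reflexive (≡.cong (λ b → if b then θ κ (j ∸ i) else 1#) (<ᵇ-true i<j))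

    entry-≥ : ∀ {i j} → j ≤ i → entry i j ≈ 1#
    entry-≥ {i} {j} j≤i = reflexive (≡.cong (λ b → if b then θ κ (j ∸ i) else 1#) (<ᵇ-false j≤i))

    triangle : ∀ l → prod (λ j → prod (λ i → entry i j) (downFrom l)) (downFrom l) ≈ Θ κ (downFrom l)
    triangle zero    = refl
    triangle (suc l) = *-cong
      {prod (λ i → entry i l) (downFrom (suc l))} {prod (λ b → θ κ (l ∸ b)) (downFrom l)}
      {prod (λ j → prod (λ i → entry i j) (downFrom (suc l))) (downFrom l)} {Θ κ (downFrom l)}
      (trans (*-cong {entry l l} {1#} {prod (λ i → entry i l) (downFrom l)} {prod (λ b → θ κ (l ∸ b)) (downFrom l)} (entry-≥ {l} {l} ℕₚ.≤-refl)
          (prod-congᴬ {f = λ i → entry i l} {g = λ b → θ κ (l ∸ b)} (All.map (λ {i} → entry-< {i} {l}) (downFrom-< l))))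
        (*-identityˡ (prod (λ b → θ κ (l ∸ b)) (downFrom l))))
      (trans (prod-congᴬ {f = λ j → entry l j * prod (λ i → entry i j) (downFrom l)} {g = λ j → prod (λ i → entry i j) (downFrom l)}
          (All.map (λ {j} j<l → trans (*-congʳ {prod (λ i → entry i j) (downFrom l)} (entry-≥ {l} {j} (ℕₚ.<⇒≤ j<l))) (*-identityˡ (prod (λ i → entry i j) (downFrom l)))) (downFrom-< l)))
        (triangle l))

    pairs : ∀ l → prod (λ { (i , j) → thetaS (j ∸ i) κ }) (pairs1 (suc l)) ≈ Θ κ (downFrom l)
    pairs l = trans (prod-concatMap (λ { (i , j) → thetaS (j ∸ i) κ }) _ (range1 (suc l))) (trans (prod-cong inner (range1 (suc l)))
      (trans (prod-range1 (λ i → prod (entry i) (range1 (suc l))) l)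
      (trans (prod-cong {f = λ i → prod (entry (suc i)) (range1 (suc l))} {g = λ i → prod (λ j → entry i j) (downFrom l)}
          (λ i → prod-range1 (entry (suc i)) l) (downFrom l))
      (trans (prod-swap entry (downFrom l) (downFrom l)) (triangle l)))))
      where
      inner : ∀ i → prod (λ { (i , j) → thetaS (j ∸ i) κ }) (map (λ j → (i , j)) (filterᵇ (λ j → i ℕ.<ᵇ j) (range1 (suc l)))) ≈ prod (entry i) (range1 (suc l))
      inner i = trans (reflexive (prod-map _ (λ j → (i , j)) (filterᵇ (λ j → i ℕ.<ᵇ j) (range1 (suc l)))))
        (trans (prod-cong {f = λ j → thetaS (j ∸ i) κ} {g = λ j → θ κ (j ∸ i)} (λ j → thetaS≈ κ (j ∸ i)) (filterᵇ (λ j → i ℕ.<ᵇ j) (range1 (suc l))))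
               (prod-filter (λ j → θ κ (j ∸ i)) (λ j → i ℕ.<ᵇ j) (range1 (suc l))))

  rhsS≈ : ∀ m l k → rhsS m (suc l) k ≈
    ((pochInf (suc l) (suc l) * pochInf (m ℕ.+ suc l) (m ℕ.+ suc l) ^ l) * invQQ ^ suc l) * Θ (m ℕ.+ suc l) ((k ℕ.+ l) ∷ downFrom l)
  rhsS≈ m l k =
    trans (⊛≈* (((a ⊛ b) ⊛ c) ⊛ d) e)
    (trans (*-cong {((a ⊛ b) ⊛ c) ⊛ d} {((a * b′) * c′) * d′} {e} {e′}
      (trans (⊛≈* ((a ⊛ b) ⊛ c) d) (*-cong {(a ⊛ b) ⊛ c} {(a * b′) * c′} {d} {d′}
        (trans (⊛≈* (a ⊛ b) c) (*-cong {a ⊛ b} {a * b′} {c} {c′}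
          (trans (⊛≈* a b) (*-congˡ {a} {b} {b′} (powS≈ (pochInf κ κ) l))) (powS≈ invQQ (suc l))))
        (trans (prodS≈ (λ i → thetaS (i ℕ.+ k) κ) (range1 (suc l))) (row κ k l))))
      (trans (prodS≈ (λ { (i , j) → thetaS (j ∸ i) κ }) (pairs1 (suc l))) (pairs κ k l)))
    (*-assoc ((a * b′) * c′) d′ e′))
    where
    κ  = m ℕ.+ suc l
    a  = pochInf (suc l) (suc l)
    b  = powS (pochInf κ κ) l
    b′ = pochInf κ κ ^ l
    c  = powS invQQ (suc l)
    c′ = invQQ ^ suc l
    d  = prodS (map (λ i → thetaS (i ℕ.+ k) κ) (range1 (suc l)))
    d′ = prod (λ b → θ κ ((k ℕ.+ l) ∸ b)) (downFrom l)
    e  = prodS (map (λ { (i , j) → thetaS (j ∸ i) κ }) (pairs1 (suc l)))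
    e′ = Θ κ (downFrom l)

  module _ (s : ℕ) (W S G ρ ρ′ : Series) where
    -- For d ≥ 0 the factor q^s is stripped from `W`. For d < 0 the coefficient lies below q^s or
    -- has a negative index, and both sides are 0.
    shifted-coefficient : ∀ d → S ≈ W [mod s ℕ.+ suc ℤ.∣ d ∣ ] → W ≈ q^ s * G → G ≈ ρ [mod suc ℤ.∣ d ∣ ] → ρ′ ≈ ρ →
      coeffℤ S (d ℤ.+ + s) ≡ coeffℤ ρ′ d
    shifted-coefficient (+ d) S≈ hG h e = ≡.trans (≡.cong S (ℕₚ.+-comm d s))
      (≡.trans (mod⇒coeff {x = S} {y = W} S≈ (ℕₚ.+-monoʳ-< s ℕₚ.≤-refl))
      (≡.trans (hG (s ℕ.+ d)) (≡.trans (q^-* s G d)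
      (≡.trans (mod⇒coeff {x = G} {y = ρ} h ℕₚ.≤-refl) (≡.sym (e d))))))
    shifted-coefficient -[1+ j ] S≈ hG h e with suc j ℕ.≤? s
    ... | yes j<s = ≡.trans (≡.cong (coeffℤ S) (ℤₚ.⊖-≥ j<s))
        (≡.trans (mod⇒coeff {x = S} {y = W} S≈ (ℕₚ.<-≤-trans below (ℕₚ.m≤m+n s _)))
        (≡.trans (hG (s ∸ suc j)) (q^-*-< s G below)))
      where
      below : s ∸ suc j < s
      below = ℕₚ.≤-trans (ℕₚ.≤-reflexive (≡.sym (ℕₚ.+-∸-assoc 1 j<s))) (ℕₚ.m∸n≤m s j)
    ... | no j≮s = ≡.cong (coeffℤ S) (≡.trans (ℤₚ.⊖-< (ℕₚ.≰⇒> j≮s))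
        (≡.cong (λ e → ℤ.- (+ e)) (ℕₚ.+-∸-assoc 1 (ℕ.s≤s⁻¹ (ℕₚ.≰⇒> j≮s)))))

  module _ (m l k : ℕ) (1≤m : 1 ≤ m) (k≤m : k ≤ m) where
    open LimitTheorem seriesQ∞ m l k 1≤m k≤m using (limit-theorem; rhs)
    open Duality.Dual seriesQ m l k k≤m using (f₁; module W₁; module C₁)

    coefficients : ∀ d → ∃[ R ] (∀ r → R ≤ r → ∀ (S : Series) →
      S ≈ W₁.walk r f₁ C₁.origin [mod shiftExp m k r ℕ.+ suc ℤ.∣ d ∣ ] →
      coeffℤ S (d ℤ.+ + shiftExp m k r) ≡ coeffℤ (rhsS m (suc l) k) d)
    coefficients d = let R , H = limit-theorem invQQ invQQ-inv (suc ℤ.∣ d ∣) in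
      R , λ r R≤r S S≈ → let G , hG , h = H r R≤r in
        shifted-coefficient (shiftExp m k r) (W₁.walk r f₁ C₁.origin) S G (rhs invQQ invQQ-inv) (rhsS m (suc l) k) d S≈ hG h (rhsS≈ m l k)

-- The specialisation t = q^n, x_i = q^i as a ring homomorphism

module Specialisation (n : ℕ) where
  open ℤ⟦q⟧
  open Kit seriesRing using (sum; prod; _^_; sum-++)

  mono : ℤ → ℕ → Series
  mono c E d = if E ℕ.≡ᵇ d then c else + 0

  mono-* : ∀ c E f d → (mono c E * f) (E ℕ.+ d) ≡ c ℤ.* f d
  mono-* c zero    f d = const-* d
    where
    open Kit ℤₚ.+-*-commutativeRing using (anti-0)
    const-* : ∀ d → (mono c 0 * f) d ≡ c ℤ.* f d
    const-* zero    = ≡.refl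
    const-* (suc d) = ≡.trans (≡.cong (λ x → c ℤ.* f (suc d) ℤ.+ x) (anti-0 d (λ a b → ≡.refl))) (ℤₚ.+-identityʳ _)
  mono-* c (suc E) f d = ≡.trans (ℤₚ.+-identityˡ _) (mono-* c E f d)

  mono-*-< : ∀ c E f {d} → d < E → (mono c E * f) d ≡ + 0
  mono-*-< c (suc E) f {zero}  d<E       = ≡.refl
  mono-*-< c (suc E) f {suc d} (s≤s d<E) = ≡.trans (ℤₚ.+-identityˡ _) (mono-*-< c E f d<E)

  mono-< : ∀ c E {d} → d < E → mono c E d ≡ + 0
  mono-< c (suc E) {zero}  _         = ≡.refl
  mono-< c (suc E) {suc d} (s≤s d<E) = mono-< c E d<E

  mono-+ : ∀ c c′ E E′ → mono (c ℤ.* c′) (E ℕ.+ E′) ≈ mono c E * mono c′ E′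
  mono-+ c c′ E E′ d with split-≤ E d
  ... | inj₁ d<E          = ≡.trans (mono-< _ (E ℕ.+ E′) (ℕₚ.<-≤-trans d<E (ℕₚ.m≤m+n E E′))) (≡.sym (mono-*-< c E (mono c′ E′) d<E))
  ... | inj₂ (e , ≡.refl) = ≡.trans (≡.trans (cancel E) (*-mono E′ e)) (≡.sym (mono-* c E (mono c′ E′) e))
    where
    cancel : ∀ E → mono (c ℤ.* c′) (E ℕ.+ E′) (E ℕ.+ e) ≡ mono (c ℤ.* c′) E′ e
    cancel zero    = ≡.refl
    cancel (suc E) = cancel E
    *-mono : ∀ E′ e → mono (c ℤ.* c′) E′ e ≡ c ℤ.* mono c′ E′ e
    *-mono E′ e with E′ ℕ.≡ᵇ e
    ... | true  = ≡.refl
    ... | false = ≡.sym (ℤₚ.*-zeroʳ c)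

  q^-mono : ∀ a → mono (+ 1) a ≈ q^ a
  q^-mono zero    zero    = ≡.refl
  q^-mono zero    (suc d) = ≡.refl
  q^-mono (suc a) zero    = ≡.refl
  q^-mono (suc a) (suc d) = q^-mono a d

  weight-zip : ∀ {N} (v e e′ : Vec ℕ N) →
    V.sum (V.zipWith ℕ._*_ v (V.zipWith ℕ._+_ e e′)) ≡ V.sum (V.zipWith ℕ._*_ v e) ℕ.+ V.sum (V.zipWith ℕ._*_ v e′)
  weight-zip V.[]       V.[]       V.[]         = ≡.refl
  weight-zip (a V.∷ v) (x V.∷ e) (y V.∷ e′) = ≡.trans (≡.cong (a ℕ.* (x ℕ.+ y) ℕ.+_) (weight-zip v e e′))
    (solveℕ 5 (λ a x y s t → a ⊗ (x ⊕ y) ⊕ (s ⊕ t) ⊜ (a ⊗ x ⊕ s) ⊕ (a ⊗ y ⊕ t)) ≡.refl a x y _ _)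

  weight-0 : ∀ {N} (v : Vec ℕ N) → V.sum (V.zipWith ℕ._*_ v (V.replicate N 0)) ≡ 0
  weight-0 V.[]       = ≡.refl
  weight-0 (a V.∷ v) = ≡.cong₂ ℕ._+_ (ℕₚ.*-zeroʳ a) (weight-0 v)

  weight-unit : ∀ {N} (f : Fin N → ℕ) i →
    V.sum (V.zipWith ℕ._*_ (tabulate f) (tabulate (λ j → if ⌊ i Finₚ.≟ j ⌋ then 1 else 0))) ≡ f i
  weight-unit {suc N} f Fin.zero    = ≡.trans (≡.cong₂ ℕ._+_ (ℕₚ.*-identityʳ (f Fin.zero)) (off N (f ∘ Fin.suc))) (ℕₚ.+-identityʳ _)
    where
    off : ∀ N (g : Fin N → ℕ) → V.sum (V.zipWith ℕ._*_ (tabulate g) (tabulate {n = N} (λ j → if ⌊ Fin.zero Finₚ.≟ Fin.suc j ⌋ then 1 else 0))) ≡ 0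
    off zero    g = ≡.refl
    off (suc N) g = ≡.cong₂ ℕ._+_ (ℕₚ.*-zeroʳ (g Fin.zero)) (off N (g ∘ Fin.suc))
  weight-unit {suc N} f (Fin.suc i) = ≡.trans (≡.cong₂ ℕ._+_ (ℕₚ.*-zeroʳ (f Fin.zero))
      (≡.cong (λ t → V.sum (V.zipWith ℕ._*_ (tabulate (f ∘ Fin.suc)) t)) (Vₚ.tabulate-cong same)))
    (weight-unit (f ∘ Fin.suc) i)
    where
    same : ∀ j → (if ⌊ Fin.suc i Finₚ.≟ Fin.suc j ⌋ then 1 else 0) ≡ (if ⌊ i Finₚ.≟ j ⌋ then 1 else 0)
    same j with i Finₚ.≟ j
    ... | yes _ = ≡.refl
    ... | no _  = ≡.refl

  module _ {N : ℕ} where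
    exponent : Mono N → ℕ
    exponent x = n ℕ.* proj₁ x ℕ.+ weight (proj₂ x)

    term : ℤ × Mono N → Series
    term x = mono (proj₁ x) (exponent (proj₂ x))

    spec : Poly N → Series
    spec p = specCoeff n p

    spec-sum : ∀ p → spec p ≈ sum term p
    spec-sum []      d = ≡.refl
    spec-sum (x ∷ p) d = ≡.cong (λ y → term x d ℤ.+ y) (spec-sum p d)

    spec-++ : ∀ p p′ → spec (p ++ p′) ≈ spec p + spec p′
    spec-++ p p′ = trans (spec-sum (p ++ p′)) (trans (sum-++ term p p′) (sym (+-cong (spec-sum p) (spec-sum p′))))

    spec-neg : ∀ p → spec (negP p) ≈ - spec p
    spec-neg []      d = ≡.refl
    spec-neg (x ∷ p) d = ≡.trans (≡.cong₂ ℤ._+_ (neg-mono (exponent (proj₂ x) ℕ.≡ᵇ d)) (spec-neg p d)) (≡.sym (ℤₚ.neg-distrib-+ (term x d) (spec p d)))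
      where
      neg-mono : ∀ b → (if b then ℤ.- proj₁ x else + 0) ≡ ℤ.- (if b then proj₁ x else + 0)
      neg-mono true  = ≡.refl
      neg-mono false = ≡.refl

    spec-- : ∀ p p′ → spec (p -P p′) ≈ spec p - spec p′
    spec-- p p′ = trans (spec-++ p (negP p′)) (+-congˡ {spec p} (spec-neg p′))

    times : ℤ × Mono N → ℤ × Mono N → ℤ × Mono N
    times x y = proj₁ x ℤ.* proj₁ y , (proj₁ (proj₂ x) ℕ.+ proj₁ (proj₂ y) , V.zipWith ℕ._+_ (proj₂ (proj₂ x)) (proj₂ (proj₂ y)))

    term-times : ∀ x y → term (times x y) ≈ term x * term y
    term-times x y = trans (reflexive (≡.cong (mono (proj₁ x ℤ.* proj₁ y)) e)) (mono-+ (proj₁ x) (proj₁ y) (exponent (proj₂ x)) (exponent (proj₂ y)))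
      where
      e : exponent (proj₂ (times x y)) ≡ exponent (proj₂ x) ℕ.+ exponent (proj₂ y)
      e = ≡.trans (≡.cong (n ℕ.* (proj₁ (proj₂ x) ℕ.+ proj₁ (proj₂ y)) ℕ.+_) (weight-zip (tabulate toℕ) (proj₂ (proj₂ x)) (proj₂ (proj₂ y))))
        (solveℕ 5 (λ n a b s t → n ⊗ (a ⊕ b) ⊕ (s ⊕ t) ⊜ (n ⊗ a ⊕ s) ⊕ (n ⊗ b ⊕ t)) ≡.refl n (proj₁ (proj₂ x)) (proj₁ (proj₂ y)) _ _)

    spec-times : ∀ x p → spec (map (times x) p) ≈ term x * spec p
    spec-times x []      = sym (zeroʳ (term x))
    spec-times x (y ∷ p) = trans (+-cong {term (times x y)} {term x * term y} (term-times x y) (spec-times x p)) (sym (distribˡ (term x) (term y) (spec p)))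

    spec-* : ∀ p p′ → spec (p *P p′) ≈ spec p * spec p′
    spec-* []      p′ = sym (zeroˡ (spec p′))
    spec-* (x ∷ p) p′ = trans (spec-++ (map (times x) p′) (p *P p′))
      (trans (+-cong {spec (map (times x) p′)} {term x * spec p′} (spec-times x p′) (spec-* p p′)) (sym (distribʳ (spec p′) (term x) (spec p))))

    spec-single : ∀ a e {E} → n ℕ.* a ℕ.+ weight e ≡ E → spec ((+ 1 , (a , e)) ∷ []) ≈ q^ E
    spec-single a e ≡.refl = trans (λ d → ℤₚ.+-identityʳ _) (q^-mono (n ℕ.* a ℕ.+ weight e))

    spec-1 : spec oneP ≈ 1#
    spec-1 = trans (spec-single 0 (V.replicate N 0) (≡.cong₂ ℕ._+_ (ℕₚ.*-zeroʳ n) (weight-0 (tabulate {n = N} toℕ)))) q^-0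

    spec-t : spec tP ≈ q^ n
    spec-t = spec-single 1 (V.replicate N 0) (≡.trans (≡.cong₂ ℕ._+_ (ℕₚ.*-identityʳ n) (weight-0 (tabulate {n = N} toℕ))) (ℕₚ.+-identityʳ n))

    spec-x : ∀ i → spec (xP i) ≈ q^ (toℕ i)
    spec-x i = spec-single 0 _ (≡.cong₂ ℕ._+_ (ℕₚ.*-zeroʳ n) (weight-unit toℕ i))

    spec-prod : ∀ {A : Set} (f : A → Poly N) xs → spec (prodP (map f xs)) ≈ prod (spec ∘ f) xs
    spec-prod f []       = spec-1
    spec-prod f (x ∷ xs) = trans (spec-* (f x) (prodP (map f xs))) (*-congˡ {spec (f x)} (spec-prod f xs))

    spec-pow : ∀ p k → spec (powP p k) ≈ spec p ^ k
    spec-pow p zero    = spec-1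
    spec-pow p (suc k) = trans (spec-* p (powP p k)) (*-congˡ {spec p} (spec-pow p k))

    spec-concatMap : ∀ {A : Set} (f : A → Poly N) xs → spec (concatMap f xs) ≈ sum (spec ∘ f) xs
    spec-concatMap f []       = refl
    spec-concatMap f (x ∷ xs) = trans (spec-++ (f x) (concatMap f xs)) (+-congˡ {spec (f x)} (spec-concatMap f xs))

    same : Mono N → Mono N → Bool
    same x y = (proj₁ x ℕ.≡ᵇ proj₁ y) ∧ ⌊ Vₚ.≡-dec ℕ._≟_ (proj₂ x) (proj₂ y) ⌋

    same⇒≡ : ∀ x y → same x y ≡ true → x ≡ y
    same⇒≡ (a , e) (a′ , e′) h with a ℕ.≡ᵇ a′ in eq | Vₚ.≡-dec ℕ._≟_ e e′
    ... | true | yes ≡.refl = ≡.cong (_, e) (ℕₚ.≡ᵇ⇒≡ a a′ (≡.subst T (≡.sym eq) tt))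

    same-refl : ∀ x → same x x ≡ true
    same-refl (a , e) with a ℕ.≡ᵇ a in eq | Vₚ.≡-dec ℕ._≟_ e e
    ... | true  | yes _ = ≡.refl
    ... | true  | no ¬e = ⊥-elim (¬e ≡.refl)
    ... | false | _     = ⊥-elim (≡.subst T eq (ℕₚ.≡⇒≡ᵇ a a ≡.refl))

    -- A common form of two coefficients: `B` tests for one monomial in a polynomial, or for one
    -- total exponent in its specialisation.
    select : (Mono N → Bool) → Poly N → ℤ
    select B p = sumℤ (map (λ x → if B (proj₂ x) then proj₁ x else + 0) p)

    without : Mono N → Poly N → Poly N
    without x = filterᵇ (λ y → not (same x (proj₂ y)))

    select-split : ∀ B x p → select B p ≡ (if B x then select (same x) p else + 0) ℤ.+ select B (without x p)
    select-split B x []            with B x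
    ... | true  = ≡.refl
    ... | false = ≡.refl
    select-split B x ((c , y) ∷ p) with same x y in eq
    ... | false = ≡.trans (≡.cong (λ z → b ℤ.+ z) (select-split B x p)) (swap (B x))
      where
      b = if B y then c else + 0
      r = select B (without x p)
      swap : ∀ t → b ℤ.+ ((if t then select (same x) p else + 0) ℤ.+ r) ≡ (if t then + 0 ℤ.+ select (same x) p else + 0) ℤ.+ (b ℤ.+ r)
      swap true  = begin
        b ℤ.+ (z ℤ.+ r)           ≡⟨ ≡.sym (ℤₚ.+-assoc b z r) ⟩
        (b ℤ.+ z) ℤ.+ r           ≡⟨ ≡.cong (λ y → y ℤ.+ r) (ℤₚ.+-comm b z) ⟩
        (z ℤ.+ b) ℤ.+ r           ≡⟨ ℤₚ.+-assoc z b r ⟩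
        z ℤ.+ (b ℤ.+ r)           ≡⟨ ≡.cong (λ y → y ℤ.+ (b ℤ.+ r)) (≡.sym (ℤₚ.+-identityˡ z)) ⟩
        (+ 0 ℤ.+ z) ℤ.+ (b ℤ.+ r) ∎
        where
        open ≡.≡-Reasoning
        z = select (same x) p
      swap false = ≡.trans (≡.cong (λ z → b ℤ.+ z) (ℤₚ.+-identityˡ r)) (≡.sym (ℤₚ.+-identityˡ (b ℤ.+ r)))
    ... | true with same⇒≡ x y eq
    ...   | ≡.refl = ≡.trans (≡.cong (λ z → (if B x then c else + 0) ℤ.+ z) (select-split B x p)) (merge (B x))
      where
      r = select B (without x p)
      merge : ∀ t → (if t then c else + 0) ℤ.+ ((if t then select (same x) p else + 0) ℤ.+ r) ≡ (if t then c ℤ.+ select (same x) p else + 0) ℤ.+ r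
      merge true  = ≡.sym (ℤₚ.+-assoc c _ r)
      merge false = ℤₚ.+-identityˡ _

    -- A monomial may occur several times in the list, so all occurrences of the first one are
    -- removed together; their coefficients add up to 0, and the list becomes shorter.
    select-0 : ∀ fuel p → length p ≤ fuel → (∀ x → select (same x) p ≡ + 0) → ∀ B → select B p ≡ + 0
    select-0 fuel       []            _         h B = ≡.refl
    select-0 (suc fuel) ((c , x) ∷ p) (s≤s len) h B = ≡.trans (select-split B x ((c , x) ∷ p))
      (≡.trans (≡.cong (λ z → z ℤ.+ select B (without x ((c , x) ∷ p))) (if-0 (B x) (h x))) (≡.trans (ℤₚ.+-identityˡ _) (select-0 fuel (without x ((c , x) ∷ p)) shorter zeros B)))
      where
      if-0 : ∀ t {z} → z ≡ + 0 → (if t then z else + 0) ≡ + 0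
      if-0 true  e = e
      if-0 false e = ≡.refl
      shorter : length (without x ((c , x) ∷ p)) ≤ fuel
      shorter rewrite same-refl x = ℕₚ.≤-trans (Lₚ.length-filter _ p) len
      zeros : ∀ y → select (same y) (without x ((c , x) ∷ p)) ≡ + 0
      zeros y = ≡.trans (≡.sym (ℤₚ.+-identityˡ _)) (≡.trans (≡.cong (λ z → z ℤ.+ select (same y) (without x ((c , x) ∷ p))) (≡.sym (if-0 (same y x) (h x))))
        (≡.trans (≡.sym (select-split (same y) x ((c , x) ∷ p))) (h y)))

    select-- : ∀ B p p′ → select B (p -P p′) ≡ select B p ℤ.- select B p′
    select-- B []      p′ = ≡.trans (neg p′) (≡.sym (ℤₚ.+-identityˡ _))
      where
      neg : ∀ p → select B (negP p) ≡ ℤ.- select B p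
      neg []      = ≡.refl
      neg (x ∷ p) with B (proj₂ x)
      ... | true  = ≡.trans (≡.cong (λ z → ℤ.- proj₁ x ℤ.+ z) (neg p)) (≡.sym (ℤₚ.neg-distrib-+ (proj₁ x) (select B p)))
      ... | false = ≡.trans (ℤₚ.+-identityˡ _) (≡.trans (neg p) (≡.cong ℤ.-_ (≡.sym (ℤₚ.+-identityˡ _))))
    select-- B (x ∷ p) p′ = ≡.trans (≡.cong (λ z → (if B (proj₂ x) then proj₁ x else + 0) ℤ.+ z) (select-- B p p′)) (≡.sym (ℤₚ.+-assoc (if B (proj₂ x) then proj₁ x else + 0) _ _))

    -- `≈P` compares coefficients, while `spec` is computed from a list of monomials. The difference
    -- has only zero coefficients, to which `select-0` applies.
    spec-cong : ∀ p p′ → p ≈P p′ → spec p ≈ spec p′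
    spec-cong p p′ e d = ℤₚ.i-j≡0⇒i≡j _ _ (≡.trans (≡.sym (select-- (λ x → exponent x ℕ.≡ᵇ d) p p′))
      (select-0 _ (p -P p′) ℕₚ.≤-refl (λ x → ≡.trans (select-- (same x) p p′) (ℤₚ.i≡j⇒i-j≡0 (e (proj₁ x) (proj₂ x)))) _))

-- The factor φ a (a - n) vanishes, so within each residue class mod n the
-- numbers are picked in increasing order: the numbers that remain form n
-- arithmetic progressions, over each of which the product of φ telescopes.
module Strings (Q : QRing) (n : ℕ) (1≤n : 1 ≤ n) where
  open QRing Q
  open CommutativeRing cring hiding (zero)
  open Kit cring
  open QKit Q
  open Order Q
  open Compositions cring using (size; up)
  open Vandermonde cring
  open Walk Q n using (State; u; X; ∏ρ; step; walk; Inv; up-Inv; energy; energy-up)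
  open SetoidReasoning setoid

  cs : List ℕ
  cs = downFrom n

  module C = Walk.Parts Q n cs (downFrom-< n) (downFrom-# n)

  t : Carrier
  t = mon n

  -- φ a b = (q^a - q^(n+b)) / (q^a - q^b)
  φ : ℕ → ℕ → Carrier
  φ a b = t + (1# - t) * ρ a b

  φ-mul : ∀ {a b} → a ≢ b → (mon a - mon b) * φ a b ≈ mon a - mon (n ℕ.+ b)
  φ-mul {a} {b} a≢b = begin
    (mon a - mon b) * (t + (1# - t) * ρ a b)
      ≈⟨ solve 4 (λ a b t r → (a :- b) :* (t :+ (:1 :- t) :* r) := t :* (a :- b) :+ (:1 :- t) :* ((a :- b) :* r)) refl _ _ _ _ ⟩
    t * (mon a - mon b) + (1# - t) * ((mon a - mon b) * ρ a b)
      ≈⟨ +-congˡ (*-congˡ (ρ-mul a≢b)) ⟩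
    t * (mon a - mon b) + (1# - t) * mon a
      ≈⟨ solve 3 (λ a b t → t :* (a :- b) :+ (:1 :- t) :* a := a :- t :* b) refl _ _ _ ⟩
    mon a - t * mon b
      ≈⟨ +-congˡ (-‿cong (sym (mon-+ n b))) ⟩
    mon a - mon (n ℕ.+ b) ∎

  u-up : ∀ a → u (up a) ≡ n ℕ.+ u a
  u-up (c , y) = ≡.trans (≡.cong (c ℕ.+_) (ℕₚ.*-suc n y)) (≡.trans (≡.sym (ℕₚ.+-assoc c n _))
    (≡.trans (≡.cong (ℕ._+ n ℕ.* y) (ℕₚ.+-comm c n)) (ℕₚ.+-assoc n c _)))

  up≢ : ∀ a → u (up a) ≢ u a
  up≢ a e = ℕₚ.<⇒≢ (ℕₚ.m<n+m (u a) 1≤n) (≡.sym (≡.trans (≡.sym (u-up a)) e))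

  φ-up : ∀ a → φ (u (up a)) (u a) ≈ 0#
  φ-up a = diff-cancel (up≢ a) (begin
    (X (up a) - X a) * φ (u (up a)) (u a)  ≈⟨ φ-mul (up≢ a) ⟩
    X (up a) - mon (n ℕ.+ u a)             ≈⟨ +-congˡ (-‿cong (mon-≡ (≡.sym (u-up a)))) ⟩
    X (up a) - X (up a)                    ≈⟨ -‿inverseʳ _ ⟩
    0#                                     ≈⟨ sym (zeroʳ _) ⟩
    (X (up a) - X a) * 0# ∎)

  end : ℕ × ℕ → ℕ → ℕ × ℕ
  end a zero    = a
  end a (suc l) = end (up a) l

  str : ℕ × ℕ → ℕ → List ℕ
  str a zero    = []
  str a (suc l) = u a ∷ str (up a) l

  telescope : ∀ a b l → All (λ c → a ≢ c) (str b l) → (mon a - X b) * prod (φ a) (str b l) ≈ mon a - X (end b l)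
  telescope a b zero    _        = *-identityʳ _
  telescope a b (suc l) (h ∷ hs) = begin
    (mon a - X b) * (φ a (u b) * prod (φ a) (str (up b) l))
      ≈⟨ sym (*-assoc _ _ _) ⟩
    ((mon a - X b) * φ a (u b)) * prod (φ a) (str (up b) l)
      ≈⟨ *-congʳ (trans (φ-mul h) (+-congˡ (-‿cong (mon-≡ (≡.sym (u-up b)))))) ⟩
    (mon a - X (up b)) * prod (φ a) (str (up b) l)
      ≈⟨ telescope a (up b) l hs ⟩
    mon a - X (end b (suc l)) ∎

  1-far : ∀ {B a e} → B ℕ.+ a ≤ e → ∃[ d ] ((mon a - mon e ≈ mon a * d) × (d ≈ 1# [mod B ]))
  1-far {B} {a} {e} h = 1# - mon (e ∸ a) ,
    trans (+-congˡ (-‿cong (mon-∸ (ℕₚ.≤-trans (ℕₚ.m≤n+m a B) h)))) (solve 2 (λ a d → a :- a :* d := a :* (:1 :- d)) refl _ _) ,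
    Ord-resp (solve 1 (λ d → :- :1 :* d := (:1 :- d) :- :1) refl _) (Ord-*ʳ (- 1#)
      (Ord-≤ (ℕₚ.≤-trans (ℕₚ.≤-reflexive (≡.sym (ℕₚ.m+n∸n≡m B a))) (ℕₚ.∸-monoˡ-≤ a h)) (1# , sym (*-identityʳ _))))

  -- The product telescopes to (q^a - q^e) / (q^a - q^(u b)) with e the end of the string, and q^e
  -- is negligible beside q^a.
  other-string : ∀ {B} a b l → a ≢ u b → All (λ c → a ≢ c) (str b l) → B ℕ.+ a ≤ u (end b l) →
    prod (φ a) (str b l) ≈ ρ a (u b) [mod B ]
  other-string {B} a b l a≢b h far = let d , e , d≈1 = 1-far {B} far in
    mod-trans (≈⇒mod (mon-cancel a (begin
      mon a * prod (φ a) (str b l)                            ≈⟨ *-congʳ (sym (ρ-mul a≢b)) ⟩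
      ((mon a - X b) * ρ a (u b)) * prod (φ a) (str b l)      ≈⟨ solve 3 (λ x r p → (x :* r) :* p := r :* (x :* p)) refl _ _ _ ⟩
      ρ a (u b) * ((mon a - X b) * prod (φ a) (str b l))      ≈⟨ *-congˡ (trans (telescope a b l h) e) ⟩
      ρ a (u b) * (mon a * d)                                 ≈⟨ solve 3 (λ r x d → r :* (x :* d) := x :* (r :* d)) refl _ _ _ ⟩
      mon a * (ρ a (u b) * d) ∎)))
    (mod-trans (mod-* (≈⇒mod refl) d≈1) (≈⇒mod (*-identityʳ _)))

  str-> : ∀ a b l → u a < u b → All (λ c → u a < c) (str b l)
  str-> a b zero    h = []
  str-> a b (suc l) h = h ∷ str-> a (up b) l (ℕₚ.<-≤-trans h (ℕₚ.≤-trans (ℕₚ.m≤n+m (u b) n) (ℕₚ.≤-reflexive (≡.sym (u-up b)))))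

  up> : ∀ a → u a < u (up a)
  up> a = ℕₚ.≤∧≢⇒< (ℕₚ.≤-trans (ℕₚ.m≤n+m (u a) n) (ℕₚ.≤-reflexive (≡.sym (u-up a)))) (λ e → up≢ a (≡.sym e))

  -- In its own class the telescoping starts at u a + n, and 1 - t is exactly the factor that
  -- cancels the remaining denominator.
  own-string : ∀ {B} a l → B ℕ.+ u a ≤ u (end (up a) l) → (1# - t) * prod (φ (u a)) (str (up a) l) ≈ 1# [mod B ]
  own-string {B} a l far = let d , e , d≈1 = 1-far {B} far in
    mod-trans (≈⇒mod (mon-cancel (u a) (begin
      X a * ((1# - t) * prod (φ (u a)) (str (up a) l))
        ≈⟨ solve 3 (λ x t p → x :* ((:1 :- t) :* p) := (x :- t :* x) :* p) refl _ _ _ ⟩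
      (X a - t * X a) * prod (φ (u a)) (str (up a) l)
        ≈⟨ *-congʳ (+-congˡ (-‿cong (trans (sym (mon-+ n (u a))) (mon-≡ (≡.sym (u-up a)))))) ⟩
      (X a - X (up a)) * prod (φ (u a)) (str (up a) l)
        ≈⟨ telescope (u a) (up a) l (All.map ℕₚ.<⇒≢ (str-> a (up a) l (up> a))) ⟩
      X a - X (end (up a) l)
        ≈⟨ e ⟩
      X a * d ∎))) d≈1

  -- A state together with the lengths of the strings that remain ahead of it.
  Strings : Set
  Strings = List ((ℕ × ℕ) × ℕ)

  cont : Strings → List ℕ
  cont = concatMap (λ α → str (proj₁ α) (proj₂ α))

  advance : (ℕ × ℕ) × ℕ → (ℕ × ℕ) × ℕ
  advance (a , l) = up a , l ∸ 1

  -- The term is 0 whenever the entry just before the marked one is smaller by n, as it is inside a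
  -- string.
  Vanishing : Foc ℕ → Set
  Vanishing G = ∀ p a q → G (p ++ u a ∷ []) (u (up a)) q ≈ 0#

  Vanishing-++ : ∀ {G} p₀ → Vanishing G → Vanishing (λ p → G (p₀ ++ p))
  Vanishing-++ {G} p₀ v p a q = trans (reflexive (≡.cong (λ r → G r (u (up a)) q) (≡.sym (Lₚ.++-assoc p₀ p _)))) (v (p₀ ++ p) a q)

  foc-tail : ∀ {G} → Vanishing G → ∀ p₀ a l → foc (λ p → G (p₀ ++ u a ∷ p)) (str (up a) l) ≈ 0#
  foc-tail     v p₀ a zero    = refl
  foc-tail {G} v p₀ a (suc l) = trans (+-cong (v p₀ a _)
    (trans (foc-cong (λ p x q → reflexive (≡.cong (λ r → G r x q) (≡.sym (Lₚ.++-assoc p₀ (u a ∷ []) _)))) (str (up (up a)) l))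
           (foc-tail {G} v (p₀ ++ u a ∷ []) (up a) l))) (+-identityˡ _)

  -- Every entry of a string other than its head follows one that is smaller by n, so only the heads
  -- can be picked.
  foc-cont : ∀ {G} → Vanishing G → ∀ S → All (λ α → 1 ≤ proj₂ α) S →
    foc G (cont S) ≈ foc (λ P α R → G (cont P) (u (proj₁ α)) (cont (advance α ∷ R))) S
  foc-cont     v []                 _          = refl
  foc-cont {G} v ((a , suc l) ∷ S) (_ ∷ lens) = begin
    foc G (str a (suc l) ++ cont S)
      ≈⟨ foc-++ G (str a (suc l)) (cont S) ⟩
    (G [] (u a) (str (up a) l ++ cont S) + foc (λ p x q → G (u a ∷ p) x (q ++ cont S)) (str (up a) l))
      + foc (λ p → G (str a (suc l) ++ p)) (cont S)
      ≈⟨ +-cong (trans (+-congˡ (foc-tail {λ p x q → G p x (q ++ cont S)} (λ p a q → v p a (q ++ cont S)) [] a l)) (+-identityʳ _))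
           (foc-cont (Vanishing-++ {G} (str a (suc l)) v) S lens) ⟩
    _ ∎

  residues : Strings → State
  residues = map proj₁

  weighted : (ℕ → List ℕ → Carrier) → List ℕ → Carrier
  weighted F = foc (λ p a q → ((1# - t) * prod (φ a) (p ++ q)) * F a (p ++ q))

  weighted-vanishing : ∀ (F : ℕ → List ℕ → Carrier) → Vanishing (λ p a q → ((1# - t) * prod (φ a) (p ++ q)) * F a (p ++ q))
  weighted-vanishing F p a q = trans (*-congʳ (trans (*-congˡ zero-factor) (zeroʳ (1# - t)))) (zeroˡ (F (u (up a)) ((p ++ u a ∷ []) ++ q)))
    where
    zero-factor : prod (φ (u (up a))) ((p ++ u a ∷ []) ++ q) ≈ 0#
    zero-factor = trans (prod-↭ (φ (u (up a))) (↭ₚ.++⁺ʳ q (↭ₚ.++-comm p (u a ∷ [])))) (trans (*-congʳ (φ-up a)) (zeroˡ _))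

  Far : ℕ → Strings → Set
  Far N S = All (λ α → N ≤ u (end (proj₁ α) (proj₂ α))) S

  -- A bound for all heads after r steps, since residues are below n and heights at most r.
  top : ℕ → ℕ
  top r = n ℕ.+ n ℕ.* r

  heads-≤ : ∀ {r} s → Inv cs r s → All (λ a → u a ≤ top r) s
  heads-≤ s i = All.zipWith (λ { (h , h′) → ℕₚ.+-mono-≤ (ℕₚ.<⇒≤ h) (ℕₚ.*-monoʳ-≤ n (≡.subst (_ ≤_) (proj₂ i) h′)) }) (proj₂ (C.Inv⇒distinct s i) , size-≥ s)
    where
    size-≥ : ∀ (s : State) → All (λ a → proj₂ a ≤ size s) s
    size-≥ []      = []
    size-≥ (a ∷ s) = ℕₚ.m≤m+n _ _ ∷ All.map (λ h → ℕₚ.≤-trans h (ℕₚ.m≤n+m _ (proj₂ a))) (size-≥ s)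

  module _ {B r N} (N-large : suc (B ℕ.+ top r) ≤ N) where
    lengths : ∀ S → Inv cs r (residues S) → Far N S → All (λ α → 1 ≤ proj₂ α) S
    lengths S i far = All.zipWith (λ {α} → positive {α}) (Allₚ.map⁻ (heads-≤ (residues S) i) , far)
      where
      positive : ∀ {α} → u (proj₁ α) ≤ top r × N ≤ u (end (proj₁ α) (proj₂ α)) → 1 ≤ proj₂ α
      positive {a , zero}  (h , h′) = ⊥-elim (ℕₚ.<⇒≱ (ℕₚ.≤-<-trans (ℕₚ.≤-trans h (ℕₚ.m≤n+m _ B)) N-large) h′)
      positive {a , suc l} _        = s≤s z≤n

    module _ {P α R} (i : Inv cs r (residues (P ++ α ∷ R))) (far : Far N (P ++ α ∷ R)) where
      a = proj₁ α

      ↭s : P ++ α ∷ R ↭ α ∷ P ++ R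
      ↭s = ↭ₚ.shift α P R

      low : u a ≤ top r
      low = All.head (↭ₚ.All-resp-↭ ↭s (Allₚ.map⁻ (heads-≤ _ i)))

      far-a : ∀ {e} → N ≤ e → B ℕ.+ u a ≤ e
      far-a h = ℕₚ.≤-trans (ℕₚ.+-monoʳ-≤ B low) (ℕₚ.≤-trans (ℕₚ.n≤1+n _) (ℕₚ.≤-trans N-large h))

      others : All (λ β → prod (φ (u a)) (str (proj₁ β) (proj₂ β)) ≈ ρ (u a) (u (proj₁ β)) [mod B ]) (P ++ R)
      others with C.Inv⇒distinct _ i
      ... | _ , s<n with ↭ₚ.All-resp-↭ ↭s (Allₚ.map⁻ s<n) | AllPairs-↭ (λ h e → h (≡.sym e)) (↭ₚ.map⁺ proj₁ ↭s) residues#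
        where
        residues# : AllPairs (λ a b → proj₁ a ≢ proj₁ b) (residues (P ++ α ∷ R))
        residues# = AllPairs-map (≡.subst (AllPairs _≢_) (≡.sym (proj₁ i)) (downFrom-# n))
          where
          AllPairs-map : ∀ {s : State} → AllPairs _≢_ (map proj₁ s) → AllPairs (λ a b → proj₁ a ≢ proj₁ b) s
          AllPairs-map {[]}    []       = []
          AllPairs-map {a ∷ s} (h ∷ hs) = Allₚ.map⁻ h ∷ AllPairs-map hs
      ...   | a<n ∷ rest<n | a# ∷ _ = All.zipWith (λ {β} → one {β}) (All.zip (rest<n , Allₚ.map⁻ a#) , All.tail (↭ₚ.All-resp-↭ ↭s far))
        where
        avoid : ∀ b l → proj₁ b < n → proj₁ a ≢ proj₁ b → All (λ c → u a ≢ c) (str b l)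
        avoid b zero    b<n ne = []
        avoid b (suc l) b<n ne = (λ e → ne (C.u-mod {proj₁ a} {proj₁ b} a<n b<n e)) ∷ avoid (up b) l b<n ne
        one : ∀ {β} → (proj₁ (proj₁ β) < n × proj₁ a ≢ proj₁ (proj₁ β)) × N ≤ u (end (proj₁ β) (proj₂ β)) →
          prod (φ (u a)) (str (proj₁ β) (proj₂ β)) ≈ ρ (u a) (u (proj₁ β)) [mod B ]
        one {b , l} ((b<n , ne) , h) = other-string (u a) b l (λ e → ne (C.u-mod {proj₁ a} {proj₁ b} a<n b<n e)) (avoid b l b<n ne) (far-a h)

      weight-approx : 1 ≤ proj₂ α → (1# - t) * prod (φ (u a)) (cont (P ++ advance α ∷ R)) ≈ ∏ρ a (residues P ++ residues R) [mod B ]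
      weight-approx 1≤l = mod-trans (≈⇒mod (trans (*-congˡ (trans (prod-concatMap (φ (u a)) _ (P ++ advance α ∷ R)) (prod-focus _ P))) (sym (*-assoc _ _ _))))
        (mod-trans (mod-* (own 1≤l (All.head (↭ₚ.All-resp-↭ ↭s far))) (mod-prod (P ++ R) others))
          (≈⇒mod (trans (*-identityˡ _) (reflexive (≡.trans (≡.sym (prod-map (λ b → ρ (u a) (u b)) proj₁ (P ++ R))) (≡.cong (∏ρ a) (Lₚ.map-++ proj₁ P R)))))))
        where
        own : ∀ {l} → 1 ≤ l → N ≤ u (end a l) → (1# - t) * prod (φ (u a)) (str (up a) (l ∸ 1)) ≈ 1# [mod B ]
        own {suc l} _ h = own-string a l (far-a h)

    -- Picking a number from the remaining ones is a step of the walk modulo q^B: the picked string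
    -- contributes 1, and each other string the fraction for its head.
    weighted-step : ∀ (F : ℕ → List ℕ → Carrier) S → Inv cs r (residues S) → Far N S →
      weighted F (cont S) ≈ foc (λ P α R → ∏ρ (proj₁ α) (residues P ++ residues R) * F (u (proj₁ α)) (cont (P ++ advance α ∷ R))) S [mod B ]
    weighted-step F S i far = mod-trans (≈⇒mod (foc-cont (weighted-vanishing F) S (lengths S i far)))
      (mod-foc (λ S → Inv cs r (residues S) × Far N S) (λ P α R (i , far) → mod-trans (≈⇒mod (reflexive (≡.cong
          (λ L → ((1# - t) * prod (φ (u (proj₁ α))) L) * F (u (proj₁ α)) L) (≡.sym (Lₚ.concatMap-++ (λ α → str (proj₁ α) (proj₂ α)) P (advance α ∷ R))))))
        (mod-* (weight-approx {P} {α} {R} i far (All.head (Allₚ.++⁻ʳ P (lengths _ i far)))) (≈⇒mod refl))) S (i , far))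

  advance-Inv : ∀ {r} P α R → Inv cs r (residues (P ++ α ∷ R)) → Inv cs (suc r) (residues (P ++ advance α ∷ R))
  advance-Inv P α R i = ≡.subst (Inv cs _) (≡.sym (Lₚ.map-++ proj₁ P _)) (up-Inv (residues P) (proj₁ α) (residues R) (≡.subst (Inv cs _) (Lₚ.map-++ proj₁ P _) i))

  advance-Far : ∀ {N} P α R → 1 ≤ proj₂ α → Far N (P ++ α ∷ R) → Far N (P ++ advance α ∷ R)
  advance-Far P (a , suc l) R _ far with ↭ₚ.All-resp-↭ (↭ₚ.shift (a , suc l) P R) far
  ... | h ∷ hs = ↭ₚ.All-resp-↭ (↭.↭-sym (↭ₚ.shift (up a , l) P R)) (h ∷ hs)

  -- `walk` absorbs its last step first, whereas picking begins with the first step.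
  walk-step : ∀ r f s → walk (suc r) f s ≈ step (walk r f) s
  walk-step zero    f s = refl
  walk-step (suc r) f s = walk-step r (step f) s

  module _ (m : ℕ) where
    peel : ℕ → (List ℕ → Carrier) → List ℕ → Carrier
    peel zero    τ = τ
    peel (suc r) τ = weighted (λ a L → mon (m ℕ.* a) * peel r τ L)

    -- Picking pays q^(m a) at once, the walk only at its endpoint; the power in front on the left
    -- stands for the numbers visited before `S`.
    peel-walk : ∀ {B N} r r₀ → suc (B ℕ.+ top (r ℕ.+ r₀)) ≤ N → ∀ τ (g : State → Carrier) →
      (∀ S → Inv cs (r ℕ.+ r₀) (residues S) → Far N S → τ (cont S) ≈ g (residues S) [mod B ]) →
      ∀ S → Inv cs r₀ (residues S) → Far N S →
      mon (m ℕ.* energy (residues S)) * peel r τ (cont S) ≈ walk r (λ s → mon (m ℕ.* energy s) * g s) (residues S) [mod B ]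
    peel-walk         zero    r₀ N-large τ g base S i far = mod-* (≈⇒mod refl) (base S i far)
    peel-walk {B} {N} (suc r) r₀ N-large τ g base S i far =
      mod-trans (mod-* (≈⇒mod refl) (weighted-step {B} N-large₀ (λ a L → mon (m ℕ.* a) * peel r τ L) S i far))
      (mod-trans (≈⇒mod (*-foc _ _ S))
      (mod-trans (mod-foc (λ S′ → S′ ≡ S × Inv cs r₀ (residues S′) × Far N S′) term S (≡.refl , i , far))
      (≈⇒mod (trans (sym (foc-map proj₁ _ S)) (sym (walk-step r _ (residues S)))))))
      where
      N-large₀ : suc (B ℕ.+ top r₀) ≤ N
      N-large₀ = ℕₚ.≤-trans (s≤s (ℕₚ.+-monoʳ-≤ B (ℕₚ.+-monoʳ-≤ n (ℕₚ.*-monoʳ-≤ n (ℕₚ.m≤n+m r₀ (suc r)))))) N-large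
      shifted : ∀ S → Inv cs (suc r₀) (residues S) → Far N S →
        mon (m ℕ.* energy (residues S)) * peel r τ (cont S) ≈ walk r (λ s → mon (m ℕ.* energy s) * g s) (residues S) [mod B ]
      shifted = peel-walk r (suc r₀) (≡.subst (λ x → suc (B ℕ.+ top x) ≤ N) (≡.sym (ℕₚ.+-suc r r₀)) N-large) τ g
        (λ S i → base S (≡.subst (λ x → Inv cs x (residues S)) (ℕₚ.+-suc r r₀) i))
      term : ∀ P α R → P ++ α ∷ R ≡ S × Inv cs r₀ (residues (P ++ α ∷ R)) × Far N (P ++ α ∷ R) →
        mon (m ℕ.* energy (residues S)) * (∏ρ (proj₁ α) (residues P ++ residues R) * (mon (m ℕ.* u (proj₁ α)) * peel r τ (cont (P ++ advance α ∷ R))))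
        ≈ ∏ρ (proj₁ α) (residues P ++ residues R) * walk r (λ s → mon (m ℕ.* energy s) * g s) (residues P ++ up (proj₁ α) ∷ residues R) [mod B ]
      term P α R (≡.refl , i , far) = mod-trans (≈⇒mod rearranged) (mod-* (≈⇒mod refl)
        (≡.subst (λ s → mon (m ℕ.* energy (residues S′)) * peel r τ (cont S′) ≈ walk r (λ s → mon (m ℕ.* energy s) * g s) s [mod B ])
          (Lₚ.map-++ proj₁ P (advance α ∷ R))
          (shifted S′ (advance-Inv P α R i) (advance-Far P α R (All.head (Allₚ.++⁻ʳ P (lengths {B} N-large₀ _ i far))) far))))
        where
        S′ = P ++ advance α ∷ R
        energy′ : energy (residues S′) ≡ energy (residues (P ++ α ∷ R)) ℕ.+ u (proj₁ α)
        energy′ = ≡.trans (≡.cong energy (Lₚ.map-++ proj₁ P (advance α ∷ R)))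
          (≡.trans (energy-up (residues P) (proj₁ α) (residues R)) (≡.cong (λ s → energy s ℕ.+ u (proj₁ α)) (≡.sym (Lₚ.map-++ proj₁ P (α ∷ R)))))
        rearranged : mon (m ℕ.* energy (residues (P ++ α ∷ R))) * (∏ρ (proj₁ α) (residues P ++ residues R) * (mon (m ℕ.* u (proj₁ α)) * peel r τ (cont S′)))
          ≈ ∏ρ (proj₁ α) (residues P ++ residues R) * (mon (m ℕ.* energy (residues S′)) * peel r τ (cont S′))
        rearranged = trans (solve 4 (λ a b c d → a :* (b :* (c :* d)) := b :* ((a :* c) :* d)) refl _ _ _ _)
          (*-congˡ (*-congʳ (trans (sym (mon-+ _ _)) (mon-≡ (≡.trans (≡.sym (ℕₚ.*-distribˡ-+ m _ (u (proj₁ α)))) (≡.cong (m ℕ.*_) (≡.sym energy′)))))))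

  up-end : ∀ c y l → u (end (c , suc y) l) ≡ u (end (c ℕ.+ n , y) l)
  up-end c y zero    = ≡.trans (u-up (c , y)) (≡.trans (ℕₚ.+-comm n _) (≡.trans (ℕₚ.+-assoc c _ n) (≡.trans (≡.cong (c ℕ.+_) (ℕₚ.+-comm _ n)) (≡.sym (ℕₚ.+-assoc c n _)))))
  up-end c y (suc l) = up-end c (suc y) l

  up-str : ∀ c y l → str (c , suc y) l ≡ str (c ℕ.+ n , y) l
  up-str c y zero    = ≡.refl
  up-str c y (suc l) = ≡.cong₂ _∷_ (up-end c y 0) (up-str c (suc y) l)

  at-zero : List (ℕ × ℕ) → Strings
  at-zero = map (λ { (c , l) → (c , 0) , l })

  -- The strings are built downwards from the end, each new number going in
  -- front of the string whose head is n larger.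
  round-robin : ∀ j i → ∃[ Z ] (map proj₁ Z ≡ map (i ℕ.+_) (downFrom n) × Far (i ℕ.+ j) (at-zero Z) × cont (at-zero Z) ↭ map (i ℕ.+_) (upTo j))
  round-robin zero    i = map (λ c → i ℕ.+ c , 0) (downFrom n) , ≡.sym (Lₚ.map-∘ (downFrom n)) ,
    Allₚ.map⁺ (Allₚ.map⁺ (All.universal (λ c → ℕₚ.≤-trans (ℕₚ.+-monoʳ-≤ i z≤n) (ℕₚ.m≤m+n (i ℕ.+ c) (n ℕ.* 0))) (downFrom n))) , empty (downFrom n)
    where
    empty : ∀ ds → cont (at-zero (map (λ c → i ℕ.+ c , 0) ds)) ↭ []
    empty []       = ↭.↭-refl
    empty (d ∷ ds) = empty ds
  round-robin (suc j) i with round-robin j (suc i) | n-suc n 1≤n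
    where
    n-suc : ∀ n → 1 ≤ n → ∃[ l ] n ≡ suc l
    n-suc (suc l) _ = l , ≡.refl
  ... | []          , heads , _           , _    | l , n≡ = ⊥-elim (nil (≡.trans heads (≡.cong (λ n → map (suc i ℕ.+_) (downFrom n)) n≡)))
    where
    nil : ∀ {x : ℕ} {xs : List ℕ} → ¬ (_≡_ {A = List ℕ} [] (x ∷ xs))
    nil ()
  ... | (c , len) ∷ Z , heads , far ∷ fars , perm | l , n≡ = Z ++ (i , suc len) ∷ [] , heads′ , far′ , perm′
    where
    heads₁ : c ∷ map proj₁ Z ≡ (suc i ℕ.+ l) ∷ map (suc i ℕ.+_) (downFrom l)
    heads₁ = ≡.trans heads (≡.cong (λ n → map (suc i ℕ.+_) (downFrom n)) n≡)
    c≡ : c ≡ i ℕ.+ n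
    c≡ = ≡.trans (Lₚ.∷-injectiveˡ heads₁) (≡.trans (≡.sym (ℕₚ.+-suc i l)) (≡.cong (i ℕ.+_) (≡.sym n≡)))
    rotate : ∀ l → map (suc i ℕ.+_) (downFrom l) ++ i ∷ [] ≡ map (i ℕ.+_) (downFrom (suc l))
    rotate zero    = ≡.cong (_∷ []) (≡.sym (ℕₚ.+-identityʳ i))
    rotate (suc l) = ≡.cong₂ _∷_ (≡.sym (ℕₚ.+-suc i l)) (rotate l)
    heads′ : map proj₁ (Z ++ (i , suc len) ∷ []) ≡ map (i ℕ.+_) (downFrom n)
    heads′ = ≡.trans (Lₚ.map-++ proj₁ Z _) (≡.trans (≡.cong (_++ i ∷ []) (Lₚ.∷-injectiveʳ heads₁)) (≡.trans (rotate l) (≡.cong (λ n → map (i ℕ.+_) (downFrom n)) (≡.sym n≡))))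
    end≡ : u (end (i , 1) len) ≡ u (end (c , 0) len)
    end≡ = ≡.trans (up-end i 0 len) (≡.cong (λ c → u (end (c , 0) len)) (≡.sym c≡))
    at-zero-++ : at-zero (Z ++ (i , suc len) ∷ []) ≡ at-zero Z ++ ((i , 0) , suc len) ∷ []
    at-zero-++ = Lₚ.map-++ _ Z _
    far′ : Far (i ℕ.+ suc j) (at-zero (Z ++ (i , suc len) ∷ []))
    far′ = ≡.subst (Far (i ℕ.+ suc j)) (≡.sym at-zero-++) (≡.subst (λ e → Far e (at-zero Z ++ ((i , 0) , suc len) ∷ [])) (≡.sym (ℕₚ.+-suc i j))
      (Allₚ.++⁺ fars (≡.subst (suc i ℕ.+ j ≤_) (≡.sym end≡) far ∷ [])))
    content : cont (at-zero (Z ++ (i , suc len) ∷ [])) ≡ cont (at-zero Z) ++ u (i , 0) ∷ str (c , 0) len ++ []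
    content = ≡.trans (≡.cong cont at-zero-++) (≡.trans (Lₚ.concatMap-++ _ (at-zero Z) _)
      (≡.cong (λ s → cont (at-zero Z) ++ u (i , 0) ∷ s ++ []) (≡.trans (up-str i 0 len) (≡.cong (λ c → str (c , 0) len) (≡.sym c≡)))))
    tail : map (suc i ℕ.+_) (upTo j) ≡ map (i ℕ.+_) (L.applyUpTo suc j)
    tail = ≡.trans (Lₚ.map-upTo (suc i ℕ.+_) j) (≡.trans (applyUpTo-cong j) (≡.sym (Lₚ.map-applyUpTo suc (i ℕ.+_) j)))
      where
      applyUpTo-cong : ∀ j → L.applyUpTo (suc i ℕ.+_) j ≡ L.applyUpTo (λ x → i ℕ.+ suc x) j
      applyUpTo-cong j = go j id
        where
        go : ∀ j (f : ℕ → ℕ) → L.applyUpTo (λ x → suc i ℕ.+ f x) j ≡ L.applyUpTo (λ x → i ℕ.+ suc (f x)) j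
        go zero    f = ≡.refl
        go (suc j) f = ≡.cong₂ _∷_ (≡.sym (ℕₚ.+-suc i (f 0))) (go j (f ∘ suc))
    perm′ : cont (at-zero (Z ++ (i , suc len) ∷ [])) ↭ map (i ℕ.+_) (upTo (suc j))
    perm′ = ↭.↭-trans (↭.↭-reflexive content) (↭.↭-trans (↭ₚ.shift (u (i , 0)) (cont (at-zero Z)) _)
      (↭.↭-trans (↭.↭-reflexive (≡.cong (_∷ (cont (at-zero Z) ++ str (c , 0) len ++ [])) (≡.cong (i ℕ.+_) (ℕₚ.*-zeroʳ n))))
      (↭.prep (i ℕ.+ 0) (↭.↭-trans (↭.↭-trans (↭ₚ.++-comm (cont (at-zero Z)) _) (↭.↭-reflexive (≡.cong (_++ cont (at-zero Z)) (Lₚ.++-identityʳ _))))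
        (↭.↭-trans perm (↭.↭-reflexive tail))))))

-- The sum over permutations as repeated picking

module HallLittlewoodSum (Q : QRing) (n : ℕ) (1≤n : 1 ≤ n) where
  open QRing Q
  open CommutativeRing cring hiding (zero)
  open Kit cring
  open QKit Q
  open Vandermonde cring
  open Walk Q n using (poch; mon-*)
  open Strings Q n 1≤n
  open SetoidReasoning setoid

  -- The sum over all ordered selections of k entries, hence over all arrangements when k is the
  -- length.
  permSum : ∀ {A : Set} → ℕ → (List A → Carrier) → List A → Carrier
  permSum zero    F L = F []
  permSum (suc k) F L = foc (λ p x q → permSum k (λ w → F (x ∷ w)) (p ++ q)) L

  permSum-cong : ∀ {A : Set} k {F F′ : List A → Carrier} L → length L ≡ k → (∀ w → w ↭ L → F w ≈ F′ w) →
    permSum k F L ≈ permSum k F′ L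
  permSum-cong zero    []      _   e = e [] ↭.↭-refl
  permSum-cong (suc k) L       len e = foc-congˢ (_≡ L) (λ { p x q ≡.refl → permSum-cong k (p ++ q) (rest-length p len)
    (λ w h → e (x ∷ w) (↭.↭-trans (↭.prep x h) (↭.↭-sym (↭ₚ.shift x p q)))) }) L ≡.refl

  *-permSum : ∀ {A : Set} k a (F : List A → Carrier) L → a * permSum k F L ≈ permSum k (λ w → a * F w) L
  *-permSum zero    a F L = refl
  *-permSum (suc k) a F L = trans (*-foc a _ L) (foc-cong (λ p x q → *-permSum k a (λ w → F (x ∷ w)) (p ++ q)) L)

  permSum-map : ∀ {A B : Set} (E : A → B) k F L → permSum k (F ∘ map E) L ≈ permSum k F (map E L)
  permSum-map E zero    F L = refl
  permSum-map E (suc k) F L = trans (foc-cong (λ p x q → trans (permSum-map E k (λ w → F (E x ∷ w)) (p ++ q))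
      (reflexive (≡.cong (permSum k (λ w → F (E x ∷ w))) (Lₚ.map-++ E p q)))) L)
    (sym (foc-map E _ L))

  pairProd : (ℕ → ℕ → Carrier) → List ℕ → Carrier
  pairProd f []      = 1#
  pairProd f (a ∷ w) = prod (f a) w * pairProd f w

  pairProd-focus : ∀ f → (∀ a b → f a b ≈ f b a) → ∀ p a q →
    pairProd f (p ++ a ∷ q) ≈ prod (f a) (p ++ q) * pairProd f (p ++ q)
  pairProd-focus f f-sym []      a q = refl
  pairProd-focus f f-sym (d ∷ p) a q = trans (*-cong (trans (prod-focus (f d) p) (*-congʳ (f-sym d a))) (pairProd-focus f f-sym p a q))
    (solve 4 (λ a b c d → (a :* b) :* (c :* d) := (a :* c) :* (b :* d)) refl _ _ _ _)

  monomial : List ℕ → List ℕ → Carrier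
  monomial (l ∷ ls) (a ∷ w) = mon a ^ l * monomial ls w
  monomial _        _       = 1#

  g square : ℕ → ℕ → Carrier
  g a b      = (mon a - t * mon b) * (mon a - mon b)
  square a b = (mon a - mon b) ^ 2

  g-φ : ∀ {a b} → a ≢ b → g a b ≈ square a b * φ a b
  g-φ {a} {b} a≢b = trans (*-congʳ (trans (+-congˡ (-‿cong (sym (mon-+ n b)))) (sym (φ-mul a≢b))))
    (solve 2 (λ d f → (d :* f) :* d := (d :* (d :* :1)) :* f) refl _ _)

  square-sym : ∀ a b → square a b ≈ square b a
  square-sym a b = solve 2 (λ a b → (a :- b) :* ((a :- b) :* :1) := (b :- a) :* ((b :- a) :* :1)) refl _ _

  H : List ℕ → List ℕ → Carrier
  H []       L = 1#
  H (l ∷ ls) L = foc (λ p a q → (mon (l ℕ.* a) * prod (φ a) (p ++ q)) * H ls (p ++ q)) L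

  Distinct : List ℕ → Set
  Distinct = AllPairs _≢_

  -- The first letter meets all the others, so its pair factors do not depend on how these are
  -- arranged. By `g-φ` they separate into `φ` and squared differences, and the latter collect into
  -- one symmetric product.
  permSum-H : ∀ ls L → length L ≡ length ls → Distinct L →
    permSum (length ls) (λ w → monomial ls w * pairProd g w) L ≈ pairProd square L * H ls L
  permSum-H []       []      _   _ = refl
  permSum-H (l ∷ ls) L       len d = trans (foc-congˢ (λ L′ → L′ ≡ L × Distinct L′) (λ { p a q (≡.refl , d) → term p a q len d }) L (≡.refl , d))
                                          (sym (*-foc _ _ L))
    where
    term : ∀ p a q → length (p ++ a ∷ q) ≡ suc (length ls) → Distinct (p ++ a ∷ q) →
      permSum (length ls) (λ w → (mon a ^ l * monomial ls w) * (prod (g a) w * pairProd g w)) (p ++ q) ≈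
      pairProd square (p ++ a ∷ q) * ((mon (l ℕ.* a) * prod (φ a) (p ++ q)) * H ls (p ++ q))
    term p a q len d = begin
      _ ≈⟨ permSum-cong (length ls) (p ++ q) (rest-length p len) (λ w h → trans
             (solve 4 (λ a b c d → (a :* b) :* (c :* d) := (a :* c) :* (b :* d)) refl _ _ _ _)
             (*-congʳ (*-congˡ (prod-↭ (g a) h)))) ⟩
      _ ≈⟨ sym (*-permSum (length ls) (mon a ^ l * prod (g a) (p ++ q)) _ (p ++ q)) ⟩
      (mon a ^ l * prod (g a) (p ++ q)) * permSum (length ls) (λ w → monomial ls w * pairProd g w) (p ++ q)
        ≈⟨ *-cong (*-cong (sym (mon-* l a)) (trans (prod-congᴬ (All.map g-φ (proj₁ (Duality.split-Distinct Q id p a q d)))) (prod-* _ _ (p ++ q))))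
             (permSum-H ls (p ++ q) (rest-length p len) (proj₂ (Duality.split-Distinct Q id p a q d))) ⟩
      (mon (l ℕ.* a) * (prod (square a) (p ++ q) * prod (φ a) (p ++ q))) * (pairProd square (p ++ q) * H ls (p ++ q))
        ≈⟨ solve 5 (λ m s f d h → (m :* (s :* f)) :* (d :* h) := (s :* d) :* ((m :* f) :* h)) refl _ _ _ _ _ ⟩
      (prod (square a) (p ++ q) * pairProd square (p ++ q)) * ((mon (l ℕ.* a) * prod (φ a) (p ++ q)) * H ls (p ++ q))
        ≈⟨ *-congʳ (sym (pairProd-focus square square-sym p a q)) ⟩
      _ ∎

  H′ : List ℕ → List ℕ → Carrier
  H′ []       L = 1#
  H′ (l ∷ ls) L = weighted (λ a L → mon (l ℕ.* a) * H′ ls L) L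

  H-H′ : ∀ ls L → (1# - t) ^ length ls * H ls L ≈ H′ ls L
  H-H′ []       L = *-identityˡ _
  H-H′ (l ∷ ls) L = trans (*-foc _ _ L) (foc-cong (λ p a q → trans
    (solve 5 (λ s sk m f h → (s :* sk) :* ((m :* f) :* h) := (s :* f) :* (m :* (sk :* h))) refl _ _ _ _ _)
    (*-congˡ (*-congˡ (H-H′ ls (p ++ q))))) L)

  module PF = PartialFractions cring ρ _≢_ ρ-sum ρ-three

  -- Partial fractions with all s_b = t: the first of M + 1 picks contributes 1 - t^(M+1), whatever
  -- numbers remain.
  zero-tail : ∀ M L → length L ≡ M → Distinct L → H′ (L.replicate M 0) L ≈ poch n M
  zero-tail zero    L len d = refl
  zero-tail (suc M) L len d = begin
    weighted (λ a L → mon 0 * H′ (L.replicate M 0) L) L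
      ≈⟨ foc-congˢ (λ L → Distinct L × length L ≡ suc M) (λ { p a q (d , len) →
           trans (*-congˡ (trans (*-cong mon-0 (zero-tail M (p ++ q) (rest-length p len) (proj₂ (Duality.split-Distinct Q id p a q d)))) (*-identityˡ _)))
                 (*-comm _ _) }) L (d , len) ⟩
    foc (λ p a q → poch n M * PF.residue (λ _ → t) p a q) L
      ≈⟨ sym (*-foc _ _ L) ⟩
    poch n M * foc (PF.residue (λ _ → t)) L
      ≈⟨ *-congˡ (solve 2 (λ a b → a := (a :+ b) :- b) refl _ (prod (λ _ → t) L)) ⟩
    poch n M * ((foc (PF.residue (λ _ → t)) L + prod (λ _ → t) L) - prod (λ _ → t) L)
      ≈⟨ *-congˡ (+-cong (PF.foc-residue (λ _ → t) L d) (-‿cong power)) ⟩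
    poch n (suc M) ∎
    where
    power : prod (λ _ → t) L ≈ mon (n ℕ.+ n ℕ.* M)
    power = trans (prod-const t L) (trans (reflexive (≡.cong (t ^_) len)) (trans (sym (mon-* (suc M) n))
      (mon-≡ (≡.trans (ℕₚ.*-comm (suc M) n) (ℕₚ.*-suc n M)))))

  peel-replicate : ∀ m r ls L → H′ (L.replicate r m ++ ls) L ≈ peel m r (H′ ls) L
  peel-replicate m zero    ls L = refl
  peel-replicate m (suc r) ls L = foc-cong (λ p a q → *-congˡ (*-congˡ (peel-replicate m r ls (p ++ q)))) L

  peel-tail : ∀ m r j c (τ τ′ : List ℕ → Carrier) → (∀ L → Distinct L → length L ≡ j → τ L ≈ c * τ′ L) →
    ∀ L → Distinct L → length L ≡ r ℕ.+ j → peel m r τ L ≈ c * peel m r τ′ L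
  peel-tail m zero    j c τ τ′ e L d len = e L d len
  peel-tail m (suc r) j c τ τ′ e L d len = trans (foc-congˢ (λ L → Distinct L × length L ≡ suc r ℕ.+ j) (λ { p a q (d , len) → trans
      (*-congˡ (*-congˡ (peel-tail m r j c τ τ′ e (p ++ q) (proj₂ (Duality.split-Distinct Q id p a q d)) (rest-length p len))))
      (solve 4 (λ w x c h → w :* (x :* (c :* h)) := c :* (w :* (x :* h))) refl _ _ _ _) }) L (d , len))
    (sym (*-foc c _ L))

  pick-↭ : ∀ (F : ℕ → List ℕ → Carrier) → (∀ a {L L′} → L ↭ L′ → F a L ≈ F a L′) → ∀ {L L′} → L ↭ L′ →
    foc (λ p a q → F a (p ++ q)) L ≈ foc (λ p a q → F a (p ++ q)) L′
  pick-↭ F F-↭ ↭.refl         = refl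
  pick-↭ F F-↭ (↭.prep x e)   = +-cong (F-↭ x e) (pick-↭ (λ a L → F a (x ∷ L)) (λ a h → F-↭ a (↭.prep x h)) e)
  pick-↭ F F-↭ {L′ = _ ∷ _ ∷ ys} (↭.swap x y e) = trans (+-cong (F-↭ x (↭.prep y e)) (+-cong (F-↭ y (↭.prep x e))
      (trans (pick-↭ (λ a L → F a (x ∷ y ∷ L)) (λ a h → F-↭ a (↭.prep x (↭.prep y h))) e)
             (foc-cong (λ p a q → F-↭ a (↭.swap x y (↭.↭-refl {x = p ++ q}))) ys))))
    (solve 3 (λ a b c → a :+ (b :+ c) := b :+ (a :+ c)) refl _ _ _)
  pick-↭ F F-↭ (↭.trans e e′) = trans (pick-↭ F F-↭ e) (pick-↭ F F-↭ e′)

  peel-↭ : ∀ m r τ → (∀ {L L′} → L ↭ L′ → τ L ≈ τ L′) → ∀ {L L′} → L ↭ L′ → peel m r τ L ≈ peel m r τ L′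
  peel-↭ m zero    τ τ-↭ e = τ-↭ e
  peel-↭ m (suc r) τ τ-↭ e = pick-↭ (λ a L → ((1# - t) * prod (φ a) L) * (mon (m ℕ.* a) * peel m r τ L))
    (λ a h → *-cong (*-congˡ (prod-↭ (φ a) h)) (*-congˡ (peel-↭ m r τ τ-↭ h))) e

  -- The number of zeros among the parts k, 0, …, 0 (M zeros after k).
  zeros : ℕ → ℕ → ℕ
  zeros zero    M = suc M
  zeros (suc k) M = M

  -- The contribution of the part k alone; for k = 0 this part is counted among the zeros and leaves
  -- 1.
  τ : ℕ → List ℕ → Carrier
  τ zero    = λ _ → 1#
  τ (suc k) = peel (suc k) 1 (λ _ → 1#)

  τ-↭ : ∀ k {L L′} → L ↭ L′ → τ k L ≈ τ k L′
  τ-↭ zero    e = refl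
  τ-↭ (suc k) e = peel-↭ (suc k) 1 (λ _ → 1#) (λ _ → refl) e

  tail : ∀ k M L → Distinct L → length L ≡ suc M → H′ (k ∷ L.replicate M 0) L ≈ poch n (zeros k M) * τ k L
  tail zero    M L d len = trans (zero-tail (suc M) L len d) (sym (*-identityʳ _))
  tail (suc k) M L d len = peel-tail (suc k) 1 M (poch n M) (H′ (L.replicate M 0)) (λ _ → 1#)
    (λ L d len → trans (zero-tail M L len d) (sym (*-identityʳ _))) L d len

  hall-littlewood-sum : ∀ m k r M L → Distinct L → length L ≡ r ℕ.+ suc M →
    let ls = L.replicate r m ++ k ∷ L.replicate M 0 in
    (1# - t) ^ length ls * permSum (length ls) (λ w → monomial ls w * pairProd g w) L ≈
    pairProd square L * (poch n (zeros k M) * peel m r (τ k) L)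
  hall-littlewood-sum m k r M L d len = begin
    _ ≈⟨ *-congˡ (permSum-H ls L (≡.trans len (≡.sym length-ls)) d) ⟩
    _ ≈⟨ solve 3 (λ a b c → a :* (b :* c) := b :* (a :* c)) refl _ _ _ ⟩
    pairProd square L * ((1# - t) ^ length ls * H ls L)
      ≈⟨ *-congˡ (trans (H-H′ ls L) (peel-replicate m r (k ∷ L.replicate M 0) L)) ⟩
    pairProd square L * peel m r (H′ (k ∷ L.replicate M 0)) L
      ≈⟨ *-congˡ (peel-tail m r (suc M) (poch n (zeros k M)) _ (τ k) (tail k M) L d len) ⟩
    _ ∎
    where
    ls = L.replicate r m ++ k ∷ L.replicate M 0
    length-ls : length ls ≡ r ℕ.+ suc M
    length-ls = ≡.trans (Lₚ.length-++ (L.replicate r m)) (≡.cong₂ ℕ._+_ (Lₚ.length-replicate r) (≡.cong suc (Lₚ.length-replicate M)))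

  -- The points q^a are distinct, so the specialised squared discriminant product can be cancelled
  -- factor by factor.
  prod-cancel : ∀ L → Distinct L → ∀ {x y} → pairProd square L * x ≈ pairProd square L * y → x ≈ y
  prod-cancel []      _        e = trans (sym (*-identityˡ _)) (trans e (*-identityˡ _))
  prod-cancel (a ∷ L) (a# ∷ d) e = prod-cancel L d (row L a# (trans (sym (*-assoc _ _ _)) (trans e (*-assoc _ _ _))))
    where
    row : ∀ L → All (a ≢_) L → ∀ {x y} → prod (square a) L * x ≈ prod (square a) L * y → x ≈ y
    row []      []       e = trans (sym (*-identityˡ _)) (trans e (*-identityˡ _))
    row (b ∷ L) (h ∷ hs) e = row L hs (diff-cancel h (diff-cancel h (trans (split _ _ _) (trans e (sym (split _ _ _))))))
      where
      split : ∀ d p x → d * (d * (p * x)) ≈ (d ^ 2 * p) * x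
      split = solve 3 (λ d p x → d :* (d :* (p :* x)) := ((d :* (d :* :1)) :* p) :* x) refl

  poch-cancel : ∀ M {x y} → poch n M * x ≈ poch n M * y → x ≈ y
  poch-cancel zero    e = trans (sym (*-identityˡ _)) (trans e (*-identityˡ _))
  poch-cancel (suc M) {x} {y} e = begin
    x                 ≈⟨ unit x ⟩
    i * (d * x)       ≈⟨ *-congˡ (poch-cancel M (trans (sym (*-assoc _ _ _)) (trans e (*-assoc _ _ _)))) ⟩
    i * (d * y)       ≈⟨ sym (unit y) ⟩
    y ∎
    where
    d = 1# - mon (n ℕ.+ n ℕ.* M)
    i = geo (n ℕ.+ n ℕ.* M)
    unit : ∀ x → x ≈ i * (d * x)
    unit x = trans (sym (*-identityˡ x)) (trans (*-congʳ (sym (geo-inv (ℕₚ.≤-trans 1≤n (ℕₚ.m≤m+n n _)))))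
      (solve 3 (λ d i x → (d :* i) :* x := i :* (d :* x)) refl d i x))

  -- The symbol for the parts 0 in `v` cancels against the one from `zero-tail`, and the squared
  -- differences cancel as well. What remains is b s, the specialisation of Q.
  peel-from-sum : ∀ m k r M L → Distinct L → length L ≡ r ℕ.+ suc M → ∀ v b s →
    let ls = L.replicate r m ++ k ∷ L.replicate M 0 in
    v ≈ poch n (zeros k M) * b →
    (v * pairProd square L) * s ≈ (1# - t) ^ length ls * permSum (length ls) (λ w → monomial ls w * pairProd g w) L →
    b * s ≈ peel m r (τ k) L
  peel-from-sum m k r M L d len v b s v≈ e = poch-cancel (zeros k M) (prod-cancel L d (begin
    pairProd square L * (poch n (zeros k M) * (b * s))
      ≈⟨ solve 4 (λ x p b s → x :* (p :* (b :* s)) := ((p :* b) :* x) :* s) refl _ _ _ _ ⟩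
    ((poch n (zeros k M) * b) * pairProd square L) * s
      ≈⟨ *-congʳ (*-congʳ (sym v≈)) ⟩
    (v * pairProd square L) * s
      ≈⟨ trans e (hall-littlewood-sum m k r M L d len) ⟩
    pairProd square L * (poch n (zeros k M) * peel m r (τ k) L) ∎))

-- From finitely many variables to the walk

module PeelLimit (Q : QRing) (m l k : ℕ) (k≤m : k ≤ m) where
  open QRing Q
  open CommutativeRing cring hiding (zero)
  open Kit cring
  open QKit Q
  open Order Q
  open Duality Q using (h; h-0; module Dual)
  open Dual m l k k≤m using (n; f₁; module W₁; module C₁)
  1≤n : 1 ≤ n
  1≤n = s≤s z≤n
  open Strings Q n 1≤n
  open HallLittlewoodSum Q n 1≤n using (τ; τ-↭; peel-↭)
  open SetoidReasoning setoid

  -- For j ≥ 1 a single pick weighted by q^(j a) becomes the sum defining `h`; for j = 0 both sides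
  -- are 1.
  τ-h : ∀ j {B r N} → suc (B ℕ.+ top r) ≤ N → ∀ S → W₁.Inv cs r (residues S) → Far N S →
    τ j (cont S) ≈ h W₁.u j (residues S) [mod B ]
  τ-h zero            N-large S i far = ≈⇒mod (sym (nonempty (residues S) i))
    where
    nonempty : ∀ {r} s → W₁.Inv cs r s → h W₁.u 0 s ≈ 1#
    nonempty (a ∷ s) i = h-0 W₁.u a s (proj₁ (C.Inv⇒distinct (a ∷ s) i))
  τ-h (suc j) {B} {r} N-large S i far = mod-trans (weighted-step {B} {r} N-large (λ a L → mon (suc j ℕ.* a) * 1#) S i far)
    (≈⇒mod (sym (trans (foc-map proj₁ _ S) (foc-cong (λ P α R → trans (*-comm _ _) (*-congˡ (sym (*-identityʳ _)))) S))))

  energy-0 : ∀ cs → W₁.energy (map (λ c → (c , 0)) cs) ≡ 0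
  energy-0 []       = ≡.refl
  energy-0 (_ ∷ cs) = energy-0 cs

  -- Picking does not depend on the order of the list, so 0, ..., N-1 may be rearranged into the
  -- strings that start at the origin.
  peel-limit : ∀ B r N → suc (B ℕ.+ top (r ℕ.+ 0)) ≤ N → peel m r (τ k) (upTo N) ≈ W₁.walk r f₁ C₁.origin [mod B ]
  peel-limit B r N N-large with round-robin N 0
  ... | Z , heads , far , perm = mod-trans (≈⇒mod (trans (peel-↭ m r (τ k) (τ-↭ k) (↭.↭-sym (↭.↭-trans perm (↭.↭-reflexive (Lₚ.map-id (upTo N))))))
        (trans (sym (*-identityˡ _)) (*-congʳ (sym (trans (mon-≡ (≡.trans (≡.cong (λ s → m ℕ.* W₁.energy s) at-origin) (≡.trans (≡.cong (m ℕ.*_) (energy-0 cs)) (ℕₚ.*-zeroʳ m)))) mon-0))))))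
      (mod-trans (peel-walk m r 0 N-large (τ k) (h W₁.u k) (λ S i far → τ-h k {B} {r ℕ.+ 0} N-large S i far) S₀ (≡.subst (W₁.Inv cs 0) (≡.sym at-origin) C.origin-Inv) far)
        (≈⇒mod (reflexive (≡.cong (W₁.walk r f₁) at-origin))))
    where
    S₀ = at-zero Z
    at-origin : residues S₀ ≡ C₁.origin
    at-origin = ≡.trans (≡.sym (Lₚ.map-∘ Z)) (≡.trans (Lₚ.map-∘ Z) (≡.cong (map (λ c → (c , 0))) (≡.trans heads (Lₚ.map-id (downFrom n)))))

-- Permutations as words without repetition

module PermutationSum (Q : QRing) (n : ℕ) (1≤n : 1 ≤ n) (N : ℕ) where
  open QRing Q
  open CommutativeRing cring hiding (zero)
  open Kit cring
  open HallLittlewoodSum Q n 1≤n using (permSum)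
  open SetoidReasoning setoid

  sum-filter : ∀ {A : Set} (f : A → Carrier) (P : A → Bool) xs →
    sum f (filterᵇ P xs) ≈ sum (λ x → if P x then f x else 0#) xs
  sum-filter f P []       = refl
  sum-filter f P (x ∷ xs) with P x
  ... | true  = +-congˡ (sum-filter f P xs)
  ... | false = trans (sum-filter f P xs) (sym (+-identityˡ _))

  sum-foc : ∀ {A : Set} (f : A → Carrier) L → sum f L ≈ foc (λ p x q → f x) L
  sum-foc f []      = refl
  sum-foc f (x ∷ L) = +-congˡ (sum-foc f L)

  Word : Set
  Word = List (Fin N)

  avail : Word → Word
  avail U = filterᵇ (λ y → not (elemF y U)) (allFin N)

  -- `noDup` compares a letter with the later ones, but picking compares it with the earlier ones;
  -- `fresh U` does the latter, with the letters of U already used.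
  fresh disjoint : Word → Word → Bool
  fresh U []         = true
  fresh U (x ∷ w)    = not (elemF x U) ∧ fresh (x ∷ U) w
  disjoint U []      = true
  disjoint U (x ∷ w) = not (elemF x U) ∧ disjoint U w

  disjoint-∷ : ∀ x U w → disjoint (x ∷ U) w ≡ not (elemF x w) ∧ disjoint U w
  disjoint-∷ x U []      = ≡.refl
  disjoint-∷ x U (y ∷ w) with x Finₚ.≟ y | y Finₚ.≟ x
  ... | yes _     | yes _     = ≡.refl
  ... | yes x≡y   | no y≢x    = ⊥-elim (y≢x (≡.sym x≡y))
  ... | no x≢y    | yes y≡x   = ⊥-elim (x≢y (≡.sym y≡x))
  ... | no _      | no _ rewrite disjoint-∷ x U w with elemF y U | elemF x w
  ...   | true  | true  = ≡.refl
  ...   | true  | false = ≡.refl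
  ...   | false | true  = ≡.refl
  ...   | false | false = ≡.refl

  fresh-noDup : ∀ U w → fresh U w ≡ disjoint U w ∧ noDup w
  fresh-noDup U []      = ≡.refl
  fresh-noDup U (x ∷ w) rewrite fresh-noDup (x ∷ U) w | disjoint-∷ x U w with elemF x U | elemF x w | disjoint U w
  ... | true  | _     | _     = ≡.refl
  ... | false | true  | true  = ≡.refl
  ... | false | true  | false = ≡.refl
  ... | false | false | true  = ≡.refl
  ... | false | false | false = ≡.refl

  disjoint-[] : ∀ w → disjoint [] w ≡ true
  disjoint-[] []      = ≡.refl
  disjoint-[] (x ∷ w) = disjoint-[] w

  avail-∷ : ∀ x U (L : Word) → filterᵇ (λ y → not (elemF y (x ∷ U))) L ≡ filterᵇ (λ y → not ⌊ y Finₚ.≟ x ⌋) (filterᵇ (λ y → not (elemF y U)) L)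
  avail-∷ x U []      = ≡.refl
  avail-∷ x U (y ∷ L) with elemF y U in eq | y Finₚ.≟ x in eq′
  ... | true  | yes _ = avail-∷ x U L
  ... | true  | no _  = avail-∷ x U L
  ... | false | yes _ rewrite eq′ = avail-∷ x U L
  ... | false | no _  rewrite eq′ = ≡.cong (y ∷_) (avail-∷ x U L)

  remove : ∀ p x (q : Word) → AllPairs _≢_ (p ++ x ∷ q) → filterᵇ (λ y → not ⌊ y Finₚ.≟ x ⌋) (p ++ x ∷ q) ≡ p ++ q
  remove []      x q (x# ∷ _) with x Finₚ.≟ x
  ... | no ¬e = ⊥-elim (¬e ≡.refl)
  ... | yes _ = keep q x#
    where
    keep : ∀ q → All (x ≢_) q → filterᵇ (λ y → not ⌊ y Finₚ.≟ x ⌋) q ≡ q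
    keep []      []       = ≡.refl
    keep (y ∷ q) (h ∷ hs) with y Finₚ.≟ x
    ... | yes e = ⊥-elim (h (≡.sym e))
    ... | no _  = ≡.cong (y ∷_) (keep q hs)
  remove (d ∷ p) x q (d# ∷ d′) with d Finₚ.≟ x
  ... | yes e = ⊥-elim (All.head (Allₚ.++⁻ʳ p d#) e)
  ... | no _  = ≡.cong (d ∷_) (remove p x q d′)

  allFin-distinct : AllPairs _≢_ (allFin N)
  allFin-distinct = Uniqueₚ.allFin⁺ N

  words-sum : ∀ k U F → sum (λ w → if fresh U (V.toList w) then F (V.toList w) else 0#) (words k (allFin N)) ≈ permSum k F (avail U)
  words-sum zero    U F = +-identityʳ _
  words-sum (suc k) U F = begin
    sum f (concatMap (λ x → map (x V.∷_) (words k (allFin N))) (allFin N))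
      ≈⟨ sum-concatMap f _ (allFin N) ⟩
    sum (λ x → sum f (map (x V.∷_) (words k (allFin N)))) (allFin N)
      ≈⟨ sum-cong (λ x → trans (reflexive (sum-map f (x V.∷_) (words k (allFin N)))) (first x)) (allFin N) ⟩
    sum (λ x → if not (elemF x U) then permSum k (λ w → F (x ∷ w)) (avail (x ∷ U)) else 0#) (allFin N)
      ≈⟨ sym (sum-filter _ _ (allFin N)) ⟩
    sum (λ x → permSum k (λ w → F (x ∷ w)) (avail (x ∷ U))) (avail U)
      ≈⟨ sum-foc _ (avail U) ⟩
    foc (λ p x q → permSum k (λ w → F (x ∷ w)) (avail (x ∷ U))) (avail U)
      ≈⟨ foc-congˢ (_≡ avail U) (λ p x q e → reflexive (≡.cong (permSum k (λ w → F (x ∷ w)))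
           (≡.trans (avail-∷ x U (allFin N)) (≡.trans (≡.cong (filterᵇ (λ y → not ⌊ y Finₚ.≟ x ⌋)) (≡.sym e))
             (remove p x q (≡.subst (AllPairs _≢_) (≡.sym e) (AllPairsₚ.filter⁺ _ allFin-distinct)))))))
           (avail U) ≡.refl ⟩
    permSum (suc k) F (avail U) ∎
    where
    f : Vec (Fin N) (suc k) → Carrier
    f w = if fresh U (V.toList w) then F (V.toList w) else 0#
    first : ∀ x → sum (λ w → if not (elemF x U) ∧ fresh (x ∷ U) (V.toList w) then F (x ∷ V.toList w) else 0#) (words k (allFin N))
      ≈ (if not (elemF x U) then permSum k (λ w → F (x ∷ w)) (avail (x ∷ U)) else 0#)
    first x with elemF x U in eq
    ... | true  = sum-0 (words k (allFin N)) (λ _ → refl)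
    ... | false = words-sum k (x ∷ U) (λ w → F (x ∷ w))

  perms-sum : ∀ F → sum (F ∘ V.toList) (perms N) ≈ permSum N F (allFin N)
  perms-sum F = begin
    sum (F ∘ V.toList) (perms N)
      ≈⟨ sum-filter (F ∘ V.toList) (λ w → noDup (V.toList w)) (words N (allFin N)) ⟩
    sum (λ w → if noDup (V.toList w) then F (V.toList w) else 0#) (words N (allFin N))
      ≈⟨ sum-cong (λ w → reflexive (≡.cong (λ b → if b then F (V.toList w) else 0#)
           (≡.sym (≡.trans (fresh-noDup [] (V.toList w)) (≡.cong (_∧ noDup (V.toList w)) (disjoint-[] (V.toList w))))))) (words N (allFin N)) ⟩
    sum (λ w → if fresh [] (V.toList w) then F (V.toList w) else 0#) (words N (allFin N))
      ≈⟨ words-sum N [] F ⟩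
    permSum N F (avail [])
      ≡⟨ ≡.cong (permSum N F) (all (allFin N)) ⟩
    permSum N F (allFin N) ∎
    where
    all : ∀ L → filterᵇ (λ y → not (elemF {N} y [])) L ≡ L
    all []      = ≡.refl
    all (x ∷ L) = ≡.cong (x ∷_) (all L)

-- Specialising the defining equation of the Hall-Littlewood polynomial

module SpecialisedHallLittlewood (l : ℕ) where
  n : ℕ
  n = suc l
  1≤n : 1 ≤ n
  1≤n = s≤s z≤n

  open ℤ⟦q⟧
  open Kit seriesRing using (sum; prod; _^_; ^-cong; sum-cong; prod-cong; prod-map; prod-concatMap; prod-++)
  open Specialisation n
  open HallLittlewoodSum seriesQ n 1≤n using (permSum; permSum-map; pairProd; monomial; g; square; zeros; τ; peel-from-sum)
  open Strings seriesQ n 1≤n using (peel)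
  open RightHandSide using (prod-filter)

  prod-allFin : ∀ {N} (f : Fin (suc N) → Series) → prod f (allFin (suc N)) ≈ f Fin.zero * prod (f ∘ Fin.suc) (allFin N)
  prod-allFin {N} f = *-congˡ {f Fin.zero} (reflexive (≡.trans (≡.cong (prod f) (≡.sym (Lₚ.map-tabulate id Fin.suc))) (prod-map f Fin.suc (allFin N))))

  prod-lookup : ∀ {A : Set} {N} (f : A → Series) (w : Vec A N) → prod (f ∘ lookup w) (allFin N) ≈ prod f (V.toList w)
  prod-lookup f V.[]       = refl
  prod-lookup f (a V.∷ w) = trans (prod-allFin (f ∘ lookup (a V.∷ w))) (*-congˡ {f a} (prod-lookup f w))

  upper : ∀ {N} → (Fin N → Fin N → Series) → Fin N → Fin N → Series
  upper G i j = if toℕ i ℕ.<ᵇ toℕ j then G i j else 1#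

  triangle : ∀ {N} → (Fin N → Fin N → Series) → Series
  triangle {N} G = prod (λ i → prod (upper G i) (allFin N)) (allFin N)

  triangle-suc : ∀ {N} (G : Fin (suc N) → Fin (suc N) → Series) →
    triangle G ≈ prod (G Fin.zero ∘ Fin.suc) (allFin N) * triangle (λ i j → G (Fin.suc i) (Fin.suc j))
  triangle-suc {N} G = trans (prod-allFin (λ i → prod (upper G i) (allFin (suc N))))
    (*-cong {prod (upper G Fin.zero) (allFin (suc N))} {prod (G Fin.zero ∘ Fin.suc) (allFin N)}
      {prod (λ i → prod (upper G (Fin.suc i)) (allFin (suc N))) (allFin N)} {triangle (λ i j → G (Fin.suc i) (Fin.suc j))}
      (trans (prod-allFin (upper G Fin.zero)) (*-identityˡ (prod (G Fin.zero ∘ Fin.suc) (allFin N))))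
      (prod-cong {f = λ i → prod (upper G (Fin.suc i)) (allFin (suc N))} {g = λ i → prod (upper (λ i j → G (Fin.suc i) (Fin.suc j)) i) (allFin N)}
        (λ i → trans (prod-allFin (upper G (Fin.suc i))) (*-identityˡ (prod (upper (λ i j → G (Fin.suc i) (Fin.suc j)) i) (allFin N)))) (allFin N)))

  triangle-lookup : ∀ {N} (f : ℕ → ℕ → Series) (w : Vec ℕ N) → triangle (λ i j → f (lookup w i) (lookup w j)) ≈ pairProd f (V.toList w)
  triangle-lookup f V.[]       = refl
  triangle-lookup f (a V.∷ w) = trans (triangle-suc (λ i j → f (lookup (a V.∷ w) i) (lookup (a V.∷ w) j)))
    (*-cong {prod (f a ∘ lookup w) (allFin _)} {prod (f a) (V.toList w)} {triangle (λ i j → f (lookup w i) (lookup w j))} {pairProd f (V.toList w)}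
      (prod-lookup (f a) w) (triangle-lookup f w))

  prod-ltPairs : ∀ {N} (G : Fin N × Fin N → Series) → prod G (ltPairs N) ≈ triangle (λ i j → G (i , j))
  prod-ltPairs {N} G = trans (prod-concatMap G row (allFin N)) (prod-cong {f = λ i → prod G (row i)} {g = λ i → prod (upper (λ i j → G (i , j)) i) (allFin N)} (λ i →
      trans (reflexive (prod-map G (λ j → i , j) (filterᵇ (λ j → toℕ i ℕ.<ᵇ toℕ j) (allFin N)))) (prod-filter (λ j → G (i , j)) (λ j → toℕ i ℕ.<ᵇ toℕ j) (allFin N))) (allFin N))
    where
    row : Fin N → List (Fin N × Fin N)
    row i = map (λ j → i , j) (filterᵇ (λ j → toℕ i ℕ.<ᵇ toℕ j) (allFin N))

  prod-monomial : ∀ {N} (lam : Vec ℕ N) (w : Vec ℕ N) → prod (λ i → q^ (lookup w i) ^ lookup lam i) (allFin N) ≈ monomial (V.toList lam) (V.toList w)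
  prod-monomial V.[]          V.[]       = refl
  prod-monomial (a V.∷ lam) (b V.∷ w) = trans (prod-allFin (λ i → q^ (lookup (b V.∷ w) i) ^ lookup (a V.∷ lam) i)) (*-congˡ {q^ b ^ a} (prod-monomial lam w))

  spec-wTerm : ∀ {N} (lam : Vec ℕ N) (w : Vec (Fin N) N) →
    spec (wTerm lam w) ≈ monomial (V.toList lam) (map toℕ (V.toList w)) * pairProd g (map toℕ (V.toList w))
  spec-wTerm {N} lam w = trans (spec-* (prodP (map mono-factor (allFin N))) (prodP (map pair-factor (ltPairs N))))
    (*-cong {spec (prodP (map mono-factor (allFin N)))} {monomial (V.toList lam) (map toℕ (V.toList w))}
            {spec (prodP (map pair-factor (ltPairs N)))} {pairProd g (map toℕ (V.toList w))} monomials pairs)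
    where
    w′ : Vec ℕ N
    w′ = V.map toℕ w
    mono-factor : Fin N → Poly N
    mono-factor i = powP (xP (lookup w i)) (lookup lam i)
    pair-factor : Fin N × Fin N → Poly N
    pair-factor (i , j) = (xP (lookup w i) -P tP *P xP (lookup w j)) *P (xP (lookup w i) -P xP (lookup w j))
    toList-map : V.toList w′ ≡ map toℕ (V.toList w)
    toList-map = Vₚ.toList-map toℕ w
    spec-lookup : ∀ i → spec (xP {N} (lookup w i)) ≈ q^ (lookup w′ i)
    spec-lookup i = trans (spec-x (lookup w i)) (reflexive (≡.cong q^ (≡.sym (Vₚ.lookup-map i toℕ w))))
    monomials : spec (prodP (map mono-factor (allFin N))) ≈ monomial (V.toList lam) (map toℕ (V.toList w))
    monomials = trans (spec-prod mono-factor (allFin N)) (trans (prod-cong {f = spec ∘ mono-factor} {g = λ i → q^ (lookup w′ i) ^ lookup lam i}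
        (λ i → trans (spec-pow (xP (lookup w i)) (lookup lam i)) (^-cong (lookup lam i) (spec-lookup i))) (allFin N))
      (trans (prod-monomial lam w′) (reflexive (≡.cong (monomial (V.toList lam)) toList-map))))
    pair : ∀ i j → spec (pair-factor (i , j)) ≈ g (lookup w′ i) (lookup w′ j)
    pair i j = trans (spec-* (xi -P tP *P xj) (xi -P xj)) (*-cong {spec (xi -P tP *P xj)} {q^ (lookup w′ i) - q^ n * q^ (lookup w′ j)} {spec (xi -P xj)} {q^ (lookup w′ i) - q^ (lookup w′ j)}
        (trans (spec-- xi (tP *P xj)) (+-cong {spec xi} {q^ (lookup w′ i)} (spec-lookup i) (-‿cong {spec (tP *P xj)} {q^ n * q^ (lookup w′ j)}
          (trans (spec-* tP xj) (*-cong {spec (tP {N})} {q^ n} {spec xj} {q^ (lookup w′ j)} (spec-t {N}) (spec-lookup j))))))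
        (trans (spec-- xi xj) (+-cong {spec xi} {q^ (lookup w′ i)} (spec-lookup i) (-‿cong {spec xj} {q^ (lookup w′ j)} (spec-lookup j)))))
      where
      xi = xP {N} (lookup w i)
      xj = xP {N} (lookup w j)
    pairs : spec (prodP (map pair-factor (ltPairs N))) ≈ pairProd g (map toℕ (V.toList w))
    pairs = trans (spec-prod pair-factor (ltPairs N)) (trans (prod-cong {f = spec ∘ pair-factor} {g = λ x → g (lookup w′ (proj₁ x)) (lookup w′ (proj₂ x))}
        (λ x → pair (proj₁ x) (proj₂ x)) (ltPairs N))
      (trans (prod-ltPairs (λ x → g (lookup w′ (proj₁ x)) (lookup w′ (proj₂ x)))) (trans (triangle-lookup g w′) (reflexive (≡.cong (pairProd g) toList-map)))))

  toList-tabulate : ∀ {A : Set} {N} (f : Fin N → A) → V.toList (tabulate f) ≡ L.tabulate f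
  toList-tabulate {N = zero}  f = ≡.refl
  toList-tabulate {N = suc N} f = ≡.cong (f Fin.zero ∷_) (toList-tabulate (f ∘ Fin.suc))

  tabulate-toℕ : ∀ {A : Set} N (f : ℕ → A) → L.tabulate {n = N} (f ∘ toℕ) ≡ L.applyUpTo f N
  tabulate-toℕ zero    f = ≡.refl
  tabulate-toℕ (suc N) f = ≡.cong (f 0 ∷_) (tabulate-toℕ N (f ∘ suc))

  map-toℕ-allFin : ∀ N → map toℕ (allFin N) ≡ upTo N
  map-toℕ-allFin N = ≡.trans (Lₚ.map-tabulate id toℕ) (tabulate-toℕ N id)

  spec-Δ² : ∀ N → spec (Δ² N) ≈ pairProd square (upTo N)
  spec-Δ² N = trans (spec-prod factor (ltPairs N)) (trans (prod-cong {f = spec ∘ factor} {g = λ x → square (lookup e (proj₁ x)) (lookup e (proj₂ x))}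
      (λ x → trans (spec-pow (xP (proj₁ x) -P xP (proj₂ x)) 2) (^-cong {spec (xP (proj₁ x) -P xP (proj₂ x))} {q^ (lookup e (proj₁ x)) - q^ (lookup e (proj₂ x))} 2
        (trans (spec-- (xP (proj₁ x)) (xP (proj₂ x))) (+-cong {spec (xP (proj₁ x))} {q^ (lookup e (proj₁ x))} (index (proj₁ x))
          (-‿cong {spec (xP (proj₂ x))} {q^ (lookup e (proj₂ x))} (index (proj₂ x))))))) (ltPairs N))
    (trans (prod-ltPairs (λ x → square (lookup e (proj₁ x)) (lookup e (proj₂ x)))) (trans (triangle-lookup square e)
      (reflexive (≡.cong (pairProd square) (≡.trans (toList-tabulate {N = N} toℕ) (tabulate-toℕ N id)))))))
    where
    factor : Fin N × Fin N → Poly N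
    factor (i , j) = powP (xP i -P xP j) 2
    e : Vec ℕ N
    e = tabulate toℕ
    index : ∀ i → spec (xP {N} i) ≈ q^ (lookup e i)
    index i = trans (spec-x i) (reflexive (≡.cong q^ (≡.sym (Vₚ.lookup∘tabulate toℕ i))))

  spec-tPoch : ∀ {N} M → spec (tPoch {N} M) ≈ poch n n M
  spec-tPoch {N} M = trans (spec-prod factor (upTo M)) (go M)
    where
    factor : ℕ → Poly N
    factor j = oneP -P powP tP (suc j)
    spec-factor : ∀ j → spec (factor j) ≈ 1# - q^ (n ℕ.+ n ℕ.* j)
    spec-factor j = trans (spec-- (oneP {N}) (powP tP (suc j))) (+-cong {spec (oneP {N})} {1#} (spec-1 {N}) (-‿cong {spec (powP (tP {N}) (suc j))} {q^ (n ℕ.+ n ℕ.* j)}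
      (trans (spec-pow (tP {N}) (suc j)) (trans (^-cong {spec (tP {N})} {q^ n} (suc j) (spec-t {N}))
        (trans (sym (Walk.mon-* seriesQ n (suc j) n)) (reflexive (≡.cong q^ (≡.trans (ℕₚ.*-comm (suc j) n) (ℕₚ.*-suc n j)))))))))
    go : ∀ M → prod (spec ∘ factor) (upTo M) ≈ poch n n M
    go zero    = refl
    go (suc M) = trans (reflexive (≡.cong (prod (spec ∘ factor)) (≡.sym (Lₚ.upTo-∷ʳ M)))) (trans (prod-++ (spec ∘ factor) (upTo M) (M ∷ []))
      (*-cong {prod (spec ∘ factor) (upTo M)} {poch n n M} {spec (factor M) * 1#} {1# - q^ (n ℕ.+ n ℕ.* M)} (go M) (trans (*-identityʳ (spec (factor M))) (spec-factor M))))

  -- The factor with index 0 is the symbol for the zero parts, and the remaining ones form `bfac`.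
  spec-Vfac : ∀ {N} (lam : Vec ℕ N) → spec (Vfac lam) ≈ poch n n (mult 0 lam) * spec (bfac lam)
  spec-Vfac {N} lam = trans (spec-* (f 0) (prodP (map f (L.applyUpTo suc (V.sum lam))))) (*-cong {spec (f 0)} {poch n n (mult 0 lam)}
      {spec (prodP (map f (L.applyUpTo suc (V.sum lam))))} {spec (bfac lam)} (spec-tPoch (mult 0 lam))
      (reflexive (≡.cong (λ xs → spec (prodP xs)) (≡.trans (≡.cong (map f) (≡.sym (Lₚ.map-upTo suc (V.sum lam)))) (≡.sym (Lₚ.map-∘ (upTo (V.sum lam))))))))
    where
    f : ℕ → Poly N
    f i = tPoch (mult i lam)

  toList-mrk : ∀ m k r M → V.toList (mrk m k r (r ℕ.+ suc M)) ≡ L.replicate r m ++ k ∷ L.replicate M 0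
  toList-mrk m k zero    M = ≡.cong (k ∷_) (zero-parts M)
    where
    zero-parts : ∀ M → V.toList (tabulate {n = M} (λ _ → 0)) ≡ L.replicate M 0
    zero-parts zero    = ≡.refl
    zero-parts (suc M) = ≡.cong (0 ∷_) (zero-parts M)
  toList-mrk m k (suc r) M = ≡.cong (m ∷_) (toList-mrk m k r M)

  -- Since m ≥ 1, only the part k and the padding can be 0.
  mult-0 : ∀ m k r M → 1 ≤ m → mult 0 (mrk m k r (r ℕ.+ suc M)) ≡ zeros k M
  mult-0 (suc m) k r M _ = ≡.trans (≡.cong (λ xs → length (filterᵇ (λ x → x ℕ.≡ᵇ 0) xs)) (toList-mrk (suc m) k r M)) (full r)
    where
    count : List ℕ → ℕ
    count xs = length (filterᵇ (λ x → x ℕ.≡ᵇ 0) xs)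
    all : ∀ M → count (L.replicate M 0) ≡ M
    all zero    = ≡.refl
    all (suc M) = ≡.cong suc (all M)
    last : ∀ k → count (k ∷ L.replicate M 0) ≡ zeros k M
    last zero    = ≡.cong suc (all M)
    last (suc k) = all M
    full : ∀ r → count (L.replicate r (suc m) ++ k ∷ L.replicate M 0) ≡ zeros k M
    full zero    = last k
    full (suc r) = full r

  spec-HL : ∀ m k r M → 1 ≤ m → ∀ p → let N = r ℕ.+ suc M in IsHallLittlewoodP N (mrk m k r N) p →
    spec (bfac (mrk m k r N) *P p) ≈ peel m r (τ k) (upTo N)
  spec-HL m k r M 1≤m p hyp = trans (spec-* (bfac lam) p) (peel-from-sum m k r M (upTo N)
      (Uniqueₚ.upTo⁺ N) (Lₚ.length-upTo N) (spec (Vfac lam)) (spec (bfac lam)) (spec p)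
      (trans (spec-Vfac lam) (reflexive (≡.cong (λ z → poch n n z * spec (bfac lam)) (mult-0 m k r M 1≤m))))
      (trans (sym left) (trans (spec-cong (Vfac lam *P Δ² N *P p) (powP (oneP -P tP) N *P concatMap (wTerm lam) (perms N)) hyp) right)))
    where
    N = r ℕ.+ suc M
    lam = mrk m k r N
    ls = L.replicate r m ++ k ∷ L.replicate M 0
    F : List ℕ → Series
    F w = monomial ls w * pairProd g w
    N≡ : N ≡ length ls
    N≡ = ≡.sym (≡.trans (Lₚ.length-++ (L.replicate r m)) (≡.cong₂ ℕ._+_ (Lₚ.length-replicate r) (≡.cong suc (Lₚ.length-replicate M))))
    left : spec (Vfac lam *P Δ² N *P p) ≈ (spec (Vfac lam) * pairProd square (upTo N)) * spec p
    left = trans (spec-* (Vfac lam *P Δ² N) p) (*-congʳ {spec p} {spec (Vfac lam *P Δ² N)} {spec (Vfac lam) * pairProd square (upTo N)}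
      (trans (spec-* (Vfac lam) (Δ² N)) (*-congˡ {spec (Vfac lam)} {spec (Δ² N)} {pairProd square (upTo N)} (spec-Δ² N))))
    words-spec : spec (concatMap (wTerm lam) (perms N)) ≈ permSum N F (upTo N)
    words-spec = trans (spec-concatMap (wTerm lam) (perms N))
      (trans (sum-cong {f = spec ∘ wTerm lam} {g = λ w → F (map toℕ (V.toList w))}
        (λ w → trans (spec-wTerm lam w) (reflexive (≡.cong (λ ls → monomial ls (map toℕ (V.toList w)) * pairProd g (map toℕ (V.toList w))) (toList-mrk m k r M)))) (perms N))
      (trans (PermutationSum.perms-sum seriesQ n 1≤n N (F ∘ map toℕ))
      (trans (permSum-map toℕ N F (allFin N)) (reflexive (≡.cong (permSum N F) (map-toℕ-allFin N))))))
    one-t : spec (powP (oneP -P tP) N) ≈ (1# - q^ n) ^ N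
    one-t = trans (spec-pow {N} (oneP -P tP) N) (^-cong {spec (oneP {N} -P tP)} {1# - q^ n} N
      (trans (spec-- (oneP {N}) tP) (+-cong {spec (oneP {N})} {1#} (spec-1 {N}) (-‿cong {spec (tP {N})} {q^ n} (spec-t {N})))))
    right : spec (powP (oneP -P tP) N *P concatMap (wTerm lam) (perms N)) ≈ (1# - q^ n) ^ length ls * permSum (length ls) F (upTo N)
    right = trans (spec-* (powP (oneP -P tP) N) (concatMap (wTerm lam) (perms N)))
      (trans (*-cong {spec (powP (oneP -P tP) N)} {(1# - q^ n) ^ N} {spec (concatMap (wTerm lam) (perms N))} {permSum N F (upTo N)} one-t words-spec)
        (reflexive (≡.cong (λ z → (1# - q^ n) ^ z * permSum z F (upTo N)) N≡)))

specCoeffℤ-coeffℤ : ∀ {N} n (p : Poly N) d → specCoeffℤ n p d ≡ coeffℤ (specCoeff n p) d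
specCoeffℤ-coeffℤ n p (+ d)    = ≡.refl
specCoeffℤ-coeffℤ n p -[1+ d ] = ≡.refl

theorem4p1 : (m n k : ℕ) → 1 ≤ m → 1 ≤ n → k ≤ m →
    (d : ℤ) → ∃[ R ] ((r : ℕ) → R ≤ r →
    ∃[ N₀ ] ((N : ℕ) → N₀ ≤ N → (p : Poly N) →
    IsHallLittlewoodP N (mrk m k r N) p →
    specCoeffℤ n (bfac (mrk m k r N) *P p) (d ℤ.+ + shiftExp m k r)
    ≡ coeffℤ (rhsS m n k) d))
theorem4p1 m (suc l) k 1≤m _ k≤m d =
  let R , coefficient = RightHandSide.coefficients m l k 1≤m k≤m d in
  -- `bound r` makes the strings long enough for the required precision; `suc r` leaves room for the
  -- part k after the r parts m.
  R , λ r R≤r → bound r ℕ.+ suc r , λ N N₀≤N p hyp → main r N N₀≤N p hyp (coefficient r R≤r)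
  where
  open SpecialisedHallLittlewood l using (spec-HL)
  open Order ℤ⟦q⟧.seriesQ using (_≈_[mod_]; mod-trans; ≈⇒mod)
  open Strings ℤ⟦q⟧.seriesQ (suc l) (s≤s z≤n) using (top; peel)
  open HallLittlewoodSum ℤ⟦q⟧.seriesQ (suc l) (s≤s z≤n) using (τ)
  open Duality.Dual ℤ⟦q⟧.seriesQ m l k k≤m using (f₁; module W₁; module C₁)
  -- Precision just beyond the exponent d + `shiftExp m k r` whose coefficient is read.
  order bound : ℕ → ℕ
  order r = shiftExp m k r ℕ.+ suc ℤ.∣ d ∣
  bound r = suc (order r ℕ.+ top (r ℕ.+ 0))
  main : ∀ r N → bound r ℕ.+ suc r ≤ N → (p : Poly N) → IsHallLittlewoodP N (mrk m k r N) p →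
    (∀ S → S ≈ W₁.walk r f₁ C₁.origin [mod order r ] → coeffℤ S (d ℤ.+ + shiftExp m k r) ≡ coeffℤ (rhsS m (suc l) k) d) →
    specCoeffℤ (suc l) (bfac (mrk m k r N) *P p) (d ℤ.+ + shiftExp m k r) ≡ coeffℤ (rhsS m (suc l) k) d
  main r N N₀≤N p hyp coefficient with N ∸ suc r | N-split
    where
    N-split : N ≡ r ℕ.+ suc (N ∸ suc r)
    N-split = ≡.trans (≡.sym (ℕₚ.m+[n∸m]≡n (ℕₚ.≤-trans (ℕₚ.m≤n+m (suc r) (bound r)) N₀≤N))) (≡.sym (ℕₚ.+-suc r _))
  ... | M | ≡.refl = ≡.trans (specCoeffℤ-coeffℤ (suc l) (bfac (mrk m k r N) *P p) (d ℤ.+ + shiftExp m k r)) (coefficient S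
    (mod-trans {x = S} {y = Y} {z = W₁.walk r f₁ C₁.origin} (≈⇒mod {x = S} {y = Y} (spec-HL m k r M 1≤m p hyp))
      (PeelLimit.peel-limit ℤ⟦q⟧.seriesQ m l k k≤m (order r) r N (ℕₚ.≤-trans (ℕₚ.m≤m+n (bound r) (suc r)) N₀≤N))))
    where
    S Y : Series
    S = specCoeff (suc l) (bfac (mrk m k r N) *P p)
    Y = peel m r (τ k) (upTo N)
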